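{- For every ordered graph $F$, \begin{align*} \rho_{<}(F) &= \inf\Big\{\alpha\in[0,1] : \text{for all sufficiently large } d, \text{ every graph } G \text{ on } \{0,1\}^d \text{ with } \tfrac{1}{d}\textstyle\sum_{\ell=1}^d \frac{e_\ell(G)}{\tau_{\ell,d}}\ge\alpha \text{ contains } F\Big\}\\ &= \inf\{\alpha\in[0,1] : \text{there exists } C \text{ such that every } (\alpha,C)\text{ -rich graph contains } F\}. \end{align*}
   Context: An ordered graph is a graph whose vertex set carries a total order. An ordered graph $G$ contains an ordered graph $F$ if there is an injective order-preserving map $V(F)\to V(G)$ sending edges of $F$ to edges of $G$; otherwise $G$ is $F$-free. For ordered graphs $F,G$ (with $e(G)>0$), $\rho_{<}(F,G)=\max\{e(G')/e(G): G'\subseteq G,\ G'\ F\text{ -free}\}$ and $\rho_{<}(F)=\inf_G\rho_{<}(F,G)$ over all ordered graphs $G$. For distinct $x,y\in\{0,1\}^d$, $\delta(x,y)=\min\{i: x_i\ne y_i\}$; graphs on $\{0,1\}^d$ are ordered lexicographically ($x<y$ iff $x_{\delta(x,y)}=0$). For a graph $G$ on $\{0,1\}^d$, an edge $uv$ is a level-$\ell$ edge if $\delta(u,v)=\ell$, $e_\ell(G)$ is the number of level-$\ell$ edges, and $\tau_{\ell,d}=2^{2d-\ell-1}$ is the number of pairs $\{u,v\}$ with $\delta(u,v)=\ell$. A level $\ell\in[d]$ is $\alpha$-rich if $e_\ell(G)\ge\alpha\tau_{\ell,d}$; $G$ is $(\alpha,C)$-rich if at least $C$ levels are $\alpha$-rich.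 "Every $(\alpha,C)$-rich graph" ranges over all $d$ and all such graphs on $\{0,1\}^d$. -}

module Defs where

open import Level using (Level; 0ℓ)
open import Data.Bool.Base using (Bool; true; false; _∧_; T)
open import Data.Bool.Properties using (T?; ∧-comm; T-∧)
import Data.Bool.Properties as Bool
open import Data.Empty using (⊥-elim)
open import Data.Nat.Base as ℕ using (ℕ; zero; suc; NonZero)
import Data.Nat.Properties as ℕ
open import Data.Integer.Base using (+_)
open import Data.Rational.Base as ℚ using (ℚ; 0ℚ; 1ℚ; _/_; _<_; _≤_)
import Data.Rational.Properties as ℚ
open import Data.Fin.Base as Fin using (Fin; zero; suc; toℕ)
import Data.Fin.Properties as Fin
open import Data.Fin.Subset using (Subset; _∈_; ∣_∣)
open import Data.Fin.Subset.Properties using (_∈?_)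
open import Data.List.Base using (List; []; _∷_; length; map; filter; allFin; cartesianProduct; cartesianProductWith)
open import Data.List.Membership.Propositional using (find; lose) renaming (_∈_ to _∈ᴸ_)
open import Data.List.Membership.Propositional.Properties
  using (∈-cartesianProductWith⁺; ∈-allFin; ∈-map⁺; ∈-map⁻; ∈-filter⁺; ∈-filter⁻)
open import Data.List.Relation.Unary.Any using (Any; here; there; any?)
import Data.List.Relation.Unary.All as All
open import Relation.Binary.Bundles using (DecTotalOrder)
open import Data.List.Extrema (DecTotalOrder.totalOrder ℚ.≤-decTotalOrder) using (max; ⊥≤max; xs≤max; argmax-sel)
open import Data.Product using (Σ; Σ-syntax; ∃; ∃-syntax; _×_; _,_; proj₁; proj₂)
open import Data.Sum.Base as Sum using (_⊎_)
open import Data.Vec.Base using (Vec; []; _∷_; lookup; tabulate)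
open import Data.Vec.Properties using (lookup∘tabulate; lookup⇒[]=; []=⇒lookup)
open import Algebra.Properties.CommutativeMonoid.Sum ℚ.+-0-commutativeMonoid using (sum)
open import Function.Base using (id; _∘_)
open import Function.Bundles using (Equivalence)
open import Relation.Binary.Core using (Rel)
open import Relation.Binary.PropositionalEquality
  using (_≡_; _≢_; refl; sym; trans; cong; cong₂; subst; subst₂)
open import Relation.Nullary using (¬_; Dec; yes; no; does)
open import Relation.Nullary.Decidable using (_×-dec_; _→-dec_; ¬?; map′)

private variable
  ℓ : Level
  k n d : ℕ

-- Real numbers as Dedekind cuts, given by the upper half:  x < q  is the
-- proposition that the rational q lies strictly above x.

record ℝ : Set₁ where
  field
    _<ℚ_      : ℚ → Set
    inhabited : ∃ _<ℚ_
    bounded   : ∃[ q ] ¬ (_<ℚ_ q)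
    upward    : ∀ {p q} → p < q → _<ℚ_ p → _<ℚ_ q
    open′     : ∀ {q} → _<ℚ_ q → ∃[ p ] (p < q × _<ℚ_ p)

open ℝ public

infix 4 _≤ᴿ_

_≤ᴿ_ : ℝ → ℝ → Set
x ≤ᴿ y = ∀ q → (y <ℚ q) → (x <ℚ q)

private
  q<q+1 : ∀ q → q < q ℚ.+ 1ℚ
  q<q+1 q = subst (_< q ℚ.+ 1ℚ) (ℚ.+-identityʳ q) (ℚ.+-monoʳ-< q (ℚ.positive⁻¹ 1ℚ))

fromℚ : ℚ → ℝ
fromℚ x = record
  { _<ℚ_      = x <_
  ; inhabited = x ℚ.+ 1ℚ , q<q+1 x
  ; bounded   = x , ℚ.<-irrefl refl
  ; upward    = λ p<q x<p → ℚ.<-trans x<p p<q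
  ; open′     = λ x<q → let p , x<p , p<q = ℚ.<-dense x<q in p , p<q , x<p
  }

fromℕ : ℕ → ℚ
fromℕ n = + n / 1

infixl 7 _·_

-- The product of a real number and a positive integer.

_·_ : ℝ → (n : ℕ) → .{{NonZero n}} → ℝ
x · n = record
  { _<ℚ_      = λ q → ∃[ p ] ((x <ℚ p) × p ℚ.* fromℕ n < q)
  ; inhabited = let p , x<p = inhabited x in _ , p , x<p , q<q+1 (p ℚ.* fromℕ n)
  ; bounded   = let b , x≮b = bounded x in b ℚ.* fromℕ n , λ (p , x<p , pn<bn) →
                  x≮b (upward x (ℚ.*-cancelʳ-<-nonNeg (fromℕ n)
                        {{ℚ.normalize-nonNeg n 1}} pn<bn) x<p)
  ; upward    = λ r<q (p , x<p , pn<r) → p , x<p , ℚ.<-trans pn<r r<q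
  ; open′     = λ (p , x<p , pn<q) →
                  let r , pn<r , r<q = ℚ.<-dense pn<q in r , r<q , p , x<p , pn<r
  }

IsInf : (ℝ → Set ℓ) → ℝ → Set _
IsInf S r = (∀ x → S x → r ≤ᴿ x) × (∀ t → (∀ x → S x → t ≤ᴿ x) → t ≤ᴿ r)

inf : {I : Set} (f : I → ℚ) (i₀ : I) (b : ℚ) → (∀ i → b ≤ f i) → ℝ
inf f i₀ b b≤f = record
  { _<ℚ_      = λ q → ∃[ i ] f i < q
  ; inhabited = f i₀ ℚ.+ 1ℚ , i₀ , q<q+1 (f i₀)
  ; bounded   = b , λ (i , fi<b) → ℚ.<-irrefl refl (ℚ.<-≤-trans fi<b (b≤f i))
  ; upward    = λ p<q (i , fi<p) → i , ℚ.<-trans fi<p p<q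
  ; open′     = λ (i , fi<q) → let p , fi<p , p<q = ℚ.<-dense fi<q in p , p<q , i , fi<p
  }

inf-isInf : {I : Set} (f : I → ℚ) (i₀ : I) (b : ℚ) (b≤f : ∀ i → b ≤ f i) →
            IsInf (λ x → ∃[ i ] x ≡ fromℚ (f i)) (inf f i₀ b b≤f)
inf-isInf f i₀ b b≤f =
  (λ { _ (i , refl) q fi<q → i , fi<q }) ,
  (λ t t≤ q (i , fi<q) → t≤ (fromℚ (f i)) (i , refl) q fi<q)

record Graph (V : Set) : Set where
  field
    adj        : V → V → Bool
    adj-sym    : ∀ u v → adj u v ≡ adj v u
    adj-irrefl : ∀ v → adj v v ≡ false

open Graph public

-- A finite ordered graph on n vertices is taken, up to its unique order
-- isomorphism, to be a Graph (Fin n) with the usual order of Fin n.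

e : Graph (Fin n) → ℕ
e {n} G = length (filter (λ (u , v) → (u Fin.<? v) ×-dec T? (adj G u v))
                         (cartesianProduct (allFin n) (allFin n)))

-- Between total orders, the injective order-preserving maps are exactly the
-- strictly increasing ones.

record Embedding (F : Graph (Fin k)) {V : Set} (_≺_ : Rel V 0ℓ) (G : Graph V) : Set where
  field
    to       : Fin k → V
    to-mono  : ∀ i j → i Fin.< j → to i ≺ to j
    to-edges : ∀ i j → T (adj F i j) → T (adj G (to i) (to j))

open Embedding public

-- Subgraphs may omit vertices as well as edges.

record Subgraph (G : Graph (Fin n)) : Set where
  field
    verts      : Subset n
    edges      : Graph (Fin n)
    edges⊆     : ∀ u v → T (adj edges u v) → T (adj G u v)
    edges-ends : ∀ u v → T (adj edges u v) → u ∈ verts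

open Subgraph public

SubgraphContains : {G : Graph (Fin n)} → Subgraph G → Graph (Fin k) → Set
SubgraphContains S F =
  Σ[ φ ∈ Embedding F Fin._<_ (edges S) ] (∀ i → to φ i ∈ verts S)

vectors : {A : Set} → List A → ∀ n → List (Vec A n)
vectors xs zero    = [] ∷ []
vectors xs (suc n) = cartesianProductWith _∷_ xs (vectors xs n)

bits : List Bool
bits = false ∷ true ∷ []

∈-vectors : {A : Set} {xs : List A} → (∀ x → x ∈ᴸ xs) → ∀ {n} (v : Vec A n) → v ∈ᴸ vectors xs n
∈-vectors all∈ []      = here refl
∈-vectors all∈ (x ∷ v) = ∈-cartesianProductWith⁺ _∷_ (all∈ x) (∈-vectors all∈ v)

∈-bits : ∀ b → b ∈ᴸ bits
∈-bits false = here refl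
∈-bits true  = there (here refl)

subgraphContains? : {G : Graph (Fin n)} (S : Subgraph G) (F : Graph (Fin k)) →
                    Dec (SubgraphContains S F)
subgraphContains? {n} {k} S F =
  map′ from-any to-any (any? isEmb? (vectors (allFin n) k))
  where
  IsEmb : Vec (Fin n) k → Set
  IsEmb v = (∀ i j → i Fin.< j → lookup v i Fin.< lookup v j)
          × (∀ i j → T (adj F i j) → T (adj (edges S) (lookup v i) (lookup v j)))
          × (∀ i → lookup v i ∈ verts S)

  isEmb? : ∀ v → Dec (IsEmb v)
  isEmb? v = Fin.all? (λ i → Fin.all? λ j → (i Fin.<? j) →-dec (lookup v i Fin.<? lookup v j))
       ×-dec Fin.all? (λ i → Fin.all? λ j → T? _ →-dec T? _)
       ×-dec Fin.all? (λ i → lookup v i ∈? verts S)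

  from-any : Any IsEmb (vectors (allFin n) k) → SubgraphContains S F
  from-any a = let v , _ , m , h , w = find a in
    record { to = lookup v ; to-mono = m ; to-edges = h } , w

  to-any : SubgraphContains S F → Any IsEmb (vectors (allFin n) k)
  to-any (φ , w) = lose (∈-vectors ∈-allFin (tabulate (to φ)))
    ( (λ i j i<j → subst₂ Fin._<_ (eq i) (eq j) (to-mono φ i j i<j))
    , (λ i j ij → subst₂ (λ x y → T (adj (edges S) x y)) (eq i) (eq j) (to-edges φ i j ij))
    , (λ i → subst (_∈ verts S) (eq i) (w i)) )
    where
    eq : ∀ i → to φ i ≡ lookup (tabulate (to φ)) i
    eq i = sym (lookup∘tabulate (to φ) i)

-- The subgraph with vertex set W whose edges are the edges uv of G inside W
-- that M selects in both of the positions (u , v) and (v , u).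

select : (G : Graph (Fin n)) → Subset n → Vec (Vec Bool n) n → Subgraph G
select G W M = record
  { verts      = W
  ; edges      = record
    { adj        = λ u v → adj G u v ∧ (mask u v ∧ mask v u)
    ; adj-sym    = λ u v → cong₂ _∧_ (adj-sym G u v) (∧-comm (mask u v) (mask v u))
    ; adj-irrefl = λ v → cong (_∧ (mask v v ∧ mask v v)) (adj-irrefl G v)
    }
  ; edges⊆     = λ u v t → proj₁ (split {adj G u v} t)
  ; edges-ends = λ u v t → T⇒∈
      (proj₁ (split {lookup W u} (proj₁ (split {mask u v} (proj₂ (split {adj G u v} t))))))
  }
  where
  mask : _ → _ → Bool
  mask u v = lookup W u ∧ lookup (lookup M u) v

  split : ∀ {x y} → T (x ∧ y) → T x × T y
  split = Equivalence.to T-∧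

  T⇒∈ : ∀ {u} → T (lookup W u) → u ∈ W
  T⇒∈ {u} t = lookup⇒[]= u W (Equivalence.to Bool.T-≡ t)

subgraphs : (G : Graph (Fin n)) → List (Subgraph G)
subgraphs {n} G =
  cartesianProductWith (select G) (vectors bits n) (vectors (vectors bits n) n)

ratio : {G : Graph (Fin n)} .{{_ : NonZero (e G)}} → Subgraph G → ℚ
ratio {G = G} S = + e (edges S) / e G

freeSubgraphs : Graph (Fin k) → (G : Graph (Fin n)) → List (Subgraph G)
freeSubgraphs F G = filter (λ S → ¬? (subgraphContains? S F)) (subgraphs G)

-- The default value 0 only matters when F has no vertices: otherwise the
-- empty subgraph of G is F-free.

ρ : Graph (Fin k) → (G : Graph (Fin n)) → .{{NonZero (e G)}} → ℚ
ρ F G = max 0ℚ (map ratio (freeSubgraphs F G))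

0≤ρ : (F : Graph (Fin k)) (G : Graph (Fin n)) .{{_ : NonZero (e G)}} → 0ℚ ≤ ρ F G
0≤ρ F G = ⊥≤max 0ℚ (map ratio (freeSubgraphs F G))

ρ-attained : (F : Graph (Fin k)) (G : Graph (Fin n)) .{{_ : NonZero (e G)}} →
             ρ F G ≡ 0ℚ ⊎ (Σ[ S ∈ Subgraph G ] (¬ SubgraphContains S F × ρ F G ≡ ratio S))
ρ-attained F G = Sum.map₂ from-list (argmax-sel id 0ℚ (map ratio (freeSubgraphs F G)))
  where
  from-list : ∀ {q} → q ∈ᴸ map ratio (freeSubgraphs F G) →
              Σ[ S ∈ Subgraph G ] (¬ SubgraphContains S F × q ≡ ratio S)
  from-list q∈ = let S , S∈ , eq = ∈-map⁻ ratio q∈ in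
    S , proj₂ (∈-filter⁻ (λ S → ¬? (subgraphContains? S F)) {xs = subgraphs G} S∈) , eq

private
  filter-length : {A : Set} {P Q : A → Set} (P? : ∀ x → Dec (P x)) (Q? : ∀ x → Dec (Q x)) →
                  (∀ x → does (P? x) ≡ does (Q? x)) →
                  ∀ xs → length (filter P? xs) ≡ length (filter Q? xs)
  filter-length P? Q? eq [] = refl
  filter-length P? Q? eq (x ∷ xs) with does (P? x) | does (Q? x) | eq x
  ... | true  | .true  | refl = cong suc (filter-length P? Q? eq xs)
  ... | false | .false | refl = filter-length P? Q? eq xs

e-cong : (G H : Graph (Fin n)) → (∀ u v → adj G u v ≡ adj H u v) → e G ≡ e H
e-cong {n} G H eq = filter-length _ _
  (λ (u , v) → cong (does (u Fin.<? v) ∧_) (eq u v)) (cartesianProduct (allFin n) (allFin n))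

ρ-upper : (F : Graph (Fin k)) (G : Graph (Fin n)) .{{_ : NonZero (e G)}} →
          (S : Subgraph G) → ¬ SubgraphContains S F → ratio S ≤ ρ F G
ρ-upper {n = n} F G S free = subst (_≤ ρ F G) (cong (λ m → + m / e G) (e-cong (edges S′) (edges S) same))
  (All.lookup (xs≤max 0ℚ (map ratio (freeSubgraphs F G)))
    (∈-map⁺ ratio (∈-filter⁺ (λ S → ¬? (subgraphContains? S F)) S′∈ free′)))
  where
  M : Vec (Vec Bool n) n
  M = tabulate λ u → tabulate (adj (edges S) u)

  S′ : Subgraph G
  S′ = select G (verts S) M

  S′∈ : S′ ∈ᴸ subgraphs G
  S′∈ = ∈-cartesianProductWith⁺ (select G) (∈-vectors ∈-bits (verts S))
          (∈-vectors (∈-vectors ∈-bits) M)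

  M≡ : ∀ u v → lookup (lookup M u) v ≡ adj (edges S) u v
  M≡ u v = trans (cong (λ r → lookup r v) (lookup∘tabulate (λ u → tabulate (adj (edges S) u)) u))
                 (lookup∘tabulate (adj (edges S) u) v)

  same : ∀ u v → adj (edges S′) u v ≡ adj (edges S) u v
  same u v rewrite M≡ u v | M≡ v u | adj-sym (edges S) v u
    with adj (edges S) u v in eq
  ... | false rewrite Bool.∧-zeroʳ (lookup (verts S) u) = Bool.∧-zeroʳ (adj G u v)
  ... | true
    rewrite Equivalence.to Bool.T-≡ (edges⊆ S u v (Equivalence.from Bool.T-≡ eq))
          | []=⇒lookup (edges-ends S u v (Equivalence.from Bool.T-≡ eq))
          | []=⇒lookup (edges-ends S v u
              (Equivalence.from Bool.T-≡ (trans (adj-sym (edges S) v u) eq))) = refl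

  free′ : ¬ SubgraphContains S′ F
  free′ (φ , w) = free
    ( record { to = to φ ; to-mono = to-mono φ
             ; to-edges = λ i j t → subst T (same _ _) (to-edges φ i j t) }
    , w )

K₂ : Graph (Fin 2)
K₂ = record
  { adj        = λ { zero zero → false ; zero (suc zero) → true
                   ; (suc zero) zero → true ; (suc zero) (suc zero) → false }
  ; adj-sym    = λ { zero zero → refl ; zero (suc zero) → refl
                   ; (suc zero) zero → refl ; (suc zero) (suc zero) → refl }
  ; adj-irrefl = λ { zero → refl ; (suc zero) → refl }
  }

ρ< : Graph (Fin k) → ℝ
ρ< F = inf {I = Σ[ n ∈ ℕ ] Σ[ G ∈ Graph (Fin n) ] NonZero (e G)}
           (λ (n , G , e≢0) → ρ F G {{e≢0}})
           (2 , K₂ , _) 0ℚ (λ (n , G , e≢0) → 0≤ρ F G {{e≢0}})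

Cube : ℕ → Set
Cube d = Vec Bool d

-- x ≠ y and δ(x , y) = ℓ, where a level ℓ ∈ {1, …, d} is the element of Fin d
-- whose toℕ is ℓ - 1.

Isδ : Cube d → Cube d → Fin d → Set
Isδ x y ℓ = lookup x ℓ ≢ lookup y ℓ × (∀ i → i Fin.< ℓ → lookup x i ≡ lookup y i)

isδ? : (x y : Cube d) (ℓ : Fin d) → Dec (Isδ x y ℓ)
isδ? x y ℓ = ¬? (lookup x ℓ Bool.≟ lookup y ℓ)
       ×-dec Fin.all? (λ i → (i Fin.<? ℓ) →-dec (lookup x i Bool.≟ lookup y i))

_<lex_ : Rel (Cube d) 0ℓ
x <lex y = ∃[ ℓ ] (Isδ x y ℓ × lookup x ℓ ≡ false)

_<lex?_ : (x y : Cube d) → Dec (x <lex y)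
x <lex? y = Fin.any? (λ ℓ → isδ? x y ℓ ×-dec (lookup x ℓ Bool.≟ false))

e[_] : Fin d → Graph (Cube d) → ℕ
e[_] {d} ℓ G =
  length (filter (λ (x , y) → (x <lex? y) ×-dec (isδ? x y ℓ ×-dec T? (adj G x y)))
                 (cartesianProduct (vectors bits d) (vectors bits d)))

τ : Fin d → ℕ
τ {d} ℓ = 2 ℕ.^ (2 ℕ.* d ℕ.∸ suc (toℕ ℓ) ℕ.∸ 1)

τ≢0 : (ℓ : Fin d) → NonZero (τ ℓ)
τ≢0 {d} ℓ = ℕ.m^n≢0 2 (2 ℕ.* d ℕ.∸ suc (toℕ ℓ) ℕ.∸ 1)

averageDensity : Graph (Cube d) → .{{NonZero d}} → ℚ
averageDensity {d} G = (+ 1 / d) ℚ.* sum (λ (ℓ : Fin d) → (+ e[ ℓ ] G / τ ℓ) {{τ≢0 ℓ}})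

Rich : ℝ → Graph (Cube d) → Fin d → Set
Rich α G ℓ = (α · τ ℓ) {{τ≢0 ℓ}} ≤ᴿ fromℚ (fromℕ (e[ ℓ ] G))

RichGraph : ℝ → ℕ → Graph (Cube d) → Set
RichGraph {d} α C G = Σ[ L ∈ Subset d ] (C ℕ.≤ ∣ L ∣ × (∀ ℓ → ℓ ∈ L → Rich α G ℓ))

_∈[0,1] : ℝ → Set
α ∈[0,1] = fromℚ 0ℚ ≤ᴿ α × α ≤ᴿ fromℚ 1ℚ

AverageThreshold : Graph (Fin k) → ℝ → Set
AverageThreshold F α =
  α ∈[0,1] ×
  (∃[ d₀ ] (∀ d .{{_ : NonZero d}} → d₀ ℕ.≤ d → (G : Graph (Cube d)) →
              α ≤ᴿ fromℚ (averageDensity G) → Embedding F _<lex_ G))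

RichThreshold : Graph (Fin k) → ℝ → Set
RichThreshold F α =
  α ∈[0,1] ×
  (∃[ C ] (∀ d (G : Graph (Cube d)) → RichGraph α C G → Embedding F _<lex_ G))

-- Both thresholds are compared with ρ< F through rationals.
--
-- If ρ F G < p for some G, then every H with enough levels of density at least p contains F. Embed
-- G greedily as a caterpillar: the least remaining vertex turns left at a rich level while the
-- others turn right, and its edges become unary functions of the vertices still to be placed.
-- Conditioning on the turns biases the averages, but if the level is one of m candidates, the total
-- bias is a covariance with the sum of m random signs, hence O(√m). So the image keeps a
-- proportion p - o(1) > ρ F G of the edges of G, and the edges kept form a graph containing F.
--
-- Conversely, if average density p suffices and p < q, a graph G with ρ F G < q is obtained by
-- unweighting: the pairs of cube points at level ℓ should carry weight 1 / τ ℓ, which is simulated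
-- by a blow-up of the cube covered uniformly by copies of the complete graph on the cube. The
-- proportion of edges in a subgraph is then the mean over the copies of its average density.

{-# OPTIONS --safe #-}
module Submission where

open import Defs
open import Data.Bool.Base using (Bool; true; false; T; _∧_; _xor_; not)
import Data.Bool.Properties as Bool
open import Data.Empty using (⊥-elim)
open import Data.Fin.Base as Fin using (Fin; zero; suc; toℕ)
import Data.Fin.Properties as Fin
open import Data.Fin.Subset using (Subset; _∈_; ∣_∣; ⊤)
open import Data.Fin.Subset.Properties using (∈⊤)
open import Data.Integer.Base as ℤ using ()
import Data.Integer.Properties as ℤ
open import Data.List.Base as List
  using (List; []; _∷_; _++_; length; map; filter; allFin; cartesianProduct)
open import Data.List.Membership.Propositional.Properties using (∈-lookup)
import Data.List.Properties as List
open import Data.List.Relation.Unary.All as All using (All; []; _∷_)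
import Data.List.Relation.Unary.All.Properties as All
open import Data.List.Relation.Unary.AllPairs using (AllPairs; []; _∷_)
import Data.List.Relation.Unary.AllPairs.Properties as AllPairs
open import Data.Nat.Base as ℕ using (ℕ; zero; suc; NonZero)
import Data.Nat.Properties as ℕ
open import Data.Product using (Σ-syntax; ∃; ∃-syntax; _×_; _,_; proj₁; proj₂)
open import Data.Rational.Base as ℚ
  using (ℚ; mkℚ; ↥_; 0ℚ; 1ℚ; ½; _+_; _*_; _-_; -_; _/_; 1/_; _≤_; _<_; toℚᵘ; nonNegative; positive)
import Data.Rational.Properties as ℚ
import Data.Rational.Unnormalised.Base as ℚᵘ
import Data.Rational.Unnormalised.Properties as ℚᵘ
open import Data.Sum.Base using (_⊎_; inj₁; inj₂; [_,_]′)
import Data.Unit.Base as Unit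
open import Data.Vec.Base as Vec using (Vec; []; _∷_; lookup; here; there)
import Data.Vec.Properties as Vec
open import Algebra.Properties.CommutativeMonoid.Sum ℚ.+-0-commutativeMonoid using (sum)
open import Function.Base using (_∘_; id)
open import Function.Bundles using (Equivalence)
open import Relation.Binary.Definitions using (Tri; tri<; tri≈; tri>)
open import Relation.Binary.PropositionalEquality
  using (_≡_; _≢_; refl; sym; trans; cong; cong₂; subst; subst₂; module ≡-Reasoning)
open import Relation.Nullary using (¬_; Dec; yes; no; does; dec⇒maybe)
open import Relation.Nullary.Decidable using (_×-dec_; dec-true; dec-false)
open import Tactic.RingSolver using (solve-∀)
open import Tactic.RingSolver.Core.AlmostCommutativeRing using (AlmostCommutativeRing; fromCommutativeRing)

-- The comparison is a cycle: `ρ F G < p` makes rich levels of density `p` sufficient, this makes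
-- average density `q` sufficient for every `q > p`, and that puts `ρ< F` below every positive
-- rational above `q`. So the lower bound for rich thresholds passes through average densities. Each
-- passage costs an arbitrarily small rational, which open upper cuts absorb.
--
-- The obstacle in the unweighting is that a subgraph may omit vertices. An embedding of `F` into a
-- dense copy sends the ends of edges to kept vertices, but an isolated vertex of `F` may land on an
-- omitted one. Hence the blow-up carries labels besides codes: many labels have dense copies, by
-- pigeonhole many of these omit the same points, and `2 k + 1` such labels leave room to move
-- isolated vertices to kept points of other copies while all edges stay in one copy.

-- Rational arithmetic and naturals as rationals

ring : AlmostCommutativeRing _ _
ring = fromCommutativeRing ℚ.+-*-commutativeRing (λ x → dec⇒maybe (0ℚ ℚ.≟ x))

<⇒≱ : ∀ {p q} → p < q → ¬ (q ≤ p)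
<⇒≱ p<q q≤p = ℚ.<-irrefl refl (ℚ.<-≤-trans p<q q≤p)

0≤1 : 0ℚ ≤ 1ℚ
0≤1 = ℚ.nonNegative⁻¹ 1ℚ

0≤½ : 0ℚ ≤ ½
0≤½ = ℚ.nonNegative⁻¹ ½

½-double : ∀ a → ½ * (a + a) ≡ a
½-double = solve-∀ ring

0≤-+ : ∀ {p q} → 0ℚ ≤ p → 0ℚ ≤ q → 0ℚ ≤ p + q
0≤-+ {p} {q} 0≤p 0≤q = subst (_≤ p + q) (ℚ.+-identityˡ 0ℚ) (ℚ.+-mono-≤ 0≤p 0≤q)

*-monoˡ : ∀ {r p q} → 0ℚ ≤ r → p ≤ q → r * p ≤ r * q
*-monoˡ {r} 0≤r = ℚ.*-monoˡ-≤-nonNeg r {{nonNegative 0≤r}}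

*-monoʳ : ∀ {r p q} → 0ℚ ≤ r → p ≤ q → p * r ≤ q * r
*-monoʳ {r} 0≤r = ℚ.*-monoʳ-≤-nonNeg r {{nonNegative 0≤r}}

*-mono : ∀ {p q r s} → 0ℚ ≤ p → 0ℚ ≤ s → p ≤ q → r ≤ s → p * r ≤ q * s
*-mono 0≤p 0≤s p≤q r≤s = ℚ.≤-trans (*-monoˡ 0≤p r≤s) (*-monoʳ 0≤s p≤q)

0≤-* : ∀ {p q} → 0ℚ ≤ p → 0ℚ ≤ q → 0ℚ ≤ p * q
0≤-* {p} {q} 0≤p 0≤q = subst (_≤ p * q) (ℚ.*-zeroʳ p) (*-monoˡ 0≤p 0≤q)

0<-* : ∀ {p q} → 0ℚ < p → 0ℚ < q → 0ℚ < p * q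
0<-* {p} {q} 0<p 0<q = subst (_< p * q) (ℚ.*-zeroʳ p) (ℚ.*-monoʳ-<-pos p {{positive 0<p}} 0<q)

*-monoˡ-< : ∀ {r p q} → 0ℚ < r → p < q → r * p < r * q
*-monoˡ-< {r} 0<r = ℚ.*-monoʳ-<-pos r {{positive 0<r}}

*-cancelˡ-≤ : ∀ {r p q} → 0ℚ < r → r * p ≤ r * q → p ≤ q
*-cancelˡ-≤ {r} 0<r = ℚ.*-cancelˡ-≤-pos r {{positive 0<r}}

*-cancelˡ-≡ : ∀ {r p q} → 0ℚ < r → r * p ≡ r * q → p ≡ q
*-cancelˡ-≡ 0<r eq = ℚ.≤-antisym (*-cancelˡ-≤ 0<r (ℚ.≤-reflexive eq))
                                 (*-cancelˡ-≤ 0<r (ℚ.≤-reflexive (sym eq)))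

≤-by : ∀ {p q r} → 0ℚ ≤ r → p + r ≡ q → p ≤ q
≤-by {p} {q} {r} 0≤r eq = subst₂ _≤_ (ℚ.+-identityʳ p) eq (ℚ.+-monoʳ-≤ p 0≤r)

<-by : ∀ {p q r} → 0ℚ < r → p + r ≡ q → p < q
<-by {p} {q} {r} 0<r eq = subst₂ _<_ (ℚ.+-identityʳ p) eq (ℚ.+-monoʳ-< p 0<r)

≤⇒0≤- : ∀ {p q} → p ≤ q → 0ℚ ≤ q - p
≤⇒0≤- {p} {q} p≤q = subst (_≤ q - p) (ℚ.+-inverseʳ p) (ℚ.+-monoˡ-≤ (- p) p≤q)

<⇒0<- : ∀ {p q} → p < q → 0ℚ < q - p
<⇒0<- {p} {q} p<q = subst (_< q - p) (ℚ.+-inverseʳ p) (ℚ.+-monoˡ-< (- p) p<q)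

0≤-sq : ∀ p → 0ℚ ≤ p * p
0≤-sq p with ℚ.≤-total 0ℚ p
... | inj₁ 0≤p = 0≤-* 0≤p 0≤p
... | inj₂ p≤0 = subst (0ℚ ≤_) (neg² p) (0≤-* 0≤-p 0≤-p)
  where
  neg² : ∀ p → (0ℚ - p) * (0ℚ - p) ≡ p * p
  neg² = solve-∀ ring
  0≤-p = ≤⇒0≤- p≤0

¬half-sum-< : ∀ {a b p q} → a ≤ p → b ≤ q → ¬ (½ * (p + q) < ½ * (a + b))
¬half-sum-< a≤p b≤q lt =
  <⇒≱ lt (*-monoˡ 0≤½ (ℚ.+-mono-≤ a≤p b≤q))

half-<-max : ∀ {a p q} → a < ½ * (p + q) → a < p ⊎ a < q
half-<-max {a} {p} {q} a< with a ℚ.<? p | a ℚ.<? q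
... | yes a<p | _       = inj₁ a<p
... | no _    | yes a<q = inj₂ a<q
... | no a≮p  | no a≮q  = ⊥-elim (¬half-sum-< (ℚ.≮⇒≥ a≮p) (ℚ.≮⇒≥ a≮q) (subst (_< ½ * (p + q)) (sym (½-double a)) a<))

half-≤-max : ∀ {a b p q} → ½ * (a + b) ≤ ½ * (p + q) → a ≤ p ⊎ b ≤ q
half-≤-max {a} {b} {p} {q} le with a ℚ.≤? p | b ℚ.≤? q
... | yes a≤p | _       = inj₁ a≤p
... | no _    | yes b≤q = inj₂ b≤q
... | no a≰p  | no b≰q  =
  ⊥-elim (<⇒≱ (*-monoˡ-< (ℚ.positive⁻¹ ½) (ℚ.+-mono-< (ℚ.≰⇒> a≰p) (ℚ.≰⇒> b≰q))) le)

toℚᵘ-fromℕ : ∀ n → toℚᵘ (fromℕ n) ℚᵘ.≃ (ℤ.+ n ℚᵘ./ 1)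
toℚᵘ-fromℕ n = ℚ.toℚᵘ-fromℚᵘ (ℤ.+ n ℚᵘ./ 1)

fromℕ-+ : ∀ m n → fromℕ (m ℕ.+ n) ≡ fromℕ m + fromℕ n
fromℕ-+ m n = ℚ.toℚᵘ-injective (begin
  toℚᵘ (fromℕ (m ℕ.+ n))            ≈⟨ toℚᵘ-fromℕ (m ℕ.+ n) ⟩
  (ℤ.+ (m ℕ.+ n) ℚᵘ./ 1)              ≈⟨ ℚᵘ.*≡* (cong (ℤ._* ℤ.+ 1) (sym (cong₂ ℤ._+_ (ℤ.*-identityʳ (ℤ.+ m)) (ℤ.*-identityʳ (ℤ.+ n))))) ⟩
  (ℤ.+ m ℚᵘ./ 1) ℚᵘ.+ (ℤ.+ n ℚᵘ./ 1)    ≈⟨ ℚᵘ.+-cong (ℚᵘ.≃-sym (toℚᵘ-fromℕ m)) (ℚᵘ.≃-sym (toℚᵘ-fromℕ n)) ⟩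
  toℚᵘ (fromℕ m) ℚᵘ.+ toℚᵘ (fromℕ n) ≈⟨ ℚᵘ.≃-sym (ℚ.toℚᵘ-homo-+ (fromℕ m) (fromℕ n)) ⟩
  toℚᵘ (fromℕ m + fromℕ n)          ∎)
  where open ℚᵘ.≃-Reasoning

fromℕ-* : ∀ m n → fromℕ (m ℕ.* n) ≡ fromℕ m * fromℕ n
fromℕ-* zero    n = sym (ℚ.*-zeroˡ (fromℕ n))
fromℕ-* (suc m) n = begin
  fromℕ (n ℕ.+ m ℕ.* n)       ≡⟨ fromℕ-+ n (m ℕ.* n) ⟩
  fromℕ n + fromℕ (m ℕ.* n)   ≡⟨ cong (fromℕ n +_) (fromℕ-* m n) ⟩
  fromℕ n + fromℕ m * fromℕ n ≡⟨ distrib (fromℕ m) (fromℕ n) ⟩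
  (1ℚ + fromℕ m) * fromℕ n    ≡⟨ cong (_* fromℕ n) (sym (fromℕ-+ 1 m)) ⟩
  fromℕ (suc m) * fromℕ n     ∎
  where
  open ≡-Reasoning
  distrib : ∀ p q → q + p * q ≡ (1ℚ + p) * q
  distrib = solve-∀ ring

fromℕ-suc : ∀ n → fromℕ (suc n) ≡ 1ℚ + fromℕ n
fromℕ-suc = fromℕ-+ 1

0≤fromℕ : ∀ n → 0ℚ ≤ fromℕ n
0≤fromℕ n = ℚ.nonNegative⁻¹ (fromℕ n) {{ℚ.normalize-nonNeg n 1}}

fromℕ-mono : ∀ {m n} → m ℕ.≤ n → fromℕ m ≤ fromℕ n
fromℕ-mono {m} {n} m≤n = ≤-by (0≤fromℕ (n ℕ.∸ m))
  (trans (sym (fromℕ-+ m (n ℕ.∸ m))) (cong fromℕ (ℕ.m+[n∸m]≡n m≤n)))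

0<fromℕ : ∀ n .{{_ : NonZero n}} → 0ℚ < fromℕ n
0<fromℕ (suc n) = ℚ.<-≤-trans (ℚ.positive⁻¹ 1ℚ) (fromℕ-mono {1} {suc n} (ℕ.s≤s ℕ.z≤n))

fromℕ-cancel-≤ : ∀ {m n} → fromℕ m ≤ fromℕ n → m ℕ.≤ n
fromℕ-cancel-≤ {m} {n} le with m ℕ.≤? n
... | yes m≤n = m≤n
... | no m≰n = ⊥-elim (<⇒≱ (ℚ.<-≤-trans
      (<-by (ℚ.positive⁻¹ 1ℚ) (trans (ℚ.+-comm (fromℕ n) 1ℚ) (sym (fromℕ-suc n))))
      (fromℕ-mono (ℕ.≰⇒> m≰n))) le)

/-fromℕ : ∀ a b .{{_ : NonZero b}} → (ℤ.+ a / b) * fromℕ b ≡ fromℕ a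
/-fromℕ a b@(suc b-1) = ℚ.toℚᵘ-injective (begin
  toℚᵘ ((ℤ.+ a / b) * fromℕ b)           ≈⟨ ℚ.toℚᵘ-homo-* (ℤ.+ a / b) (fromℕ b) ⟩
  toℚᵘ (ℤ.+ a / b) ℚᵘ.* toℚᵘ (fromℕ b)   ≈⟨ ℚᵘ.*-cong (ℚ.toℚᵘ-fromℚᵘ (ℤ.+ a ℚᵘ./ b)) (toℚᵘ-fromℕ b) ⟩
  (ℤ.+ a ℚᵘ./ b) ℚᵘ.* (ℤ.+ b ℚᵘ./ 1)       ≈⟨ ℚᵘ.*≡* eq ⟩
  (ℤ.+ a ℚᵘ./ 1)                         ≈⟨ ℚᵘ.≃-sym (toℚᵘ-fromℕ a) ⟩
  toℚᵘ (fromℕ a)                       ∎)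
  where
  open ℚᵘ.≃-Reasoning
  eq : (ℤ.+ a ℤ.* ℤ.+ b) ℤ.* ℤ.+ 1 ≡ ℤ.+ a ℤ.* ℤ.+ (b ℕ.* 1)
  eq = trans (ℤ.*-identityʳ (ℤ.+ a ℤ.* ℤ.+ b)) (cong (λ n → ℤ.+ a ℤ.* ℤ.+ n) (sym (ℕ.*-identityʳ b)))

0≤/ : ∀ a b .{{_ : NonZero b}} → 0ℚ ≤ ℤ.+ a / b
0≤/ a b = ℚ.nonNegative⁻¹ (ℤ.+ a / b) {{ℚ.normalize-nonNeg a b}}

archimedean : ∀ q → ∃[ n ] q < fromℕ n
-- The denominator is at least 1, so `q` is at most the absolute value of its numerator.
archimedean q = ℕ.suc ℤ.∣ ↥ q ∣ , ℚ.toℚᵘ-cancel-< (ℚᵘ.<-respʳ-≃ (ℚᵘ.≃-sym (toℚᵘ-fromℕ _)) (bound q))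
  where
  bound : ∀ q → toℚᵘ q ℚᵘ.< (ℤ.+ suc ℤ.∣ ↥ q ∣ ℚᵘ./ 1)
  bound q@(mkℚ n d _) = ℚᵘ.*<* (ℤ.<-≤-trans lt (ℤ.+≤+ (ℕ.m≤m*n (suc ℤ.∣ n ∣) (suc d))))
    where
    abs≥ : ∀ n → n ℤ.≤ ℤ.+ ℤ.∣ n ∣
    abs≥ (ℤ.+ n)           = ℤ.≤-refl
    abs≥ ℤ.-[1+ n ]      = ℤ.-≤+
    lt : n ℤ.* ℤ.+ 1 ℤ.< ℤ.+ suc ℤ.∣ n ∣
    lt = subst (ℤ._< ℤ.+ suc ℤ.∣ n ∣) (sym (ℤ.*-identityʳ n))
           (ℤ.≤-<-trans (abs≥ n) (ℤ.+<+ (ℕ.n<1+n _)))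

𝟙 : Bool → ℚ
𝟙 false = 0ℚ
𝟙 true  = 1ℚ

0≤𝟙 : ∀ b → 0ℚ ≤ 𝟙 b
0≤𝟙 false = ℚ.≤-refl
0≤𝟙 true  = 0≤1

𝟙≤1 : ∀ b → 𝟙 b ≤ 1ℚ
𝟙≤1 false = 0≤1
𝟙≤1 true  = ℚ.≤-refl

𝟙-∧ : ∀ a b → 𝟙 (a ∧ b) ≡ 𝟙 a * 𝟙 b
𝟙-∧ false b = sym (ℚ.*-zeroˡ (𝟙 b))
𝟙-∧ true  b = sym (ℚ.*-identityˡ (𝟙 b))

does-cong : ∀ {A B : Set} (a? : Dec A) (b? : Dec B) → (A → B) → (B → A) → does a? ≡ does b?
does-cong (yes a) b?     f g = sym (dec-true b? (f a))
does-cong (no ¬a) b?     f g = sym (dec-false b? (¬a ∘ g))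

-- Averages over the cube

𝔼 : ∀ {d} → (Cube d → ℚ) → ℚ
𝔼 {zero}  f = f []
𝔼 {suc d} f = ½ * (𝔼 (λ x → f (false ∷ x)) + 𝔼 (λ x → f (true ∷ x)))

𝔼-cong : ∀ {d} {f g : Cube d → ℚ} → (∀ x → f x ≡ g x) → 𝔼 f ≡ 𝔼 g
𝔼-cong {zero}  eq = eq []
𝔼-cong {suc d} eq = cong (½ *_) (cong₂ _+_ (𝔼-cong (λ x → eq (false ∷ x))) (𝔼-cong (λ x → eq (true ∷ x))))

𝔼-mono : ∀ {d} {f g : Cube d → ℚ} → (∀ x → f x ≤ g x) → 𝔼 f ≤ 𝔼 g
𝔼-mono {zero}  le = le []
𝔼-mono {suc d} le = *-monoˡ 0≤½ (ℚ.+-mono-≤ (𝔼-mono (λ x → le (false ∷ x))) (𝔼-mono (λ x → le (true ∷ x))))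

𝔼-+ : ∀ {d} (f g : Cube d → ℚ) → 𝔼 (λ x → f x + g x) ≡ 𝔼 f + 𝔼 g
𝔼-+ {zero}  f g = refl
𝔼-+ {suc d} f g = trans
  (cong (½ *_) (cong₂ _+_ (𝔼-+ (λ x → f (false ∷ x)) (λ x → g (false ∷ x)))
                          (𝔼-+ (λ x → f (true ∷ x)) (λ x → g (true ∷ x)))))
  (rearrange (𝔼 (λ x → f (false ∷ x))) (𝔼 (λ x → g (false ∷ x))) (𝔼 (λ x → f (true ∷ x))) (𝔼 (λ x → g (true ∷ x))))
  where
  rearrange : ∀ a b c d → ½ * ((a + b) + (c + d)) ≡ ½ * (a + c) + ½ * (b + d)
  rearrange = solve-∀ ring

𝔼-* : ∀ {d} c (f : Cube d → ℚ) → 𝔼 (λ x → c * f x) ≡ c * 𝔼 f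
𝔼-* {zero}  c f = refl
𝔼-* {suc d} c f = trans
  (cong (½ *_) (cong₂ _+_ (𝔼-* c (λ x → f (false ∷ x))) (𝔼-* c (λ x → f (true ∷ x)))))
  (rearrange c (𝔼 (λ x → f (false ∷ x))) (𝔼 (λ x → f (true ∷ x))))
  where
  rearrange : ∀ c a b → ½ * (c * a + c * b) ≡ c * (½ * (a + b))
  rearrange = solve-∀ ring

𝔼-const : ∀ {d} c → 𝔼 {d} (λ _ → c) ≡ c
𝔼-const {zero}  c = refl
𝔼-const {suc d} c = trans (cong (λ a → ½ * (a + a)) (𝔼-const {d} c)) (½-double c)

𝔼-swap : ∀ {d d′} (f : Cube d → Cube d′ → ℚ) →
         𝔼 (λ x → 𝔼 (λ y → f x y)) ≡ 𝔼 (λ y → 𝔼 (λ x → f x y))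
𝔼-swap {zero}  f = refl
𝔼-swap {suc d} f = begin
  ½ * (𝔼 (λ x → 𝔼 (λ y → f (false ∷ x) y)) + 𝔼 (λ x → 𝔼 (λ y → f (true ∷ x) y)))
    ≡⟨ cong (½ *_) (cong₂ _+_ (𝔼-swap (λ x → f (false ∷ x))) (𝔼-swap (λ x → f (true ∷ x)))) ⟩
  ½ * (𝔼 (λ y → 𝔼 (λ x → f (false ∷ x) y)) + 𝔼 (λ y → 𝔼 (λ x → f (true ∷ x) y)))
    ≡⟨ cong (½ *_) (sym (𝔼-+ (λ y → 𝔼 (λ x → f (false ∷ x) y)) (λ y → 𝔼 (λ x → f (true ∷ x) y)))) ⟩
  ½ * 𝔼 (λ y → 𝔼 (λ x → f (false ∷ x) y) + 𝔼 (λ x → f (true ∷ x) y))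
    ≡⟨ sym (𝔼-* ½ (λ y → 𝔼 (λ x → f (false ∷ x) y) + 𝔼 (λ x → f (true ∷ x) y))) ⟩
  𝔼 (λ y → 𝔼 (λ x → f x y)) ∎
  where open ≡-Reasoning

𝔼-≤-attained : ∀ {d} (f : Cube d → ℚ) → ∃[ x ] 𝔼 f ≤ f x
𝔼-≤-attained {zero}  f = [] , ℚ.≤-refl
𝔼-≤-attained {suc d} f
  with x , le₀ ← 𝔼-≤-attained (λ x → f (false ∷ x)) | y , le₁ ← 𝔼-≤-attained (λ x → f (true ∷ x))
  with ℚ.≤-total (f (false ∷ x)) (f (true ∷ y))
... | inj₁ le = true ∷ y , ℚ.≤-trans (*-monoˡ 0≤½ (ℚ.+-mono-≤ (ℚ.≤-trans le₀ le) le₁)) (ℚ.≤-reflexive (½-double _))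
... | inj₂ le = false ∷ x , ℚ.≤-trans (*-monoˡ 0≤½ (ℚ.+-mono-≤ le₀ (ℚ.≤-trans le₁ le))) (ℚ.≤-reflexive (½-double _))

𝔼-++ : ∀ d {d′} (f : Cube (d ℕ.+ d′) → ℚ) → 𝔼 f ≡ 𝔼 {d} (λ x → 𝔼 {d′} (λ y → f (x Vec.++ y)))
𝔼-++ zero    f = refl
𝔼-++ (suc d) f = cong (½ *_) (cong₂ _+_ (𝔼-++ d (λ x → f (false ∷ x))) (𝔼-++ d (λ x → f (true ∷ x))))

𝔼-≥0 : ∀ {d} {f : Cube d → ℚ} → (∀ x → 0ℚ ≤ f x) → 0ℚ ≤ 𝔼 f
𝔼-≥0 {d} {f} le = subst (_≤ 𝔼 f) (𝔼-const {d} 0ℚ) (𝔼-mono le)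

𝔼-≤1 : ∀ {d} {f : Cube d → ℚ} → (∀ x → f x ≤ 1ℚ) → 𝔼 f ≤ 1ℚ
𝔼-≤1 {d} {f} le = subst (𝔼 f ≤_) (𝔼-const {d} 1ℚ) (𝔼-mono le)

-- Finite sums and counting

∑ : ∀ {A : Set} → List A → (A → ℚ) → ℚ
∑ []       f = 0ℚ
∑ (x ∷ xs) f = f x + ∑ xs f

∑-cong : ∀ {A : Set} (xs : List A) {f g : A → ℚ} → (∀ x → f x ≡ g x) → ∑ xs f ≡ ∑ xs g
∑-cong []       eq = refl
∑-cong (x ∷ xs) eq = cong₂ _+_ (eq x) (∑-cong xs eq)

∑-++ : ∀ {A : Set} (xs ys : List A) f → ∑ (xs ++ ys) f ≡ ∑ xs f + ∑ ys f
∑-++ []       ys f = sym (ℚ.+-identityˡ (∑ ys f))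
∑-++ (x ∷ xs) ys f = trans (cong (f x +_) (∑-++ xs ys f)) (sym (ℚ.+-assoc (f x) (∑ xs f) (∑ ys f)))

∑-map : ∀ {A B : Set} (h : B → A) (xs : List B) f → ∑ (map h xs) f ≡ ∑ xs (f ∘ h)
∑-map h []       f = refl
∑-map h (x ∷ xs) f = cong (f (h x) +_) (∑-map h xs f)

∑-cartesianProduct : ∀ {A B : Set} (xs : List A) (ys : List B) f →
                     ∑ (cartesianProduct xs ys) f ≡ ∑ xs (λ x → ∑ ys (λ y → f (x , y)))
∑-cartesianProduct []       ys f = refl
∑-cartesianProduct (x ∷ xs) ys f = trans (∑-++ (map (x ,_) ys) _ f)
  (cong₂ _+_ (∑-map (x ,_) ys f) (∑-cartesianProduct xs ys f))

fromℕ-length-filter : ∀ {A : Set} {P : A → Set} (P? : ∀ x → Dec (P x)) (xs : List A) →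
                      fromℕ (length (filter P? xs)) ≡ ∑ xs (λ x → 𝟙 (does (P? x)))
fromℕ-length-filter P? [] = refl
fromℕ-length-filter P? (x ∷ xs) with does (P? x)
... | false = trans (fromℕ-length-filter P? xs) (sym (ℚ.+-identityˡ _))
... | true  = trans (fromℕ-suc (length (filter P? xs))) (cong (1ℚ +_) (fromℕ-length-filter P? xs))

∑-cube : ∀ d (f : Cube d → ℚ) → ∑ (vectors bits d) f ≡ fromℕ (2 ℕ.^ d) * 𝔼 f
∑-cube zero    f = trans (ℚ.+-identityʳ (f [])) (sym (ℚ.*-identityˡ (f [])))
∑-cube (suc d) f = begin
  ∑ (map (false ∷_) V ++ (map (true ∷_) V ++ [])) f
    ≡⟨ ∑-++ (map (false ∷_) V) _ f ⟩
  ∑ (map (false ∷_) V) f + ∑ (map (true ∷_) V ++ []) f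
    ≡⟨ cong₂ _+_ (∑-map (false ∷_) V f)
         (trans (cong (λ l → ∑ l f) (List.++-identityʳ (map (true ∷_) V))) (∑-map (true ∷_) V f)) ⟩
  ∑ V (λ x → f (false ∷ x)) + ∑ V (λ x → f (true ∷ x))
    ≡⟨ cong₂ _+_ (∑-cube d (λ x → f (false ∷ x))) (∑-cube d (λ x → f (true ∷ x))) ⟩
  N * 𝔼 (λ x → f (false ∷ x)) + N * 𝔼 (λ x → f (true ∷ x))
    ≡⟨ rearrange N (𝔼 (λ x → f (false ∷ x))) (𝔼 (λ x → f (true ∷ x))) ⟩
  (fromℕ 2 * N) * 𝔼 f
    ≡⟨ cong (_* 𝔼 f) (sym (fromℕ-* 2 (2 ℕ.^ d))) ⟩
  fromℕ (2 ℕ.^ suc d) * 𝔼 f ∎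
  where
  open ≡-Reasoning
  V = vectors bits d
  N = fromℕ (2 ℕ.^ d)
  rearrange : ∀ n a b → n * a + n * b ≡ ((1ℚ + 1ℚ) * n) * (½ * (a + b))
  rearrange = solve-∀ ring

sum-cong : ∀ n {f g : Fin n → ℚ} → (∀ i → f i ≡ g i) → sum f ≡ sum g
sum-cong zero    eq = refl
sum-cong (suc n) eq = cong₂ _+_ (eq zero) (sum-cong n (eq ∘ suc))

sum-mono : ∀ n {f g : Fin n → ℚ} → (∀ i → f i ≤ g i) → sum f ≤ sum g
sum-mono zero    le = ℚ.≤-refl
sum-mono (suc n) le = ℚ.+-mono-≤ (le zero) (sum-mono n (le ∘ suc))

sum-+ : ∀ n (f g : Fin n → ℚ) → sum (λ i → f i + g i) ≡ sum f + sum g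
sum-+ zero    f g = refl
sum-+ (suc n) f g = trans (cong (f zero + g zero +_) (sum-+ n (f ∘ suc) (g ∘ suc)))
  (rearrange (f zero) (g zero) (sum (f ∘ suc)) (sum (g ∘ suc)))
  where
  rearrange : ∀ a b c d → a + b + (c + d) ≡ a + c + (b + d)
  rearrange = solve-∀ ring

sum-* : ∀ n c (f : Fin n → ℚ) → sum (λ i → c * f i) ≡ c * sum f
sum-* zero    c f = sym (ℚ.*-zeroʳ c)
sum-* (suc n) c f = trans (cong (c * f zero +_) (sum-* n c (f ∘ suc)))
  (sym (ℚ.*-distribˡ-+ c (f zero) (sum (f ∘ suc))))

sum-const : ∀ n c → sum {n} (λ _ → c) ≡ fromℕ n * c
sum-const zero    c = sym (ℚ.*-zeroˡ c)
sum-const (suc n) c = trans (cong (c +_) (sum-const n c))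
  (trans (factor c (fromℕ n)) (cong (_* c) (sym (fromℕ-suc n))))
  where
  factor : ∀ c n → c + n * c ≡ (1ℚ + n) * c
  factor = solve-∀ ring

sum-𝔼 : ∀ {d} n (f : Fin n → Cube d → ℚ) → 𝔼 (λ x → sum (λ i → f i x)) ≡ sum (λ i → 𝔼 (f i))
sum-𝔼 {d} zero f = 𝔼-const {d} 0ℚ
sum-𝔼 (suc n) f = trans (𝔼-+ (f zero) (λ x → sum (λ i → f (suc i) x)))
  (cong (𝔼 (f zero) +_) (sum-𝔼 n (f ∘ suc)))

∑-allFin : ∀ n (f : Fin n → ℚ) → ∑ (allFin n) f ≡ sum f
∑-allFin n f = go n id
  where
  go : ∀ m (g : Fin m → Fin n) → ∑ (List.tabulate g) f ≡ sum (f ∘ g)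
  go zero    g = refl
  go (suc m) g = cong (f (g zero) +_) (go m (g ∘ suc))

-- Level densities

infix 30 _↾_

_↾_ : ∀ {d} {A : Set} → (Cube (suc d) → Cube (suc d) → A) → Bool → Cube d → Cube d → A
(h ↾ b) x y = h (b ∷ x) (b ∷ y)

-- The mean of h over the pairs (x , y) with x <lex y and δ(x , y) = ℓ.

lev : ∀ {d} → Fin d → (Cube d → Cube d → ℚ) → ℚ
lev zero    h = 𝔼 λ x → 𝔼 λ y → h (false ∷ x) (true ∷ y)
lev (suc ℓ) h = ½ * (lev ℓ (h ↾ false) + lev ℓ (h ↾ true))

lev-≥0 : ∀ {d} (ℓ : Fin d) {h : Cube d → Cube d → ℚ} → (∀ x y → 0ℚ ≤ h x y) → 0ℚ ≤ lev ℓ h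
lev-≥0 {suc d} zero le = 𝔼-≥0 {d} λ x → 𝔼-≥0 {d} λ y → le (false ∷ x) (true ∷ y)
lev-≥0 (suc ℓ) le = 0≤-* 0≤½ (0≤-+ (lev-≥0 ℓ λ x y → le _ _) (lev-≥0 ℓ λ x y → le _ _))

lev-mono : ∀ {d} (ℓ : Fin d) {h h′ : Cube d → Cube d → ℚ} → (∀ x y → h x y ≤ h′ x y) → lev ℓ h ≤ lev ℓ h′
lev-mono {suc d} zero le = 𝔼-mono {d} λ x → 𝔼-mono {d} λ y → le (false ∷ x) (true ∷ y)
lev-mono (suc ℓ) le = *-monoˡ 0≤½ (ℚ.+-mono-≤ (lev-mono ℓ λ x y → le _ _) (lev-mono ℓ λ x y → le _ _))

lev-const : ∀ {d} (ℓ : Fin d) c → lev ℓ (λ _ _ → c) ≡ c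
lev-const {suc d} zero c = trans (𝔼-cong {d} λ _ → 𝔼-const {d} c) (𝔼-const {d} c)
lev-const (suc ℓ) c = trans (cong (λ a → ½ * (a + a)) (lev-const ℓ c)) (½-double c)

lev-≤1 : ∀ {d} (ℓ : Fin d) {h : Cube d → Cube d → ℚ} → (∀ x y → h x y ≤ 1ℚ) → lev ℓ h ≤ 1ℚ
lev-≤1 ℓ {h} le = subst (lev ℓ h ≤_) (lev-const ℓ 1ℚ) (lev-mono ℓ le)

module _ {d : ℕ} {b : Bool} {x y : Cube d} where

  isδ-∷ : ∀ {ℓ} → Isδ x y ℓ → Isδ (b ∷ x) (b ∷ y) (suc ℓ)
  isδ-∷ (x≢y , eq) = x≢y , λ { zero _ → refl ; (suc i) (ℕ.s≤s i<ℓ) → eq i i<ℓ }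

  isδ-tail : ∀ {ℓ} → Isδ (b ∷ x) (b ∷ y) (suc ℓ) → Isδ x y ℓ
  isδ-tail (x≢y , eq) = x≢y , λ i i<ℓ → eq (suc i) (ℕ.s≤s i<ℓ)

  <lex-∷ : x <lex y → (b ∷ x) <lex (b ∷ y)
  <lex-∷ (ℓ , δ , xℓ) = suc ℓ , isδ-∷ δ , xℓ

  <lex-tail : (b ∷ x) <lex (b ∷ y) → x <lex y
  <lex-tail (zero  , (b≢b , _) , _) = ⊥-elim (b≢b refl)
  <lex-tail (suc ℓ , δ , xℓ)        = ℓ , isδ-tail δ , xℓ

false<lextrue : ∀ {d} {x y : Cube d} → (false ∷ x) <lex (true ∷ y)
false<lextrue = zero , ((λ ()) , λ _ ()) , refl

true≮lexfalse : ∀ {d} {x y : Cube d} → ¬ ((true ∷ x) <lex (false ∷ y))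
true≮lexfalse (zero  , _ , ())
true≮lexfalse (suc ℓ , (_ , eq) , _) with () ← eq zero (ℕ.s≤s ℕ.z≤n)

LevelEdge : ∀ {d} → Fin d → (Cube d → Cube d → Bool) → Cube d × Cube d → Set
LevelEdge ℓ a (x , y) = x <lex y × Isδ x y ℓ × T (a x y)

levelEdge? : ∀ {d} (ℓ : Fin d) a (p : Cube d × Cube d) → Dec (LevelEdge ℓ a p)
levelEdge? ℓ a (x , y) = (x <lex? y) ×-dec (isδ? x y ℓ ×-dec Bool.T? (a x y))

module _ {d : ℕ} (a : Cube (suc d) → Cube (suc d) → Bool) (x y : Cube d) where

  private
    isEdge : Fin (suc d) → Bool → Bool → Bool
    isEdge ℓ b b′ = does (levelEdge? ℓ a (b ∷ x , b′ ∷ y))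

  isEdge-cross : isEdge zero false true ≡ a (false ∷ x) (true ∷ y)
  isEdge-cross = does-cong (levelEdge? zero a _) (Bool.T? (a (false ∷ x) (true ∷ y)))
    (λ (_ , _ , t) → t) (λ t → false<lextrue , ((λ ()) , λ _ ()) , t)

  isEdge-back : ∀ ℓ → isEdge ℓ true false ≡ false
  isEdge-back ℓ = dec-false (levelEdge? ℓ a (true ∷ x , false ∷ y)) λ (lt , _) → true≮lexfalse lt

  isEdge-same-zero : ∀ b → isEdge zero b b ≡ false
  isEdge-same-zero b = dec-false (levelEdge? zero a (b ∷ x , b ∷ y)) λ (_ , (b≢b , _) , _) → b≢b refl

  isEdge-cross-suc : ∀ ℓ → isEdge (suc ℓ) false true ≡ false
  isEdge-cross-suc ℓ = dec-false (levelEdge? (suc ℓ) a (false ∷ x , true ∷ y)) λ (_ , (_ , eq) , _) → lemma (eq zero (ℕ.s≤s ℕ.z≤n))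
    where
    lemma : ¬ (false ≡ true)
    lemma ()

  isEdge-same-suc : ∀ ℓ b → isEdge (suc ℓ) b b ≡ does (levelEdge? ℓ (a ↾ b) (x , y))
  isEdge-same-suc ℓ b = does-cong (levelEdge? (suc ℓ) a _) (levelEdge? ℓ (a ↾ b) _)
    (λ (lt , δ , t) → <lex-tail lt , isδ-tail δ , t)
    (λ (lt , δ , t) → <lex-∷ lt , isδ-∷ δ , t)

ind : ∀ {A B : Set} → (A → B → Bool) → A → B → ℚ
ind a x y = 𝟙 (a x y)

-- A random pair agrees on the first `toℕ ℓ` bits and has bits `false` and `true` at `ℓ` with
-- probability `2 ^ -(2 + toℕ ℓ)`; the factor conditions on this event.
𝔼-levelEdge : ∀ {d} (ℓ : Fin d) (a : Cube d → Cube d → Bool) →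
              fromℕ (2 ℕ.^ (2 ℕ.+ toℕ ℓ)) * 𝔼 (λ x → 𝔼 (λ y → 𝟙 (does (levelEdge? ℓ a (x , y))))) ≡ lev ℓ (ind a)
𝔼-levelEdge {suc d} zero a = begin
  fromℕ 4 * (½ * (𝔼 (λ x → ½ * (𝔼 (λ y → E false false x y) + 𝔼 (λ y → E false true x y)))
                + 𝔼 (λ x → ½ * (𝔼 (λ y → E true false x y) + 𝔼 (λ y → E true true x y)))))
    ≡⟨ cong (λ q → fromℕ 4 * (½ * q)) (cong₂ _+_
         (𝔼-cong λ x → cong (½ *_) (cong₂ _+_
           (trans (𝔼-cong λ y → cong 𝟙 (isEdge-same-zero a x y false)) (𝔼-const {d} 0ℚ))
           (𝔼-cong λ y → cong 𝟙 (isEdge-cross a x y))))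
         (trans (𝔼-cong λ x → cong₂ (λ p q → ½ * (p + q))
           (trans (𝔼-cong λ y → cong 𝟙 (isEdge-back a x y zero)) (𝔼-const {d} 0ℚ))
           (trans (𝔼-cong λ y → cong 𝟙 (isEdge-same-zero a x y true)) (𝔼-const {d} 0ℚ)))
           (𝔼-const {d} 0ℚ))) ⟩
  fromℕ 4 * (½ * (𝔼 (λ x → ½ * (0ℚ + C x)) + 0ℚ))
    ≡⟨ cong (λ q → fromℕ 4 * (½ * (q + 0ℚ))) (trans (𝔼-cong λ x → drop0 (C x)) (𝔼-* ½ C)) ⟩
  fromℕ 4 * (½ * (½ * 𝔼 C + 0ℚ))
    ≡⟨ quarter (𝔼 C) ⟩
  𝔼 C ∎
  where
  open ≡-Reasoning
  E : Bool → Bool → Cube d → Cube d → ℚ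
  E b b′ x y = 𝟙 (does (levelEdge? zero a (b ∷ x , b′ ∷ y)))
  C : Cube d → ℚ
  C x = 𝔼 (λ y → ind a (false ∷ x) (true ∷ y))
  drop0 : ∀ c → ½ * (0ℚ + c) ≡ ½ * c
  drop0 = solve-∀ ring
  quarter : ∀ c → (1ℚ + 1ℚ + 1ℚ + 1ℚ) * (½ * (½ * c + 0ℚ)) ≡ c
  quarter = solve-∀ ring
𝔼-levelEdge {suc d} (suc ℓ) a = begin
  fromℕ (2 ℕ.^ (3 ℕ.+ toℕ ℓ)) * (½ * (𝔼 (λ x → ½ * (𝔼 (λ y → E false false x y) + 𝔼 (λ y → E false true x y)))
                + 𝔼 (λ x → ½ * (𝔼 (λ y → E true false x y) + 𝔼 (λ y → E true true x y)))))
    ≡⟨ cong₂ (λ w q → w * (½ * q)) (fromℕ-* 2 (2 ℕ.^ (2 ℕ.+ toℕ ℓ))) (cong₂ _+_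
         (trans (𝔼-cong λ x → cong₂ (λ p q → ½ * (p + q))
           (𝔼-cong λ y → cong 𝟙 (isEdge-same-suc a x y ℓ false))
           (trans (𝔼-cong λ y → cong 𝟙 (isEdge-cross-suc a x y ℓ)) (𝔼-const {d} 0ℚ)))
           (trans (𝔼-cong λ x → drop0ʳ (R false x)) (𝔼-* ½ (R false))))
         (trans (𝔼-cong λ x → cong₂ (λ p q → ½ * (p + q))
           (trans (𝔼-cong λ y → cong 𝟙 (isEdge-back a x y (suc ℓ))) (𝔼-const {d} 0ℚ))
           (𝔼-cong λ y → cong 𝟙 (isEdge-same-suc a x y ℓ true)))
           (trans (𝔼-cong λ x → drop0ˡ (R true x)) (𝔼-* ½ (R true))))) ⟩
  (fromℕ 2 * W) * (½ * (½ * 𝔼 (R false) + ½ * 𝔼 (R true)))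
    ≡⟨ rearrange W (𝔼 (R false)) (𝔼 (R true)) ⟩
  ½ * (W * 𝔼 (R false) + W * 𝔼 (R true))
    ≡⟨ cong (½ *_) (cong₂ _+_ (𝔼-levelEdge ℓ (a ↾ false)) (𝔼-levelEdge ℓ (a ↾ true))) ⟩
  lev (suc ℓ) (ind a) ∎
  where
  open ≡-Reasoning
  W = fromℕ (2 ℕ.^ (2 ℕ.+ toℕ ℓ))
  E : Bool → Bool → Cube d → Cube d → ℚ
  E b b′ x y = 𝟙 (does (levelEdge? (suc ℓ) a (b ∷ x , b′ ∷ y)))
  R : Bool → Cube d → ℚ
  R b x = 𝔼 (λ y → 𝟙 (does (levelEdge? ℓ (a ↾ b) (x , y))))
  drop0ʳ : ∀ c → ½ * (c + 0ℚ) ≡ ½ * c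
  drop0ʳ = solve-∀ ring
  drop0ˡ : ∀ c → ½ * (0ℚ + c) ≡ ½ * c
  drop0ˡ = solve-∀ ring
  rearrange : ∀ w p q → ((1ℚ + 1ℚ) * w) * (½ * (½ * p + ½ * q)) ≡ ½ * (w * p + w * q)
  rearrange = solve-∀ ring

-- From `toℕ ℓ < d` follows `2 + toℕ ℓ ≤ 2 d`, so the truncated subtractions in `τ` are exact. Of
-- the `d + d` bits of a pair, `2 + toℕ ℓ` are lost to the level condition and `τ` counts the
-- choices for the rest.
τ-exponent : ∀ {d} (ℓ : Fin d) → (2 ℕ.+ toℕ ℓ) ℕ.+ (2 ℕ.* d ℕ.∸ suc (toℕ ℓ) ℕ.∸ 1) ≡ d ℕ.+ d
τ-exponent {d} ℓ = begin
  (2 ℕ.+ toℕ ℓ) ℕ.+ (2 ℕ.* d ℕ.∸ suc (toℕ ℓ) ℕ.∸ 1)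
    ≡⟨ cong ((2 ℕ.+ toℕ ℓ) ℕ.+_) (trans (ℕ.∸-+-assoc (2 ℕ.* d) (suc (toℕ ℓ)) 1) (cong (2 ℕ.* d ℕ.∸_) (ℕ.+-comm (suc (toℕ ℓ)) 1))) ⟩
  (2 ℕ.+ toℕ ℓ) ℕ.+ (2 ℕ.* d ℕ.∸ (2 ℕ.+ toℕ ℓ))
    ≡⟨ ℕ.m+[n∸m]≡n (ℕ.≤-trans (ℕ.+-mono-≤ (ℕ.≤-trans (ℕ.s≤s ℕ.z≤n) (Fin.toℕ<n ℓ)) (Fin.toℕ<n ℓ)) (ℕ.≤-reflexive (cong (d ℕ.+_) (sym (ℕ.+-identityʳ d))))) ⟩
  2 ℕ.* d
    ≡⟨ cong (d ℕ.+_) (ℕ.+-identityʳ d) ⟩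
  d ℕ.+ d ∎
  where open ≡-Reasoning

e-level : ∀ {d} (ℓ : Fin d) (G : Graph (Cube d)) → fromℕ (e[ ℓ ] G) ≡ lev ℓ (ind (adj G)) * fromℕ (τ ℓ)
e-level {d} ℓ G = begin
  fromℕ (e[ ℓ ] G)
    ≡⟨ fromℕ-length-filter (levelEdge? ℓ (adj G)) (cartesianProduct V V) ⟩
  ∑ (cartesianProduct V V) (λ p → 𝟙 (does (levelEdge? ℓ (adj G) p)))
    ≡⟨ ∑-cartesianProduct V V _ ⟩
  ∑ V (λ x → ∑ V (λ y → E x y))
    ≡⟨ ∑-cong V (λ x → ∑-cube d (E x)) ⟩
  ∑ V (λ x → N * 𝔼 (E x))
    ≡⟨ ∑-cube d _ ⟩
  N * 𝔼 (λ x → N * 𝔼 (E x))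
    ≡⟨ cong (N *_) (𝔼-* N (λ x → 𝔼 (E x))) ⟩
  N * (N * 𝔼𝔼)
    ≡⟨ sym (ℚ.*-assoc N N 𝔼𝔼) ⟩
  (N * N) * 𝔼𝔼
    ≡⟨ cong (_* 𝔼𝔼) split ⟩
  (fromℕ (2 ℕ.^ (2 ℕ.+ toℕ ℓ)) * fromℕ (τ ℓ)) * 𝔼𝔼
    ≡⟨ rearrange (fromℕ (2 ℕ.^ (2 ℕ.+ toℕ ℓ))) (fromℕ (τ ℓ)) 𝔼𝔼 ⟩
  (fromℕ (2 ℕ.^ (2 ℕ.+ toℕ ℓ)) * 𝔼𝔼) * fromℕ (τ ℓ)
    ≡⟨ cong (_* fromℕ (τ ℓ)) (𝔼-levelEdge ℓ (adj G)) ⟩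
  lev ℓ (ind (adj G)) * fromℕ (τ ℓ) ∎
  where
  open ≡-Reasoning
  V = vectors bits d
  N = fromℕ (2 ℕ.^ d)
  E : Cube d → Cube d → ℚ
  E x y = 𝟙 (does (levelEdge? ℓ (adj G) (x , y)))
  𝔼𝔼 = 𝔼 (λ x → 𝔼 (E x))
  split : N * N ≡ fromℕ (2 ℕ.^ (2 ℕ.+ toℕ ℓ)) * fromℕ (τ ℓ)
  split = begin
    N * N                                                  ≡⟨ sym (fromℕ-* (2 ℕ.^ d) (2 ℕ.^ d)) ⟩
    fromℕ (2 ℕ.^ d ℕ.* 2 ℕ.^ d)                            ≡⟨ cong fromℕ (sym (ℕ.^-distribˡ-+-* 2 d d)) ⟩
    fromℕ (2 ℕ.^ (d ℕ.+ d))                                ≡⟨ cong (λ k → fromℕ (2 ℕ.^ k)) (sym (τ-exponent ℓ)) ⟩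
    fromℕ (2 ℕ.^ ((2 ℕ.+ toℕ ℓ) ℕ.+ (2 ℕ.* d ℕ.∸ suc (toℕ ℓ) ℕ.∸ 1)))
      ≡⟨ cong fromℕ (ℕ.^-distribˡ-+-* 2 (2 ℕ.+ toℕ ℓ) _) ⟩
    fromℕ (2 ℕ.^ (2 ℕ.+ toℕ ℓ) ℕ.* τ ℓ)                    ≡⟨ fromℕ-* (2 ℕ.^ (2 ℕ.+ toℕ ℓ)) (τ ℓ) ⟩
    fromℕ (2 ℕ.^ (2 ℕ.+ toℕ ℓ)) * fromℕ (τ ℓ)              ∎
  rearrange : ∀ a b c → (a * b) * c ≡ (a * c) * b
  rearrange = solve-∀ ring

0<τ : ∀ {d} (ℓ : Fin d) → 0ℚ < fromℕ (τ ℓ)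
0<τ ℓ = 0<fromℕ (τ ℓ) {{τ≢0 ℓ}}

level-density : ∀ {d} (ℓ : Fin d) (G : Graph (Cube d)) →
                (ℤ.+ e[ ℓ ] G / τ ℓ) {{τ≢0 ℓ}} ≡ lev ℓ (ind (adj G))
level-density ℓ G = *-cancelˡ-≡ (0<τ ℓ) (begin
  fromℕ (τ ℓ) * D   ≡⟨ ℚ.*-comm (fromℕ (τ ℓ)) D ⟩
  D * fromℕ (τ ℓ)   ≡⟨ /-fromℕ (e[ ℓ ] G) (τ ℓ) {{τ≢0 ℓ}} ⟩
  fromℕ (e[ ℓ ] G)  ≡⟨ e-level ℓ G ⟩
  lev ℓ (ind (adj G)) * fromℕ (τ ℓ) ≡⟨ ℚ.*-comm _ (fromℕ (τ ℓ)) ⟩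
  fromℕ (τ ℓ) * lev ℓ (ind (adj G)) ∎)
  where
  open ≡-Reasoning
  D = (ℤ.+ e[ ℓ ] G / τ ℓ) {{τ≢0 ℓ}}

averageDensity-lev : ∀ {d} .{{_ : NonZero d}} (G : Graph (Cube d)) →
                     averageDensity G * fromℕ d ≡ sum (λ ℓ → lev ℓ (ind (adj G)))
averageDensity-lev {d} G = begin
  ((ℤ.+ 1 / d) * sum D) * fromℕ d ≡⟨ rearrange (ℤ.+ 1 / d) (sum D) (fromℕ d) ⟩
  ((ℤ.+ 1 / d) * fromℕ d) * sum D ≡⟨ cong (_* sum D) (/-fromℕ 1 d) ⟩
  1ℚ * sum D                      ≡⟨ ℚ.*-identityˡ (sum D) ⟩
  sum D                           ≡⟨ sum-cong d (λ ℓ → level-density ℓ G) ⟩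
  sum (λ ℓ → lev ℓ (ind (adj G))) ∎
  where
  open ≡-Reasoning
  D : Fin d → ℚ
  D ℓ = (ℤ.+ e[ ℓ ] G / τ ℓ) {{τ≢0 ℓ}}
  rearrange : ∀ a b c → (a * b) * c ≡ (a * c) * b
  rearrange = solve-∀ ring

-- Caterpillar embeddings

Increasing : ∀ {n d} → (Fin n → Cube d) → Set
Increasing φ = ∀ i j → i Fin.< j → φ i <lex φ j

_◂_ : ∀ {n} {A : Set} → A → (Fin n → A) → Fin (suc n) → A
(x ◂ φ) zero    = x
(x ◂ φ) (suc i) = φ i

deg : ∀ {n} → (Fin (suc n) → Fin (suc n) → ℚ) → ℚ
deg A = sum λ v → A zero (suc v)

infix 30 _⁺

_⁺ : ∀ {n} → (Fin (suc n) → Fin (suc n) → ℚ) → Fin n → Fin n → ℚ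
(A ⁺) u v = A (suc u) (suc v)

-- The total weight of the edges of A preserved by φ, plus unary terms g.  Once the first vertex is
-- placed, its edges become unary terms of the other vertices.

obj : ∀ n {d} → (Fin n → Fin n → ℚ) → (Cube d → Cube d → ℚ) → (Fin n → Cube d → ℚ) → (Fin n → Cube d) → ℚ
obj zero    A h g φ = 0ℚ
obj (suc n) A h g φ =
  g zero (φ zero) + obj n (A ⁺) h (λ v x → g (suc v) x + A zero (suc v) * h (φ zero) x) (φ ∘ suc)

obj-↾ : ∀ n {d} b A (h : Cube (suc d) → Cube (suc d) → ℚ) g φ →
        obj n A h g (λ v → b ∷ φ v) ≡ obj n A (h ↾ b) (λ v x → g v (b ∷ x)) φ
obj-↾ zero    b A h g φ = refl
obj-↾ (suc n) b A h g φ = cong (g zero (b ∷ φ zero) +_) (obj-↾ n b (A ⁺) h _ (φ ∘ suc))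

module Caterpillar (m : ℕ) (μ : ℚ) where

  -- A choice among d levels of r consecutive blocks of m levels each, preceded by k levels of
  -- the block in progress.

  data Plan : ℕ → ℕ → ℕ → Set where
    done : ∀ {d} → Plan d 0 0
    skip : ∀ {d k r} → Plan d k r → Plan (suc d) k r
    take : ∀ {d k r} → Plan d k r → Plan (suc d) (suc k) r
    next : ∀ {d r} → Plan d m r → Plan d 0 (suc r)

  drop : ∀ {d k r} → Plan d k r → Plan d 0 r
  drop done     = done
  drop (skip P) = skip (drop P)
  drop (take P) = skip (drop P)
  drop (next P) = next P

  -- The densities are those of the subcubes along `x`, because a split happens inside such a
  -- subcube. Only their mean over `x` is a density of the whole level.
  curr : ∀ {d k r} → Plan d k r → (Cube d → Cube d → ℚ) → Cube d → ℚ
  curr (skip P) h (b ∷ x) = curr P (h ↾ b) x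
  curr (take P) h (b ∷ x) = lev zero h + curr P (h ↾ b) x
  curr done     h x       = 0ℚ
  curr (next P) h x       = 0ℚ

  -- With `μ = 1 / m`, a block contributes the degree of its vertex times the mean density of its
  -- levels along `x`, which is what the vertex collects if its split is at a uniformly chosen level
  -- of the block.
  later : ∀ {d k r} → Plan d k r → (Fin r → Fin r → ℚ) → (Cube d → Cube d → ℚ) → Cube d → ℚ
  later (skip P) A h (b ∷ x) = later P A (h ↾ b) x
  later (take P) A h (b ∷ x) = later P A (h ↾ b) x
  later done     A h x       = 0ℚ
  later (next P) A h x       = (μ * deg A) * curr P h x + later P (A ⁺) h x

  -- The random sum of signs that measures the bias of the turns in the current block.
  sgn : ∀ {d k r} → Plan d k r → Cube d → ℚ
  sgn (skip P) (b ∷ x)     = sgn P x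
  sgn (take P) (false ∷ x) = - 1ℚ + sgn P x
  sgn (take P) (true ∷ x)  = 1ℚ + sgn P x
  sgn done     x           = 0ℚ
  sgn (next P) x           = 0ℚ

  later-drop : ∀ {d k r} (P : Plan d k r) A h x → later (drop P) A h x ≡ later P A h x
  later-drop done     A h x       = refl
  later-drop (skip P) A h (b ∷ x) = later-drop P A (h ↾ b) x
  later-drop (take P) A h (b ∷ x) = later-drop P A (h ↾ b) x
  later-drop (next P) A h x       = refl

  -- Signs of different levels are uncorrelated, so only the `k` squares survive. The offset `σ`
  -- stands for the signs already read; `take` shifts it by -1 and 1 in the two halves.
  𝔼-sgn² : ∀ {d k r} (P : Plan d k r) σ →
            𝔼 (λ x → (σ + sgn P x) * (σ + sgn P x)) ≡ σ * σ + fromℕ k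
  𝔼-sgn² {d} done σ = trans (𝔼-const {d} _) (lemma σ)
    where
    lemma : ∀ σ → (σ + 0ℚ) * (σ + 0ℚ) ≡ σ * σ + 0ℚ
    lemma = solve-∀ ring
  𝔼-sgn² {d} (next P) σ = trans (𝔼-const {d} _) (lemma σ)
    where
    lemma : ∀ σ → (σ + 0ℚ) * (σ + 0ℚ) ≡ σ * σ + 0ℚ
    lemma = solve-∀ ring
  𝔼-sgn² {suc d} {k} (skip P) σ = trans (cong (λ q → ½ * (q + q)) (𝔼-sgn² P σ)) (½-double (σ * σ + fromℕ k))
  𝔼-sgn² {suc d} {suc k} (take P) σ = begin
    ½ * (𝔼 (λ x → (σ + (- 1ℚ + sgn P x)) * (σ + (- 1ℚ + sgn P x))) + 𝔼 (λ x → (σ + (1ℚ + sgn P x)) * (σ + (1ℚ + sgn P x))))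
      ≡⟨ cong (½ *_) (cong₂ _+_ (𝔼-cong {d} λ x → cong (λ q → q * q) (sym (ℚ.+-assoc σ (- 1ℚ) (sgn P x))))
                                (𝔼-cong {d} λ x → cong (λ q → q * q) (sym (ℚ.+-assoc σ 1ℚ (sgn P x))))) ⟩
    ½ * (𝔼 (λ x → ((σ + - 1ℚ) + sgn P x) * ((σ + - 1ℚ) + sgn P x)) + 𝔼 (λ x → ((σ + 1ℚ) + sgn P x) * ((σ + 1ℚ) + sgn P x)))
      ≡⟨ cong (½ *_) (cong₂ _+_ (𝔼-sgn² P (σ + - 1ℚ)) (𝔼-sgn² P (σ + 1ℚ))) ⟩
    ½ * (((σ + - 1ℚ) * (σ + - 1ℚ) + fromℕ k) + ((σ + 1ℚ) * (σ + 1ℚ) + fromℕ k))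
      ≡⟨ lemma σ (fromℕ k) ⟩
    σ * σ + (1ℚ + fromℕ k)
      ≡⟨ cong (σ * σ +_) (sym (fromℕ-suc k)) ⟩
    σ * σ + fromℕ (suc k) ∎
    where
    open ≡-Reasoning
    lemma : ∀ σ k → ½ * (((σ + - 1ℚ) * (σ + - 1ℚ) + k) + ((σ + 1ℚ) * (σ + 1ℚ) + k)) ≡ σ * σ + (1ℚ + k)
    lemma = solve-∀ ring

  -- The sum, over the k levels of the current block, of the mean gain of splitting at that level:
  -- the first vertex goes left and collects g₀ and the edges (of total weight a) to the others,
  -- which go right, where F describes what they can achieve.

  gain : ∀ {d k r} → Plan d k r → ℚ → (Cube d → Cube d → ℚ) → (Cube d → ℚ) → (Cube d → ℚ) → ℚ
  gain done     a h g₀ F = 0ℚ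
  gain (next P) a h g₀ F = 0ℚ
  gain (skip P) a h g₀ F =
    ½ * (gain P a (h ↾ false) (λ x → g₀ (false ∷ x)) (λ x → F (false ∷ x))
       + gain P a (h ↾ true) (λ x → g₀ (true ∷ x)) (λ x → F (true ∷ x)))
  gain (take P) a h g₀ F =
    (𝔼 (λ x → g₀ (false ∷ x)) + 𝔼 (λ x → F (true ∷ x)) + a * lev zero h) +
    ½ * (gain P a (h ↾ false) (λ x → g₀ (false ∷ x)) (λ x → F (false ∷ x))
       + gain P a (h ↾ true) (λ x → g₀ (true ∷ x)) (λ x → F (true ∷ x)))

  -- Restricting a mean to the left or right half at a level multiplies the integrand by one minus
  -- or one plus the sign of that level. Over the block the signs add up to `sgn P`, so all biases
  -- together form a single covariance with `F - g₀`.
  gain-≡ : ∀ {d k r} (P : Plan d k r) a h g₀ F →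
           gain P a h g₀ F ≡ fromℕ k * (𝔼 g₀ + 𝔼 F) + 𝔼 (λ x → (F x - g₀ x) * sgn P x) + a * 𝔼 (curr P h)
  gain-≡ {d} done a h g₀ F = sym (trans
    (cong₂ (λ p q → 0ℚ * (𝔼 g₀ + 𝔼 F) + p + a * q) (trans (𝔼-cong {d} λ x → ℚ.*-zeroʳ (F x - g₀ x)) (𝔼-const {d} 0ℚ)) (𝔼-const {d} 0ℚ))
    (lemma (𝔼 g₀ + 𝔼 F) a))
    where
    lemma : ∀ e a → 0ℚ * e + 0ℚ + a * 0ℚ ≡ 0ℚ
    lemma = solve-∀ ring
  gain-≡ {d} (next P) a h g₀ F = sym (trans
    (cong₂ (λ p q → 0ℚ * (𝔼 g₀ + 𝔼 F) + p + a * q) (trans (𝔼-cong {d} λ x → ℚ.*-zeroʳ (F x - g₀ x)) (𝔼-const {d} 0ℚ)) (𝔼-const {d} 0ℚ))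
    (lemma (𝔼 g₀ + 𝔼 F) a))
    where
    lemma : ∀ e a → 0ℚ * e + 0ℚ + a * 0ℚ ≡ 0ℚ
    lemma = solve-∀ ring
  gain-≡ {suc d} {k} (skip P) a h g₀ F = trans
    (cong (½ *_) (cong₂ _+_ (gain-≡ P a (h ↾ false) (λ x → g₀ (false ∷ x)) (λ x → F (false ∷ x)))
                            (gain-≡ P a (h ↾ true) (λ x → g₀ (true ∷ x)) (λ x → F (true ∷ x)))))
    (lemma (fromℕ k) a (𝔼 (λ x → g₀ (false ∷ x))) (𝔼 (λ x → g₀ (true ∷ x))) (𝔼 (λ x → F (false ∷ x))) (𝔼 (λ x → F (true ∷ x))) _ _ _ _)
    where
    lemma : ∀ k a g g′ f f′ X X′ C C′ →
            ½ * ((k * (g + f) + X + a * C) + (k * (g′ + f′) + X′ + a * C′)) ≡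
            k * (½ * (g + g′) + ½ * (f + f′)) + ½ * (X + X′) + a * (½ * (C + C′))
    lemma = solve-∀ ring
  gain-≡ {suc d} {suc k} (take P) a h g₀ F = begin
    (Eg + Ef′ + a * lev zero h) + ½ * (gain P a (h ↾ false) g f + gain P a (h ↾ true) g′ f′)
      ≡⟨ cong (λ q → (Eg + Ef′ + a * lev zero h) + ½ * q)
           (cong₂ _+_ (gain-≡ P a (h ↾ false) g f) (gain-≡ P a (h ↾ true) g′ f′)) ⟩
    (Eg + Ef′ + a * lev zero h) + ½ * ((fromℕ k * (Eg + Ef) + X + a * C) + (fromℕ k * (Eg′ + Ef′) + X′ + a * C′))
      ≡⟨ lemma (fromℕ k) a Eg Eg′ Ef Ef′ X X′ C C′ (lev zero h) ⟩
    (1ℚ + fromℕ k) * (½ * (Eg + Eg′) + ½ * (Ef + Ef′))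
      + ½ * ((- 1ℚ * (Ef - Eg) + X) + ((Ef′ - Eg′) + X′)) + a * (½ * ((lev zero h + C) + (lev zero h + C′)))
      ≡⟨ cong₂ _+_ (cong₂ _+_ (cong (_* (½ * (Eg + Eg′) + ½ * (Ef + Ef′))) (sym (fromℕ-suc k)))
                              (cong (½ *_) (cong₂ _+_ (sym (cov f g (- 1ℚ))) (sym (trans (cov f′ g′ 1ℚ) (cong (_+ X′) (ℚ.*-identityˡ (Ef′ - Eg′))))))))
           (cong (λ q → a * (½ * q)) (cong₂ _+_ (sym (shift (curr P (h ↾ false)))) (sym (shift (curr P (h ↾ true)))))) ⟩
    fromℕ (suc k) * (𝔼 g₀ + 𝔼 F) + 𝔼 (λ x → (F x - g₀ x) * sgn (take P) x) + a * 𝔼 (curr (take P) h) ∎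
    where
    open ≡-Reasoning
    g g′ f f′ : Cube d → ℚ
    g x = g₀ (false ∷ x)
    g′ x = g₀ (true ∷ x)
    f x = F (false ∷ x)
    f′ x = F (true ∷ x)
    Eg = 𝔼 g
    Eg′ = 𝔼 g′
    Ef = 𝔼 f
    Ef′ = 𝔼 f′
    X = 𝔼 (λ x → (f x - g x) * sgn P x)
    X′ = 𝔼 (λ x → (f′ x - g′ x) * sgn P x)
    C = 𝔼 (curr P (h ↾ false))
    C′ = 𝔼 (curr P (h ↾ true))
    lemma : ∀ k a g g′ f f′ X X′ C C′ l →
            (g + f′ + a * l) + ½ * ((k * (g + f) + X + a * C) + (k * (g′ + f′) + X′ + a * C′)) ≡
            (1ℚ + k) * (½ * (g + g′) + ½ * (f + f′))
              + ½ * ((- 1ℚ * (f - g) + X) + ((f′ - g′) + X′)) + a * (½ * ((l + C) + (l + C′)))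
    lemma = solve-∀ ring
    cov : ∀ (f g : Cube d → ℚ) s → 𝔼 (λ x → (f x - g x) * (s + sgn P x)) ≡
          s * (𝔼 f - 𝔼 g) + 𝔼 (λ x → (f x - g x) * sgn P x)
    cov f g s = begin
      𝔼 (λ x → (f x - g x) * (s + sgn P x))
        ≡⟨ 𝔼-cong (λ x → expand (f x) (g x) s (sgn P x)) ⟩
      𝔼 (λ x → (s * f x + (- s) * g x) + (f x - g x) * sgn P x)
        ≡⟨ 𝔼-+ (λ x → s * f x + (- s) * g x) _ ⟩
      𝔼 (λ x → s * f x + (- s) * g x) + Y
        ≡⟨ cong (_+ Y) (trans (𝔼-+ (λ x → s * f x) (λ x → (- s) * g x)) (cong₂ _+_ (𝔼-* s f) (𝔼-* (- s) g))) ⟩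
      (s * 𝔼 f + (- s) * 𝔼 g) + Y
        ≡⟨ cong (_+ Y) (factor s (𝔼 f) (𝔼 g)) ⟩
      s * (𝔼 f - 𝔼 g) + Y ∎
      where
      Y = 𝔼 (λ x → (f x - g x) * sgn P x)
      expand : ∀ f g s t → (f - g) * (s + t) ≡ (s * f + (- s) * g) + (f - g) * t
      expand = solve-∀ ring
      factor : ∀ s f g → s * f + (- s) * g ≡ s * (f - g)
      factor = solve-∀ ring
    shift : ∀ (u : Cube d → ℚ) → 𝔼 (λ x → lev zero h + u x) ≡ lev zero h + 𝔼 u
    shift u = trans (𝔼-+ (λ _ → lev zero h) u) (cong (_+ 𝔼 u) (𝔼-const {d} (lev zero h)))

-- Since 2 c u s + M (s² + c²) = ½ ((M + u) (s + c)² + (M - u) (s - c)²).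

|u|≤M⇒ : ∀ M u s c → u ≤ M → - M ≤ u → 0ℚ ≤ ((1ℚ + 1ℚ) * c) * (u * s) + M * (s * s + c * c)
|u|≤M⇒ M u s c u≤M -M≤u = subst (0ℚ ≤_) (identity M u s c)
  (0≤-* 0≤½ (0≤-+ (0≤-* (subst (0ℚ ≤_) (flip M u) (≤⇒0≤- -M≤u)) (0≤-sq (s + c)))
                  (0≤-* (≤⇒0≤- u≤M) (0≤-sq (s - c)))))
  where
  flip : ∀ M u → u - (- M) ≡ M + u
  flip = solve-∀ ring
  identity : ∀ M u s c → ½ * ((M + u) * ((s + c) * (s + c)) + (M - u) * ((s - c) * (s - c))) ≡
             ((1ℚ + 1ℚ) * c) * (u * s) + M * (s * s + c * c)
  identity = solve-∀ ring

-- Bounding the bias and embedding greedily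

InUnit : ∀ {A B : Set} → (A → B → ℚ) → Set
InUnit f = ∀ x y → 0ℚ ≤ f x y × f x y ≤ 1ℚ

ind-InUnit : ∀ {A B : Set} (a : A → B → Bool) → InUnit (ind a)
ind-InUnit a x y = 0≤𝟙 (a x y) , 𝟙≤1 (a x y)

sum-≥0 : ∀ n {f : Fin n → ℚ} → (∀ i → 0ℚ ≤ f i) → 0ℚ ≤ sum f
sum-≥0 zero    le = ℚ.≤-refl
sum-≥0 (suc n) le = 0≤-+ (le zero) (sum-≥0 n (le ∘ suc))

sum-≤ : ∀ n {f : Fin n → ℚ} κ → (∀ i → f i ≤ κ) → sum f ≤ fromℕ n * κ
sum-≤ n {f} κ le = subst (sum f ≤_) (sum-const n κ) (sum-mono n le)

increasing-∷ : ∀ {n d} {φ : Fin n → Cube d} b → Increasing φ → Increasing (λ v → b ∷ φ v)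
increasing-∷ b inc i j i<j = <lex-∷ (inc i j i<j)

increasing-◂ : ∀ {n d} (x : Cube d) {φ : Fin n → Cube d} → Increasing φ →
               Increasing ((false ∷ x) ◂ (λ v → true ∷ φ v))
increasing-◂ x inc zero    (suc j) _            = false<lextrue
increasing-◂ x inc (suc i) (suc j) (ℕ.s≤s i<j) = <lex-∷ (inc i j i<j)

module Achieve (c : ℕ) .{{_ : NonZero c}} (N : ℕ) (ε : ℚ) (N²<εc : fromℕ (N ℕ.* N) < ε * fromℕ c) where

  private
    -- A square block length makes its square root, the standard deviation of the sum of signs, the
    -- rational number `c`.
    m = c ℕ.* c
    instance
      m≢0 : NonZero m
      m≢0 = ℕ.m*n≢0 c c
    μ = ℤ.+ 1 / m
    μm≡1 : μ * fromℕ m ≡ 1ℚ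
    μm≡1 = /-fromℕ 1 m
    0≤μ : 0ℚ ≤ μ
    0≤μ = 0≤/ 1 m
    C = fromℕ c
    M = fromℕ (N ℕ.* N)
    m≡C² : fromℕ m ≡ C * C
    m≡C² = fromℕ-* c c
    0<C : 0ℚ < C
    0<C = 0<fromℕ c

  open Caterpillar m μ public

  lev-InUnit : ∀ {d} {h : Cube (suc d) → Cube (suc d) → ℚ} → InUnit h → 0ℚ ≤ lev zero h × lev zero h ≤ 1ℚ
  lev-InUnit h01 = lev-≥0 zero (λ x y → proj₁ (h01 x y)) , lev-≤1 zero (λ x y → proj₂ (h01 x y))

  curr-bounds : ∀ {d k r} (P : Plan d k r) h → InUnit h → ∀ x → 0ℚ ≤ curr P h x × curr P h x ≤ fromℕ k
  curr-bounds done     h h01 x = ℚ.≤-refl , ℚ.≤-refl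
  curr-bounds (next P) h h01 x = ℚ.≤-refl , ℚ.≤-refl
  curr-bounds (skip P) h h01 (b ∷ x) = curr-bounds P (h ↾ b) (λ _ _ → h01 _ _) x
  curr-bounds {suc d} {suc k} (take P) h h01 (b ∷ x) =
    let lo , hi = curr-bounds P (h ↾ b) (λ _ _ → h01 _ _) x
        lo₀ , hi₀ = lev-InUnit {h = h} h01
    in 0≤-+ lo₀ lo , ℚ.≤-trans (ℚ.+-mono-≤ hi₀ hi) (ℚ.≤-reflexive (sym (fromℕ-suc k)))

  -- Since `μ * m = 1`, a block contributes at most the degree of its vertex, hence at most the
  -- number of vertices after it; the square crudely bounds the sum of these numbers.
  later-bounds : ∀ {d k r} (P : Plan d k r) A h → InUnit A → InUnit h → ∀ x →
                 0ℚ ≤ later P A h x × later P A h x ≤ fromℕ (r ℕ.* r)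
  later-bounds done     A h A01 h01 x = ℚ.≤-refl , ℚ.≤-refl
  later-bounds (skip P) A h A01 h01 (b ∷ x) = later-bounds P A (h ↾ b) A01 (λ _ _ → h01 _ _) x
  later-bounds (take P) A h A01 h01 (b ∷ x) = later-bounds P A (h ↾ b) A01 (λ _ _ → h01 _ _) x
  later-bounds {r = suc r} (next P) A h A01 h01 x =
    let lo , hi = later-bounds P (A ⁺) h (λ _ _ → A01 _ _) h01 x
        lo₀ , hi₀ = curr-bounds P h h01 x
        0≤deg = sum-≥0 r (λ v → proj₁ (A01 zero (suc v)))
        deg≤r = sum-≤ r 1ℚ (λ v → proj₂ (A01 zero (suc v)))
        first : (μ * deg A) * curr P h x ≤ fromℕ r
        first = ℚ.≤-trans (*-monoˡ (0≤-* 0≤μ 0≤deg) hi₀) (ℚ.≤-trans (ℚ.≤-reflexive (scaled (deg A)))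
                  (ℚ.≤-trans deg≤r (ℚ.≤-reflexive (ℚ.*-identityʳ (fromℕ r)))))
    in 0≤-+ (0≤-* (0≤-* 0≤μ 0≤deg) lo₀) lo ,
       ℚ.≤-trans (ℚ.+-mono-≤ first hi) (subst (_≤ fromℕ (suc r ℕ.* suc r)) (fromℕ-+ r (r ℕ.* r))
         (fromℕ-mono (ℕ.≤-trans (ℕ.+-monoʳ-≤ r (ℕ.*-monoʳ-≤ r (ℕ.n≤1+n r))) (ℕ.+-monoˡ-≤ (r ℕ.* suc r) (ℕ.n≤1+n r)))))
    where
    scaled : ∀ D → (μ * D) * fromℕ m ≡ D
    scaled D = trans (swap μ D (fromℕ m)) (trans (cong (_* D) μm≡1) (ℚ.*-identityˡ D))
      where
      swap : ∀ a b c → (a * b) * c ≡ (a * c) * b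
      swap = solve-∀ ring

  -- Placing a vertex adds at most 1 to every remaining unary term and leaves one vertex fewer, so
  -- `κ + r ≤ N` is invariant and `N` bounds everything throughout.
  Unary : ∀ {d} r → (Fin r → Cube d → ℚ) → Set
  Unary r g = Σ[ κ ∈ ℕ ] (κ ℕ.+ r ℕ.≤ N) × (∀ v x → 0ℚ ≤ g v x × g v x ≤ fromℕ κ)

  Achievable : ∀ r {d} → (Fin r → Fin r → ℚ) → (Cube d → Cube d → ℚ) → (Fin r → Cube d → ℚ) → ℚ → Set
  Achievable r A h g θ = ∃[ φ ] Increasing φ × θ ≤ obj r A h g φ

  achievable-↾ : ∀ r {d} A (h : Cube (suc d) → Cube (suc d) → ℚ) g {θ} b →
                 Achievable r A (h ↾ b) (λ v x → g v (b ∷ x)) θ → Achievable r A h g θ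
  achievable-↾ r A h g {θ} b (φ , inc , le) =
    (λ v → b ∷ φ v) , increasing-∷ b inc , subst (θ ≤_) (sym (obj-↾ r b A h g φ)) le

  -- The target is an expectation: each edge counts with the mean density of the block of its first
  -- vertex, each unary term with its mean. Every placed vertex may lose `ε`.
  Achieves : ℕ → Set
  Achieves r = ∀ {d} (P : Plan d 0 r) A (h : Cube d → Cube d → ℚ) g → InUnit A → InUnit h → Unary r g →
    Achievable r A h g ((𝔼 (later P A h) + sum (λ v → 𝔼 (g v))) - fromℕ r * ε)

  -- This plays the part of `F` in `gain`: the score expected from the vertices after the first,
  -- without their edges to it.
  future : ∀ {d k r} → Plan d k r → (Fin (suc r) → Fin (suc r) → ℚ) → (Cube d → Cube d → ℚ) →
           (Fin (suc r) → Cube d → ℚ) → Cube d → ℚ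
  future P A h g x = later P (A ⁺) h x + sum (λ v → g (suc v) x)

  𝔼-future : ∀ {d k r} (P : Plan d k r) A h g →
             𝔼 (future P A h g) ≡ 𝔼 (later P (A ⁺) h) + sum (λ v → 𝔼 (g (suc v)))
  𝔼-future {r = r} P A h g = trans (𝔼-+ (later P (A ⁺) h) _)
    (cong (𝔼 (later P (A ⁺) h) +_) (sum-𝔼 r (λ v → g (suc v))))

  -- Once the first vertex sits at a fixed point of the left half, its edges depend only on the
  -- other endpoint, on the right, so they become unary terms there. A best point `x₀` scores at
  -- least the mean, in which the edges contribute `deg A * lev zero h`.
  split : ∀ {d k r} → Achieves r → (P : Plan d k r) (A : Fin (suc r) → Fin (suc r) → ℚ) →
          ∀ (h : Cube (suc d) → Cube (suc d) → ℚ) g →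
          InUnit A → InUnit h → Unary (suc r) g →
          Achievable (suc r) A h g
            ((𝔼 (λ x → g zero (false ∷ x)) + 𝔼 (future P A (h ↾ true) (λ v x → g v (true ∷ x))) + deg A * lev zero h)
             - fromℕ r * ε)
  split {d} {k} {r} achieves P A h g A01 h01 (κ , κ≤N , g≤κ) =
    (false ∷ x₀) ◂ (λ v → true ∷ φ v) , increasing-◂ x₀ inc , (begin
      (𝔼 g₀ + EF + deg A * lev zero h) - fromℕ r * ε
        ≡⟨ cong (_- fromℕ r * ε) (sym 𝔼K) ⟩
      𝔼 K - fromℕ r * ε
        ≤⟨ ℚ.+-monoˡ-≤ (- (fromℕ r * ε)) K≤ ⟩
      K x₀ - fromℕ r * ε
        ≡⟨ regroup ⟩
      g₀ x₀ + ((𝔼 (later (drop P) (A ⁺) (h ↾ true)) + sum (λ v → 𝔼 (g′ v))) - fromℕ r * ε)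
        ≤⟨ ℚ.+-monoʳ-≤ (g₀ x₀) le ⟩
      g₀ x₀ + obj r (A ⁺) (h ↾ true) g′ φ
        ≡⟨ cong (g₀ x₀ +_) (sym (obj-↾ r true (A ⁺) h _ φ)) ⟩
      obj (suc r) A h g ((false ∷ x₀) ◂ (λ v → true ∷ φ v)) ∎)
    where
    open ℚ.≤-Reasoning
    g₀ W K : Cube d → ℚ
    g₀ x = g zero (false ∷ x)
    EF = 𝔼 (future P A (h ↾ true) (λ v x → g v (true ∷ x)))
    W x = 𝔼 (λ y → h (false ∷ x) (true ∷ y))
    K x = g₀ x + (EF + deg A * W x)
    𝔼K : 𝔼 K ≡ 𝔼 g₀ + EF + deg A * lev zero h
    𝔼K = trans (𝔼-+ g₀ (λ x → EF + deg A * W x))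
      (trans (cong (𝔼 g₀ +_) (trans (𝔼-+ (λ _ → EF) (λ x → deg A * W x)) (cong₂ _+_ (𝔼-const {d} EF) (𝔼-* (deg A) W))))
        (sym (ℚ.+-assoc (𝔼 g₀) EF (deg A * lev zero h))))
    x₀ = proj₁ (𝔼-≤-attained K)
    K≤ = proj₂ (𝔼-≤-attained K)
    g′ : Fin r → Cube d → ℚ
    g′ v y = g (suc v) (true ∷ y) + A zero (suc v) * h (false ∷ x₀) (true ∷ y)
    g′-unary : Unary r g′
    g′-unary = suc κ , ℕ.≤-trans (ℕ.≤-reflexive (sym (ℕ.+-suc κ r))) κ≤N , λ v y →
      let lo , hi = g≤κ (suc v) (true ∷ y)
          a0 , a1 = A01 zero (suc v)
          h0 , h1 = h01 (false ∷ x₀) (true ∷ y)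
      in 0≤-+ lo (0≤-* a0 h0) , subst (g′ v y ≤_) (trans (ℚ.+-comm (fromℕ κ) 1ℚ) (sym (fromℕ-suc κ))) (ℚ.+-mono-≤ hi (*-mono a0 0≤1 a1 h1))
    ih = achieves (drop P) (A ⁺) (h ↾ true) g′ (λ _ _ → A01 _ _) (λ _ _ → h01 _ _) g′-unary
    φ = proj₁ ih
    inc = proj₁ (proj₂ ih)
    le = proj₂ (proj₂ ih)
    L = 𝔼 (later P (A ⁺) (h ↾ true))
    S = sum (λ v → 𝔼 (λ y → g (suc v) (true ∷ y)))
    𝔼-g′ : sum (λ v → 𝔼 (g′ v)) ≡ S + deg A * W x₀
    𝔼-g′ = trans (sum-cong r λ v → trans (𝔼-+ (λ y → g (suc v) (true ∷ y)) (λ y → A zero (suc v) * h (false ∷ x₀) (true ∷ y)))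
        (cong (𝔼 (λ y → g (suc v) (true ∷ y)) +_) (trans (𝔼-* (A zero (suc v)) (λ y → h (false ∷ x₀) (true ∷ y))) (ℚ.*-comm (A zero (suc v)) (W x₀)))))
      (trans (sum-+ r _ _) (cong (S +_) (trans (sum-* r (W x₀) (λ v → A zero (suc v))) (ℚ.*-comm (W x₀) (deg A)))))
    regroup : K x₀ - fromℕ r * ε ≡ g₀ x₀ + ((𝔼 (later (drop P) (A ⁺) (h ↾ true)) + sum (λ v → 𝔼 (g′ v))) - fromℕ r * ε)
    regroup = trans (cong (λ q → (g₀ x₀ + (q + deg A * W x₀)) - fromℕ r * ε) (𝔼-future P A (h ↾ true) (λ v x → g v (true ∷ x))))
      (trans (shuffle (g₀ x₀) L S (deg A * W x₀) (fromℕ r * ε))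
        (cong₂ (λ p q → g₀ x₀ + ((p + q) - fromℕ r * ε)) (sym (𝔼-cong (later-drop P (A ⁺) (h ↾ true)))) (sym 𝔼-g′)))
      where
      shuffle : ∀ a l s w e → (a + ((l + s) + w)) - e ≡ a + ((l + (s + w)) - e)
      shuffle = solve-∀ ring

  -- Pigeonhole along the block: some level, in some subcube, offers a split worth at least the
  -- average `θ`. Strictness of the hypothesis excludes an exhausted block, where both sides vanish.
  choose : ∀ {d k r} → Achieves r → (P : Plan d k r) (A : Fin (suc r) → Fin (suc r) → ℚ) →
           ∀ h g θ → InUnit A → InUnit h → Unary (suc r) g →
           fromℕ k * θ < gain P (deg A) h (g zero) (future P A h g) →
           Achievable (suc r) A h g (θ - fromℕ r * ε)
  choose achieves done     A h g θ A01 h01 ug lt = ⊥-elim (ℚ.<-irrefl (ℚ.*-zeroˡ θ) lt)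
  choose achieves (next P) A h g θ A01 h01 ug lt = ⊥-elim (ℚ.<-irrefl (ℚ.*-zeroˡ θ) lt)
  choose {r = r} achieves (skip P) A h g θ A01 h01 (κ , κ≤N , g≤κ) lt =
    [ (λ lt₀ → achievable-↾ (suc r) A h g false (choose achieves P A (h ↾ false) (λ v x → g v (false ∷ x)) θ A01
        (λ x y → h01 (false ∷ x) (false ∷ y)) (κ , κ≤N , λ v x → g≤κ v (false ∷ x)) lt₀))
    , (λ lt₁ → achievable-↾ (suc r) A h g true (choose achieves P A (h ↾ true) (λ v x → g v (true ∷ x)) θ A01
        (λ x y → h01 (true ∷ x) (true ∷ y)) (κ , κ≤N , λ v x → g≤κ v (true ∷ x)) lt₁))
    ]′ (half-<-max lt)
  choose {suc d} {suc k} {r} achieves (take P) A h g θ A01 h01 ug@(κ , κ≤N , g≤κ) lt = decide (θ ℚ.≤? O)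
    where
    O = 𝔼 (λ x → g zero (false ∷ x)) + 𝔼 (future P A (h ↾ true) (λ v x → g v (true ∷ x))) + deg A * lev zero h
    -- If the split here is worth less than `θ`, the other `k` levels must exceed their share, and
    -- so they do in one of the halves.
    rest : ¬ (θ ≤ O) → fromℕ k * θ <
           ½ * (gain P (deg A) (h ↾ false) (λ x → g zero (false ∷ x)) (λ x → future (take P) A h g (false ∷ x))
              + gain P (deg A) (h ↾ true) (λ x → g zero (true ∷ x)) (λ x → future (take P) A h g (true ∷ x)))
    rest θ≰O = ℚ.≰⇒> λ ge → <⇒≱ lt (ℚ.≤-trans (ℚ.+-mono-≤ (ℚ.<⇒≤ (ℚ.≰⇒> θ≰O)) ge)
      (ℚ.≤-reflexive (trans (factor θ (fromℕ k)) (cong (_* θ) (sym (fromℕ-suc k))))))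
      where
      factor : ∀ t k → t + k * t ≡ (1ℚ + k) * t
      factor = solve-∀ ring
    decide : Dec (θ ≤ O) → Achievable (suc r) A h g (θ - fromℕ r * ε)
    decide (yes θ≤O) =
      let φ , inc , le = split achieves P A h g A01 h01 ug
      in φ , inc , ℚ.≤-trans (ℚ.+-monoˡ-≤ (- (fromℕ r * ε)) θ≤O) le
    decide (no θ≰O) =
      [ (λ lt₀ → achievable-↾ (suc r) A h g false (choose achieves P A (h ↾ false) (λ v x → g v (false ∷ x)) θ A01
          (λ x y → h01 (false ∷ x) (false ∷ y)) (κ , κ≤N , λ v x → g≤κ v (false ∷ x)) lt₀))
      , (λ lt₁ → achievable-↾ (suc r) A h g true (choose achieves P A (h ↾ true) (λ v x → g v (true ∷ x)) θ A01
          (λ x y → h01 (true ∷ x) (true ∷ y)) (κ , κ≤N , λ v x → g≤κ v (true ∷ x)) lt₁))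
      ]′ (half-<-max (rest θ≰O))

  -- The inequality `|u|≤M⇒` with `c = C` is averaged. The second moment of `sgn P` is `m = C * C`,
  -- so both squares have mean `C * C` and a common factor `2 C` cancels.
  covariance : ∀ {d r} (P : Plan d m r) (u : Cube d → ℚ) → (∀ x → u x ≤ M × - M ≤ u x) →
               0ℚ ≤ 𝔼 (λ x → u x * sgn P x) + M * C
  covariance {d} P u u≤M = *-cancelˡ-≤ 0<2C (subst₂ _≤_ (sym (ℚ.*-zeroʳ ((1ℚ + 1ℚ) * C))) total
    (𝔼-≥0 {d} λ x → |u|≤M⇒ M (u x) (sgn P x) C (proj₁ (u≤M x)) (proj₂ (u≤M x))))
    where
    open ≡-Reasoning
    0<2C : 0ℚ < (1ℚ + 1ℚ) * C
    0<2C = 0<-* (ℚ.positive⁻¹ (1ℚ + 1ℚ)) 0<C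
    X = 𝔼 (λ x → u x * sgn P x)
    𝔼s² : 𝔼 (λ x → sgn P x * sgn P x) ≡ C * C
    𝔼s² = trans (𝔼-cong {d} λ x → cong (λ q → q * q) (sym (ℚ.+-identityˡ (sgn P x))))
      (trans (𝔼-sgn² P 0ℚ) (trans (cong (0ℚ * 0ℚ +_) m≡C²) (ℚ.+-identityˡ (C * C))))
    collect : ∀ c x m → ((1ℚ + 1ℚ) * c) * x + m * (c * c + c * c) ≡ ((1ℚ + 1ℚ) * c) * (x + m * c)
    collect = solve-∀ ring
    total : 𝔼 (λ x → ((1ℚ + 1ℚ) * C) * (u x * sgn P x) + M * (sgn P x * sgn P x + C * C)) ≡
            ((1ℚ + 1ℚ) * C) * (X + M * C)
    total = begin
      𝔼 (λ x → ((1ℚ + 1ℚ) * C) * (u x * sgn P x) + M * (sgn P x * sgn P x + C * C))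
        ≡⟨ 𝔼-+ (λ x → ((1ℚ + 1ℚ) * C) * (u x * sgn P x)) _ ⟩
      𝔼 (λ x → ((1ℚ + 1ℚ) * C) * (u x * sgn P x)) + 𝔼 (λ x → M * (sgn P x * sgn P x + C * C))
        ≡⟨ cong₂ _+_ (𝔼-* ((1ℚ + 1ℚ) * C) (λ x → u x * sgn P x)) (trans (𝔼-* M (λ x → sgn P x * sgn P x + C * C))
             (cong (M *_) (trans (𝔼-+ (λ x → sgn P x * sgn P x) (λ _ → C * C)) (cong₂ _+_ 𝔼s² (𝔼-const {d} (C * C)))))) ⟩
      ((1ℚ + 1ℚ) * C) * X + M * (C * C + C * C)
        ≡⟨ collect C X M ⟩
      ((1ℚ + 1ℚ) * C) * (X + M * C) ∎

  -- Both functions lie between 0 and `M`: `future` is at most `r * r + r * κ = r * (r + κ)`, where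
  -- both factors are at most `N`, and `g zero` is at most `κ ≤ N ≤ N * N`.
  future-bounds : ∀ {d k r} (P : Plan d k r) A h g → InUnit A → InUnit h → Unary (suc r) g → ∀ x →
                  (future P A h g x - g zero x ≤ M) × (- M ≤ future P A h g x - g zero x)
  future-bounds {r = r} P A h g A01 h01 (κ , κ≤N , g≤κ) x =
    ≤-by (0≤-+ (proj₁ (g≤κ zero x)) (≤⇒0≤- F≤M)) (upper (future P A h g x) (g zero x) M) ,
    ≤-by (0≤-+ 0≤F (≤⇒0≤- g₀≤M)) (lower (future P A h g x) (g zero x) M)
    where
    upper : ∀ F g M → (F - g) + (g + (M - F)) ≡ M
    upper = solve-∀ ring
    lower : ∀ F g M → - M + (F + (M - g)) ≡ F - g
    lower = solve-∀ ring
    0≤F : 0ℚ ≤ future P A h g x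
    0≤F = 0≤-+ (proj₁ (later-bounds P (A ⁺) h (λ _ _ → A01 _ _) h01 x)) (sum-≥0 r (λ v → proj₁ (g≤κ (suc v) x)))
    F≤M : future P A h g x ≤ M
    F≤M = ℚ.≤-trans (ℚ.+-mono-≤ (proj₂ (later-bounds P (A ⁺) h (λ _ _ → A01 _ _) h01 x))
                                (sum-≤ r (fromℕ κ) (λ v → proj₂ (g≤κ (suc v) x))))
      (ℚ.≤-trans (ℚ.≤-reflexive (trans (cong (fromℕ (r ℕ.* r) +_) (sym (fromℕ-* r κ))) (sym (fromℕ-+ (r ℕ.* r) (r ℕ.* κ)))))
        (fromℕ-mono (ℕ.≤-trans (ℕ.≤-reflexive (sym (ℕ.*-distribˡ-+ r r κ)))
          (ℕ.*-mono-≤ (ℕ.≤-trans (ℕ.≤-trans (ℕ.n≤1+n r) (ℕ.m≤n+m (suc r) κ)) κ≤N)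
                      (ℕ.≤-trans (ℕ.≤-reflexive (ℕ.+-comm r κ)) (ℕ.≤-trans (ℕ.+-monoʳ-≤ κ (ℕ.n≤1+n r)) κ≤N))))))
    g₀≤M : g zero x ≤ M
    g₀≤M = ℚ.≤-trans (proj₂ (g≤κ zero x)) (fromℕ-mono (ℕ.≤-trans κ≤N′ (N≤N² N)))
      where
      κ≤N′ : κ ℕ.≤ N
      κ≤N′ = ℕ.≤-trans (ℕ.m≤m+n κ (suc r)) κ≤N
      N≤N² : ∀ N → N ℕ.≤ N ℕ.* N
      N≤N² zero    = ℕ.z≤n
      N≤N² (suc N) = ℕ.m≤m*n (suc N) (suc N)

  achieves : ∀ r → Achieves r
  achieves zero {d} done A h g A01 h01 ug = (λ ()) , (λ ()) , ℚ.≤-reflexive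
    (trans (cong (λ q → (q + 0ℚ) - 0ℚ * ε) (𝔼-const {d} 0ℚ)) (lemma ε))
    where
    lemma : ∀ ε → (0ℚ + 0ℚ) - 0ℚ * ε ≡ 0ℚ
    lemma = solve-∀ ring
  achieves r {suc d} (skip P) A h g A01 h01 (κ , κ≤N , g≤κ) =
    [ (λ le → achievable-↾ r A h g false (φ₀ , inc₀ , ℚ.≤-trans le le₀))
    , (λ le → achievable-↾ r A h g true (φ₁ , inc₁ , ℚ.≤-trans le le₁))
    -- At a level outside the plan the target is exactly the mean of the targets of the two halves,
    -- so one half is good enough.
    ]′ (half-≤-max {θ} {θ} {θ₀} {θ₁} (ℚ.≤-reflexive average))
    where
    ih₀ = achieves r P A (h ↾ false) (λ v x → g v (false ∷ x)) A01
            (λ x y → h01 (false ∷ x) (false ∷ y)) (κ , κ≤N , λ v x → g≤κ v (false ∷ x))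
    ih₁ = achieves r P A (h ↾ true) (λ v x → g v (true ∷ x)) A01
            (λ x y → h01 (true ∷ x) (true ∷ y)) (κ , κ≤N , λ v x → g≤κ v (true ∷ x))
    φ₀ = proj₁ ih₀
    inc₀ = proj₁ (proj₂ ih₀)
    le₀ = proj₂ (proj₂ ih₀)
    φ₁ = proj₁ ih₁
    inc₁ = proj₁ (proj₂ ih₁)
    le₁ = proj₂ (proj₂ ih₁)
    S₀ = sum (λ v → 𝔼 (λ x → g v (false ∷ x)))
    S₁ = sum (λ v → 𝔼 (λ x → g v (true ∷ x)))
    L₀ = 𝔼 (later P A (h ↾ false))
    L₁ = 𝔼 (later P A (h ↾ true))
    θ = (𝔼 (later (skip P) A h) + sum (λ v → 𝔼 (g v))) - fromℕ r * ε
    θ₀ = (L₀ + S₀) - fromℕ r * ε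
    θ₁ = (L₁ + S₁) - fromℕ r * ε
    lemma : ∀ l l′ s s′ e → ½ * (((½ * (l + l′) + ½ * (s + s′)) - e) + ((½ * (l + l′) + ½ * (s + s′)) - e)) ≡
            ½ * (((l + s) - e) + ((l′ + s′) - e))
    lemma = solve-∀ ring
    average : ½ * (θ + θ) ≡ ½ * (θ₀ + θ₁)
    average = trans (cong (λ q → ½ * (((½ * (L₀ + L₁) + q) - fromℕ r * ε) + ((½ * (L₀ + L₁) + q) - fromℕ r * ε)))
      (trans (sum-* r ½ (λ v → 𝔼 (λ x → g v (false ∷ x)) + 𝔼 (λ x → g v (true ∷ x))))
        (cong (½ *_) (sum-+ r (λ v → 𝔼 (λ x → g v (false ∷ x))) (λ v → 𝔼 (λ x → g v (true ∷ x)))))))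
      (lemma L₀ L₁ S₀ S₁ (fromℕ r * ε))
  achieves (suc r) {d} (next P) A h g A01 h01 ug =
    let φ , inc , le = choose (achieves r) P A h g θ A01 h01 ug enough
    in φ , inc , ℚ.≤-trans (ℚ.≤-reflexive target) le
    where
    F = future P A h g
    a = deg A
    K = 𝔼 (curr P h)
    X = 𝔼 (λ x → (F x - g zero x) * sgn P x)
    -- The unbiased mean value of a split, lowered by `ε`. Over the block the allowance
    -- `m * ε = C * (ε * C)` exceeds the possible bias `M * C`, because `M < ε * C`.
    θ = ((𝔼 (g zero) + 𝔼 F) + (μ * a) * K) - ε
    enough : fromℕ m * θ < gain P a h (g zero) F
    enough = subst (fromℕ m * θ <_) (sym (gain-≡ P a h (g zero) F)) (<-by slack (begin
      fromℕ m * θ + ((X + M * C) + C * (ε * C - M))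
        ≡⟨ lemma (fromℕ m) (𝔼 (g zero) + 𝔼 F) μ a K ε X M C ⟩
      ((fromℕ m * (𝔼 (g zero) + 𝔼 F) + X) + a * ((μ * fromℕ m) * K)) + (ε * (C * C) - ε * fromℕ m)
        ≡⟨ cong₂ (λ p q → ((fromℕ m * (𝔼 (g zero) + 𝔼 F) + X) + a * (p * K)) + (ε * q - ε * fromℕ m)) μm≡1 (sym m≡C²) ⟩
      ((fromℕ m * (𝔼 (g zero) + 𝔼 F) + X) + a * (1ℚ * K)) + (ε * fromℕ m - ε * fromℕ m)
        ≡⟨ finish (fromℕ m * (𝔼 (g zero) + 𝔼 F) + X) a K (ε * fromℕ m) ⟩
      (fromℕ m * (𝔼 (g zero) + 𝔼 F) + X) + a * K ∎))
      where
      open ≡-Reasoning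
      slack : 0ℚ < (X + M * C) + C * (ε * C - M)
      slack = subst (_< (X + M * C) + C * (ε * C - M)) (ℚ.+-identityˡ 0ℚ)
        (ℚ.+-mono-≤-< (covariance P (λ x → F x - g zero x) (future-bounds P A h g A01 h01 ug)) (0<-* 0<C (<⇒0<- N²<εc)))
      lemma : ∀ m e μ a k ε x M c →
        m * ((e + (μ * a) * k) - ε) + ((x + M * c) + c * (ε * c - M)) ≡
        ((m * e + x) + a * ((μ * m) * k)) + (ε * (c * c) - ε * m)
      lemma = solve-∀ ring
      finish : ∀ y a k z → (y + a * (1ℚ * k)) + (z - z) ≡ y + a * k
      finish = solve-∀ ring
    S = sum (λ v → 𝔼 (g (suc v)))
    L = 𝔼 (later P (A ⁺) h)
    target : (𝔼 (later (next P) A h) + sum (λ v → 𝔼 (g v))) - fromℕ (suc r) * ε ≡ θ - fromℕ r * ε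
    target = trans
      (cong₂ (λ p q → (p + (𝔼 (g zero) + S)) - q * ε)
        (trans (𝔼-+ (λ x → (μ * a) * curr P h x) _) (cong (_+ L) (𝔼-* (μ * a) (curr P h)))) (fromℕ-suc r))
      (trans (lemma ((μ * a) * K) L (𝔼 (g zero)) S (fromℕ r) ε)
        (cong (λ q → (((𝔼 (g zero) + q) + (μ * a) * K) - ε) - fromℕ r * ε) (sym (𝔼-future P A h g))))
      where
      lemma : ∀ k l g s r ε → ((k + l) + (g + s)) - (1ℚ + r) * ε ≡ (((g + (l + s)) + k) - ε) - r * ε
      lemma = solve-∀ ring

-- Rich graphs

wt : ∀ n → (Fin n → Fin n → ℚ) → ℚ
wt zero    A = 0ℚ
wt (suc n) A = deg A + wt n (A ⁺)

wt-cong : ∀ n {A B : Fin n → Fin n → ℚ} → (∀ u v → A u v ≡ B u v) → wt n A ≡ wt n B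
wt-cong zero    eq = refl
wt-cong (suc n) eq = cong₂ _+_ (sum-cong n λ v → eq zero (suc v)) (wt-cong n λ u v → eq (suc u) (suc v))

wt-≡ : ∀ n (a : Fin n → Fin n → Bool) →
       sum (λ u → sum (λ v → 𝟙 (does (u Fin.<? v) ∧ a u v))) ≡ wt n (ind a)
wt-≡ zero    a = refl
wt-≡ (suc n) a = cong₂ _+_ (ℚ.+-identityˡ (sum λ v → 𝟙 (a zero (suc v))))
  (trans (sum-cong n λ u → ℚ.+-identityˡ (sum λ v → 𝟙 (does (u Fin.<? v) ∧ a (suc u) (suc v))))
         (wt-≡ n (λ u v → a (suc u) (suc v))))

e-wt : ∀ {n} (G : Graph (Fin n)) → fromℕ (e G) ≡ wt n (ind (adj G))
e-wt {n} G = begin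
  fromℕ (e G)
    ≡⟨ fromℕ-length-filter _ (cartesianProduct (allFin n) (allFin n)) ⟩
  ∑ (cartesianProduct (allFin n) (allFin n)) (λ (u , v) → E u v)
    ≡⟨ ∑-cartesianProduct (allFin n) (allFin n) _ ⟩
  ∑ (allFin n) (λ u → ∑ (allFin n) (E u))
    ≡⟨ trans (∑-allFin n _) (sum-cong n λ u → ∑-allFin n (E u)) ⟩
  sum (λ u → sum (E u))
    ≡⟨ wt-≡ n (adj G) ⟩
  wt n (ind (adj G)) ∎
  where
  open ≡-Reasoning
  E : Fin n → Fin n → ℚ
  E u v = 𝟙 (does (u Fin.<? v) ∧ adj G u v)

obj-wt : ∀ n {d} A (h : Cube d → Cube d → ℚ) g φ →
         obj n A h g φ ≡ sum (λ v → g v (φ v)) + wt n (λ u v → A u v * h (φ u) (φ v))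
obj-wt zero    A h g φ = refl
obj-wt (suc n) A h g φ = trans
  (cong (g zero (φ zero) +_) (trans (obj-wt n (A ⁺) h _ (φ ∘ suc)) (cong (_+ W) (sum-+ n _ _))))
  (lemma (g zero (φ zero)) (sum λ v → g (suc v) (φ (suc v))) (sum λ v → A zero (suc v) * h (φ zero) (φ (suc v))) W)
  where
  W = wt n (λ u v → A (suc u) (suc v) * h (φ (suc u)) (φ (suc v)))
  lemma : ∀ a b c w → a + ((b + c) + w) ≡ (a + b) + (c + w)
  lemma = solve-∀ ring

ratio-fromℕ : ∀ {n} {G : Graph (Fin n)} .{{_ : NonZero (e G)}} (S : Subgraph G) →
              ratio S * fromℕ (e G) ≡ fromℕ (e (edges S))
ratio-fromℕ {G = G} S = /-fromℕ (e (edges S)) (e G)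

archimedean-* : ∀ a {ε} → 0ℚ < ε → ∃[ c ] NonZero c × a < ε * fromℕ c
archimedean-* a {ε} 0<ε = suc n , _ , subst (_< ε * fromℕ (suc n)) cancel
  (*-monoˡ-< 0<ε (ℚ.<-≤-trans a/ε<n (fromℕ-mono (ℕ.n≤1+n n))))
  where
  instance
    ε≢0 : ℚ.NonZero ε
    ε≢0 = ℚ.>-nonZero 0<ε
  n = proj₁ (archimedean (a * 1/ ε))
  a/ε<n = proj₂ (archimedean (a * 1/ ε))
  swap : ∀ e a i → e * (a * i) ≡ a * (e * i)
  swap = solve-∀ ring
  cancel : ε * (a * 1/ ε) ≡ a
  cancel = trans (swap ε a (1/ ε)) (trans (cong (a *_) (ℚ.*-inverseʳ ε)) (ℚ.*-identityʳ a))

module PlanLevels (m : ℕ) (μ : ℚ) (0≤μ : 0ℚ ≤ μ) (μm≡1 : μ * fromℕ m ≡ 1ℚ) where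

  open Caterpillar m μ

  Within : ∀ {d k r} → Plan d k r → (Fin d → Set) → Set
  Within done     Q = Unit.⊤
  Within (skip P) Q = Within P (Q ∘ suc)
  Within (take P) Q = Q zero × Within P (Q ∘ suc)
  Within (next P) Q = Within P Q

  plan : ∀ {d} (L : Subset d) k r → k ℕ.+ r ℕ.* m ℕ.≤ ∣ L ∣ → Plan d k r
  plan L           zero    zero    le = done
  plan L           zero    (suc r) le = next (plan L m r le)
  plan (false ∷ L) (suc k) r       le = skip (plan L (suc k) r le)
  plan (true ∷ L)  (suc k) r       le = take (plan L k r (ℕ.s≤s⁻¹ le))

  plan-within : ∀ {d} (L : Subset d) k r le {Q : Fin d → Set} → (∀ ℓ → ℓ ∈ L → Q ℓ) → Within (plan L k r le) Q
  plan-within L           zero    zero    le q = _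
  plan-within L           zero    (suc r) le q = plan-within L m r le q
  plan-within (false ∷ L) (suc k) r       le q = plan-within L (suc k) r le (λ ℓ ℓ∈ → q (suc ℓ) (there ℓ∈))
  plan-within (true ∷ L)  (suc k) r       le q =
    q zero here , plan-within L k r (ℕ.s≤s⁻¹ le) (λ ℓ ℓ∈ → q (suc ℓ) (there ℓ∈))

  currSum : ∀ {d k r} → Plan d k r → (Fin d → ℚ) → ℚ
  currSum done     t = 0ℚ
  currSum (next P) t = 0ℚ
  currSum (skip P) t = currSum P (t ∘ suc)
  currSum (take P) t = t zero + currSum P (t ∘ suc)

  laterSum : ∀ {d k r} → Plan d k r → (Fin r → Fin r → ℚ) → (Fin d → ℚ) → ℚ
  laterSum done     A t = 0ℚ
  laterSum (next P) A t = (μ * deg A) * currSum P t + laterSum P (A ⁺) t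
  laterSum (skip P) A t = laterSum P A (t ∘ suc)
  laterSum (take P) A t = laterSum P A (t ∘ suc)

  currSum-half : ∀ {d k r} (P : Plan d k r) t t′ → currSum P (λ ℓ → ½ * (t ℓ + t′ ℓ)) ≡ ½ * (currSum P t + currSum P t′)
  currSum-half done     t t′ = refl
  currSum-half (next P) t t′ = refl
  currSum-half (skip P) t t′ = currSum-half P (t ∘ suc) (t′ ∘ suc)
  currSum-half (take P) t t′ = trans (cong (½ * (t zero + t′ zero) +_) (currSum-half P (t ∘ suc) (t′ ∘ suc)))
    (lemma (t zero) (t′ zero) (currSum P (t ∘ suc)) (currSum P (t′ ∘ suc)))
    where
    lemma : ∀ a b c d → ½ * (a + b) + ½ * (c + d) ≡ ½ * ((a + c) + (b + d))
    lemma = solve-∀ ring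

  laterSum-half : ∀ {d k r} (P : Plan d k r) A t t′ → laterSum P A (λ ℓ → ½ * (t ℓ + t′ ℓ)) ≡ ½ * (laterSum P A t + laterSum P A t′)
  laterSum-half done     A t t′ = refl
  laterSum-half (skip P) A t t′ = laterSum-half P A (t ∘ suc) (t′ ∘ suc)
  laterSum-half (take P) A t t′ = laterSum-half P A (t ∘ suc) (t′ ∘ suc)
  laterSum-half (next P) A t t′ = trans
    (cong₂ (λ p q → (μ * deg A) * p + q) (currSum-half P t t′) (laterSum-half P (A ⁺) t t′))
    (lemma (μ * deg A) (currSum P t) (currSum P t′) (laterSum P (A ⁺) t) (laterSum P (A ⁺) t′))
    where
    lemma : ∀ w a b c d → w * (½ * (a + b)) + ½ * (c + d) ≡ ½ * ((w * a + c) + (w * b + d))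
    lemma = solve-∀ ring

  -- The densities of a level in the subcubes above it average to its density in the whole cube, so
  -- the dependence on the path disappears.
  𝔼-curr : ∀ {d k r} (P : Plan d k r) h → 𝔼 (curr P h) ≡ currSum P (λ ℓ → lev ℓ h)
  𝔼-curr {d} done     h = 𝔼-const {d} 0ℚ
  𝔼-curr {d} (next P) h = 𝔼-const {d} 0ℚ
  𝔼-curr (skip P) h = trans (cong (½ *_) (cong₂ _+_ (𝔼-curr P (h ↾ false)) (𝔼-curr P (h ↾ true))))
    (sym (currSum-half P _ _))
  𝔼-curr {suc d} (take P) h = trans
    (cong (½ *_) (cong₂ _+_ (shift (h ↾ false)) (shift (h ↾ true))))
    (trans (lemma (lev zero h) (𝔼 (curr P (h ↾ false))) (𝔼 (curr P (h ↾ true))))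
      (cong (lev zero h +_) (trans (cong (½ *_) (cong₂ _+_ (𝔼-curr P (h ↾ false)) (𝔼-curr P (h ↾ true)))) (sym (currSum-half P _ _)))))
    where
    shift : ∀ (h′ : Cube d → Cube d → ℚ) → 𝔼 (λ x → lev zero h + curr P h′ x) ≡ lev zero h + 𝔼 (curr P h′)
    shift h′ = trans (𝔼-+ (λ _ → lev zero h) (curr P h′)) (cong (_+ 𝔼 (curr P h′)) (𝔼-const {d} (lev zero h)))
    lemma : ∀ l a b → ½ * ((l + a) + (l + b)) ≡ l + ½ * (a + b)
    lemma = solve-∀ ring

  𝔼-later : ∀ {d k r} (P : Plan d k r) A h → 𝔼 (later P A h) ≡ laterSum P A (λ ℓ → lev ℓ h)
  𝔼-later {d} done A h = 𝔼-const {d} 0ℚ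
  𝔼-later (skip P) A h = trans (cong (½ *_) (cong₂ _+_ (𝔼-later P A (h ↾ false)) (𝔼-later P A (h ↾ true))))
    (sym (laterSum-half P A _ _))
  𝔼-later (take P) A h = trans (cong (½ *_) (cong₂ _+_ (𝔼-later P A (h ↾ false)) (𝔼-later P A (h ↾ true))))
    (sym (laterSum-half P A _ _))
  𝔼-later (next P) A h = trans (𝔼-+ (λ x → (μ * deg A) * curr P h x) (later P (A ⁺) h))
    (cong₂ _+_ (trans (𝔼-* (μ * deg A) (curr P h)) (cong ((μ * deg A) *_) (𝔼-curr P h))) (𝔼-later P (A ⁺) h))

  currSum-≥ : ∀ {d k r} (P : Plan d k r) {t : Fin d → ℚ} {p} → Within P (λ ℓ → p ≤ t ℓ) → fromℕ k * p ≤ currSum P t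
  currSum-≥ done     {p = p} w = ℚ.≤-reflexive (ℚ.*-zeroˡ p)
  currSum-≥ (next P) {p = p} w = ℚ.≤-reflexive (ℚ.*-zeroˡ p)
  currSum-≥ (skip P) w = currSum-≥ P w
  currSum-≥ {k = suc k} (take P) {p = p} (le , w) = ℚ.≤-trans
    (ℚ.≤-reflexive (trans (cong (_* p) (fromℕ-suc k)) (lemma (fromℕ k) p))) (ℚ.+-mono-≤ le (currSum-≥ P w))
    where
    lemma : ∀ k p → (1ℚ + k) * p ≡ p + k * p
    lemma = solve-∀ ring

  -- The `m` levels of a block have mean at least `p`, as `μ * m = 1`, and every edge is counted in
  -- the degree of exactly one vertex, its first.
  laterSum-≥ : ∀ {d k r} (P : Plan d k r) {A} {t : Fin d → ℚ} {p} → (∀ u v → 0ℚ ≤ A u v) →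
               Within P (λ ℓ → p ≤ t ℓ) → wt r A * p ≤ laterSum P A t
  laterSum-≥ done     {p = p} 0≤A w = ℚ.≤-reflexive (ℚ.*-zeroˡ p)
  laterSum-≥ (skip P) 0≤A w = laterSum-≥ P 0≤A w
  laterSum-≥ (take P) 0≤A (_ , w) = laterSum-≥ P 0≤A w
  laterSum-≥ {r = suc r} (next P) {A} {p = p} 0≤A w = ℚ.≤-trans
    (ℚ.≤-reflexive (trans (ℚ.*-distribʳ-+ p (deg A) (wt r (A ⁺))) (cong (_+ wt r (A ⁺) * p) (sym scaled))))
    (ℚ.+-mono-≤ (*-monoˡ (0≤-* 0≤μ (sum-≥0 r λ v → 0≤A zero (suc v))) (currSum-≥ P w))
                (laterSum-≥ P (λ u v → 0≤A (suc u) (suc v)) w))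
    where
    swap : ∀ a b c p → (a * b) * (c * p) ≡ (a * c) * (b * p)
    swap = solve-∀ ring
    scaled : (μ * deg A) * (fromℕ m * p) ≡ deg A * p
    scaled = trans (swap μ (deg A) (fromℕ m) p) (trans (cong (_* (deg A * p)) μm≡1) (ℚ.*-identityˡ (deg A * p)))

RichSuffices : ∀ {k} → Graph (Fin k) → ℚ → ℕ → Set
RichSuffices F p C = ∀ d (H : Graph (Cube d)) (L : Subset d) → C ℕ.≤ ∣ L ∣ →
  (∀ ℓ → ℓ ∈ L → p ≤ lev ℓ (ind (adj H))) → Embedding F _<lex_ H

pullback : ∀ {n d} (G : Graph (Fin n)) (H : Graph (Cube d)) → (Fin n → Cube d) → Subgraph G
pullback G H φ = record
  { verts = ⊤
  ; edges = record
    { adj        = λ u v → adj G u v ∧ adj H (φ u) (φ v)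
    ; adj-sym    = λ u v → cong₂ _∧_ (adj-sym G u v) (adj-sym H (φ u) (φ v))
    ; adj-irrefl = λ v → cong (_∧ adj H (φ v) (φ v)) (adj-irrefl G v)
    }
  ; edges⊆     = λ u v → proj₁ ∘ Equivalence.to Bool.T-∧
  ; edges-ends = λ u v _ → ∈⊤
  }

e-pullback : ∀ {n d} (G : Graph (Fin n)) (H : Graph (Cube d)) φ →
             fromℕ (e (edges (pullback G H φ))) ≡ wt n (λ u v → ind (adj G) u v * ind (adj H) (φ u) (φ v))
e-pullback {n} G H φ = trans (e-wt (edges (pullback G H φ))) (wt-cong n λ u v → 𝟙-∧ (adj G u v) (adj H (φ u) (φ v)))

module _ {k n d : ℕ} (F : Graph (Fin k)) (G : Graph (Fin n)) .{{_ : NonZero (e G)}} (H : Graph (Cube d)) where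

  private
    E = fromℕ (e G)
    h = ind (adj H)
    A = ind (adj G)
    W : (Fin n → Cube d) → ℚ
    W φ = wt n (λ u v → A u v * h (φ u) (φ v))

  -- The edges of G that φ preserves form an F-free subgraph unless H contains F.

  preserved⇒contains : ∀ (φ : Fin n → Cube d) → Increasing φ → ρ F G * E < W φ → Embedding F _<lex_ H
  preserved⇒contains φ inc lt = decide (subgraphContains? S F)
    where
    S = pullback G H φ
    decide : Dec (SubgraphContains S F) → Embedding F _<lex_ H
    decide (yes (ψ , _)) = record
      { to       = λ i → φ (to ψ i)
      ; to-mono  = λ i j i<j → inc _ _ (to-mono ψ i j i<j)
      ; to-edges = λ i j t → proj₂ (Equivalence.to (Bool.T-∧ {adj G (to ψ i) (to ψ j)}) (to-edges ψ i j t))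
      }
    decide (no free) = ⊥-elim (<⇒≱ lt (ℚ.≤-trans
      (ℚ.≤-reflexive (trans (sym (e-pullback G H φ)) (sym (ratio-fromℕ S))))
      (*-monoʳ (0≤fromℕ (e G)) (ρ-upper F G S free))))

  module _ (c : ℕ) .{{_ : NonZero c}} (ε : ℚ) (n²<εc : fromℕ (n ℕ.* n) < ε * fromℕ c) where

    private
      m = c ℕ.* c
      instance
        m≢0 : NonZero m
        m≢0 = ℕ.m*n≢0 c c

    open Achieve c n ε n²<εc
    open PlanLevels m (ℤ.+ 1 / m) (0≤/ 1 m) (/-fromℕ 1 m)

    rich⇒preserved : ∀ (L : Subset d) {p} → n ℕ.* m ℕ.≤ ∣ L ∣ → (∀ ℓ → ℓ ∈ L → p ≤ lev ℓ h) →
                     ∃[ φ ] Increasing φ × E * p - fromℕ n * ε ≤ W φ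
    rich⇒preserved L {p} C≤L rich = φ , inc , ℚ.≤-trans θ≥ (ℚ.≤-trans le
      (ℚ.≤-reflexive (trans (obj-wt n A h (λ _ _ → 0ℚ) φ) (trans (cong (_+ W φ) zeros) (ℚ.+-identityˡ (W φ))))))
      where
      P = plan L 0 n C≤L
      ach = achieves n P A h (λ _ _ → 0ℚ) (ind-InUnit (adj G)) (ind-InUnit (adj H))
                     -- No vertex is placed yet: the unary terms vanish, so `κ = 0` and `N = n`.
                     (0 , ℕ.≤-refl , λ _ _ → ℚ.≤-refl , ℚ.≤-refl)
      φ = proj₁ ach
      inc = proj₁ (proj₂ ach)
      le = proj₂ (proj₂ ach)
      θ = (𝔼 (later P A h) + sum {n} (λ v → 𝔼 {d} (λ _ → 0ℚ))) - fromℕ n * ε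
      zeros : sum {n} (λ _ → 0ℚ) ≡ 0ℚ
      zeros = trans (sum-const n 0ℚ) (ℚ.*-zeroʳ (fromℕ n))
      θ≥ : E * p - fromℕ n * ε ≤ θ
      θ≥ = ℚ.+-monoˡ-≤ (- (fromℕ n * ε)) (subst₂ _≤_ (cong (_* p) (sym (e-wt G)))
        (trans (sym (𝔼-later P A h)) (sym (trans (cong (𝔼 (later P A h) +_)
          (trans (sum-cong n λ _ → 𝔼-const {d} 0ℚ) zeros)) (ℚ.+-identityʳ (𝔼 (later P A h))))))
        (laterSum-≥ P (λ u v → 0≤𝟙 (adj G u v)) (plan-within L 0 n C≤L rich)))

small-multiple : ∀ n {a} → 0ℚ < a → ∃[ ε ] 0ℚ < ε × fromℕ n * ε < a
small-multiple n {a} 0<a = a * ι , 0<ε , <-by 0<ε (trans (lemma (fromℕ n) a ι)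
    (trans (cong (a *_) (trans (cong (ι *_) (sym (fromℕ-suc n))) (/-fromℕ 1 (suc n)))) (ℚ.*-identityʳ a)))
  where
  ι = ℤ.+ 1 / suc n
  0<ε : 0ℚ < a * ι
  0<ε = 0<-* 0<a (ℚ.positive⁻¹ ι {{ℚ.normalize-pos 1 (suc n)}})
  lemma : ∀ n x i → n * (x * i) + x * i ≡ x * (i * (1ℚ + n))
  lemma = solve-∀ ring

ρ<⇒rich : ∀ {k n} (F : Graph (Fin k)) (G : Graph (Fin n)) .{{_ : NonZero (e G)}} {p} → ρ F G < p → ∃ (RichSuffices F p)
ρ<⇒rich {k} {n} F G {p} ρ<p =
  -- The total loss `n * ε` has to stay below the surplus `(p - ρ F G) * e G`.
  let ε , 0<ε , nε< = small-multiple n (0<-* (<⇒0<- ρ<p) (0<fromℕ (e G)))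
      c , c≢0 , n²<εc = archimedean-* (fromℕ (n ℕ.* n)) 0<ε
  -- One block of `c * c` rich levels for each of the `n` vertices.
  in n ℕ.* (c ℕ.* c) , λ d H L C≤L rich →
     let φ , inc , le = rich⇒preserved F G H c {{c≢0}} ε n²<εc L C≤L rich
     in preserved⇒contains F G H φ inc (ℚ.<-≤-trans
          (<-by (<⇒0<- nε<) (final (fromℕ n * ε) (ρ F G) p (fromℕ (e G)))) le)
  where
  final : ∀ x r p E → r * E + ((p - r) * E - x) ≡ E * p - x
  final = solve-∀ ring

-- Complete graphs and average densities

≤-tight : ∀ {a a′ b b′} → a ≤ a′ → b ≤ b′ → a′ + b′ ≤ a + b → a′ ≤ a × b′ ≤ b
≤-tight {a} {a′} {b} {b′} a≤ b≤ le =
  ≤-by (0≤-+ (≤⇒0≤- le) (≤⇒0≤- b≤)) (lemma a a′ b b′) ,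
  ≤-by (0≤-+ (≤⇒0≤- le) (≤⇒0≤- a≤)) (lemma′ a a′ b b′)
  where
  lemma : ∀ a a′ b b′ → a′ + (((a + b) - (a′ + b′)) + (b′ - b)) ≡ a
  lemma = solve-∀ ring
  lemma′ : ∀ a a′ b b′ → b′ + (((a + b) - (a′ + b′)) + (a′ - a)) ≡ b
  lemma′ = solve-∀ ring

sum-tight : ∀ n {f g : Fin n → ℚ} → (∀ i → f i ≤ g i) → sum g ≤ sum f → ∀ i → g i ≤ f i
sum-tight (suc n) le tight zero    = proj₁ (≤-tight (le zero) (sum-mono n (le ∘ suc)) tight)
sum-tight (suc n) le tight (suc i) =
  sum-tight n (le ∘ suc) (proj₂ (≤-tight (le zero) (sum-mono n (le ∘ suc)) tight)) i

wt-mono : ∀ n {A B : Fin n → Fin n → ℚ} → (∀ u v → A u v ≤ B u v) → wt n A ≤ wt n B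
wt-mono zero    le = ℚ.≤-refl
wt-mono (suc n) le = ℚ.+-mono-≤ (sum-mono n λ v → le zero (suc v)) (wt-mono n λ u v → le (suc u) (suc v))

wt-tight : ∀ n {A B : Fin n → Fin n → ℚ} → (∀ u v → A u v ≤ B u v) → wt n B ≤ wt n A →
           ∀ u v → u Fin.< v → B u v ≤ A u v
wt-tight (suc n) {A} {B} le tight = go
  where
  both = ≤-tight (sum-mono n λ v → le zero (suc v)) (wt-mono n λ u v → le (suc u) (suc v)) tight
  go : ∀ u v → u Fin.< v → B u v ≤ A u v
  go zero    (suc v) _           = sum-tight n (λ v → le zero (suc v)) (proj₁ both) v
  go (suc u) (suc v) (ℕ.s≤s u<v) = wt-tight n (λ u v → le (suc u) (suc v)) (proj₂ both) u v u<v

𝟙-mono : ∀ a b → (T a → T b) → 𝟙 a ≤ 𝟙 b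
𝟙-mono false b     f = 0≤𝟙 b
𝟙-mono true  false f = ⊥-elim (f _)
𝟙-mono true  true  f = ℚ.≤-refl

𝟙-reflect : ∀ a b → 𝟙 a ≤ 𝟙 b → T a → T b
𝟙-reflect true true  _  _ = _
𝟙-reflect true false le _ = ⊥-elim (<⇒≱ (ℚ.positive⁻¹ 1ℚ) le)

complete : ∀ n → Graph (Fin n)
complete n = record
  { adj        = λ u v → not (does (u Fin.≟ v))
  ; adj-sym    = λ u v → cong not (does-cong (u Fin.≟ v) (v Fin.≟ u) sym sym)
  ; adj-irrefl = λ v → cong not (dec-true (v Fin.≟ v) refl)
  }

complete-adj : ∀ {n} {u v : Fin n} → u ≢ v → T (adj (complete n) u v)
complete-adj {u = u} {v} u≢v = subst (T ∘ not) (sym (dec-false (u Fin.≟ v) u≢v)) _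

module _ {k : ℕ} (K : Graph (Fin (2 ℕ.+ k))) (full : ∀ {u v} → u ≢ v → T (adj K u v)) where

  e-full≢0 : NonZero (e K)
  e-full≢0 = ℕ.≢-nonZero λ e≡0 → <⇒≱ (ℚ.positive⁻¹ 1ℚ) (subst (1ℚ ≤_) (trans (sym (e-wt K)) (cong fromℕ e≡0)) 1≤wt)
    where
    A = ind (adj K)
    1≤A : 1ℚ ≤ A zero (suc zero)
    1≤A = 𝟙-mono true (adj K zero (suc zero)) (λ _ → full λ ())
    wt≥0 : ∀ n (B : Fin n → Fin n → ℚ) → (∀ u v → 0ℚ ≤ B u v) → 0ℚ ≤ wt n B
    wt≥0 zero    B le = ℚ.≤-refl
    wt≥0 (suc n) B le = 0≤-+ (sum-≥0 n λ v → le zero (suc v)) (wt≥0 n (B ⁺) λ u v → le (suc u) (suc v))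
    1≤wt : 1ℚ ≤ wt (2 ℕ.+ k) A
    1≤wt = ≤-by (0≤-+ (≤⇒0≤- 1≤A) (0≤-+ (sum-≥0 k λ v → 0≤𝟙 (adj K zero (suc (suc v))))
                  (wt≥0 (suc k) (A ⁺) λ u v → 0≤𝟙 (adj K (suc u) (suc v)))))
      (lemma (A zero (suc zero)) (sum λ v → A zero (suc (suc v))) (wt (suc k) (A ⁺)))
      where
      lemma : ∀ a s w → 1ℚ + ((a - 1ℚ) + (s + w)) ≡ (a + s) + w
      lemma = solve-∀ ring

  -- A subgraph of ratio 1 has all edges of `K` and so contains `F` on the vertices after the first
  -- two. Edges to vertex `zero` certify through `edges-ends` that these are kept, even if isolated
  -- in `F`; the second extra vertex gives `K` an edge when `k = 0`.
  ρ-full<1 : (F : Graph (Fin k)) .{{_ : NonZero (e K)}} → ρ F K < 1ℚ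
  ρ-full<1 F = [ (λ ρ≡0 → subst (_< 1ℚ) (sym ρ≡0) (ℚ.positive⁻¹ 1ℚ))
               , (λ (S , free , ρ≡) → subst (_< 1ℚ) (sym ρ≡) (ℚ.≰⇒> λ 1≤ratio → free (contains S 1≤ratio)))
               ]′ (ρ-attained F K)
    where
    module _ (S : Subgraph K) (1≤ratio : 1ℚ ≤ ratio S) where
      all : ∀ u v → u Fin.< v → T (adj (edges S) u v)
      all u v u<v = 𝟙-reflect (adj K u v) (adj (edges S) u v)
        (wt-tight (2 ℕ.+ k) (λ u v → 𝟙-mono (adj (edges S) u v) (adj K u v) (edges⊆ S u v))
          (subst₂ _≤_ (trans (ℚ.*-identityˡ (fromℕ (e K))) (e-wt K))
            (trans (ratio-fromℕ S) (e-wt (edges S))) (*-monoʳ (0≤fromℕ (e K)) 1≤ratio)) u v u<v)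
        (full λ u≡v → ℕ.<-irrefl (cong toℕ u≡v) u<v)
      symS : ∀ u v → T (adj (edges S) u v) → T (adj (edges S) v u)
      symS u v = subst T (adj-sym (edges S) u v)
      edge : ∀ i j → T (adj F i j) → T (adj (edges S) (suc (suc i)) (suc (suc j)))
      edge i j t = compare (Fin.<-cmp i j)
        where
        compare : Tri (i Fin.< j) (i ≡ j) (j Fin.< i) → T (adj (edges S) (suc (suc i)) (suc (suc j)))
        compare (tri< i<j _ _) = all _ _ (ℕ.s≤s (ℕ.s≤s i<j))
        compare (tri> _ _ j<i) = symS (suc (suc j)) (suc (suc i)) (all _ _ (ℕ.s≤s (ℕ.s≤s j<i)))
        compare (tri≈ _ i≡j _) = ⊥-elim (subst T (adj-irrefl F i) (subst (T ∘ adj F i) (sym i≡j) t))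
      contains : SubgraphContains S F
      contains = record { to = λ i → suc (suc i) ; to-mono = λ i j i<j → ℕ.s≤s (ℕ.s≤s i<j) ; to-edges = edge } ,
        λ i → edges-ends S (suc (suc i)) zero (symS zero (suc (suc i)) (all zero (suc (suc i)) (ℕ.s≤s ℕ.z≤n)))

-- From rich levels to average density

AverageSuffices : ∀ {k} → Graph (Fin k) → ℚ → ℕ → Set
AverageSuffices F p d₀ = ∀ d .{{_ : NonZero d}} → d₀ ℕ.≤ d → (H : Graph (Cube d)) →
  p ≤ averageDensity H → Embedding F _<lex_ H

module _ (p : ℚ) (0≤p : 0ℚ ≤ p) where

  -- Markov's inequality in reverse: a level of `L` weighs at most 1, any other less than `p`.
  atLeast : ∀ d (t : Fin d → ℚ) → (∀ ℓ → t ℓ ≤ 1ℚ) →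
            ∃[ L ] (∀ ℓ → ℓ ∈ L → p ≤ t ℓ) × sum t ≤ fromℕ ∣ L ∣ + fromℕ d * p
  atLeast zero    t t≤1 = [] , (λ _ ()) , ℚ.≤-reflexive (sym (trans (ℚ.+-identityˡ (0ℚ * p)) (ℚ.*-zeroˡ p)))
  atLeast (suc d) t t≤1 = extend (p ℚ.≤? t zero) (atLeast d (t ∘ suc) (t≤1 ∘ suc))
    where
    above : ∀ t s l d p → (t + s) + (((1ℚ - t) + ((l + d * p) - s)) + p) ≡ (1ℚ + l) + (1ℚ + d) * p
    above = solve-∀ ring
    below : ∀ t s l d p → (t + s) + (((l + d * p) - s) + (p - t)) ≡ l + (1ℚ + d) * p
    below = solve-∀ ring
    extend : Dec (p ≤ t zero) → ∃[ L ] (∀ ℓ → ℓ ∈ L → p ≤ t (suc ℓ)) × sum (t ∘ suc) ≤ fromℕ ∣ L ∣ + fromℕ d * p →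
             ∃[ L ] (∀ ℓ → ℓ ∈ L → p ≤ t ℓ) × sum t ≤ fromℕ ∣ L ∣ + fromℕ (suc d) * p
    extend (yes p≤t) (L , p≤ , le) = true ∷ L , (λ { zero _ → p≤t ; (suc ℓ) (there ℓ∈) → p≤ ℓ ℓ∈ }) ,
      ≤-by (0≤-+ (0≤-+ (≤⇒0≤- (t≤1 zero)) (≤⇒0≤- le)) 0≤p)
        (trans (above (t zero) (sum (t ∘ suc)) (fromℕ ∣ L ∣) (fromℕ d) p)
          (sym (cong₂ (λ a b → a + b * p) (fromℕ-suc ∣ L ∣) (fromℕ-suc d))))
    extend (no p≰t) (L , p≤ , le) = false ∷ L , (λ { (suc ℓ) (there ℓ∈) → p≤ ℓ ℓ∈ }) ,
      ≤-by (0≤-+ (≤⇒0≤- le) (≤⇒0≤- (ℚ.<⇒≤ (ℚ.≰⇒> p≰t))))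
        (trans (below (t zero) (sum (t ∘ suc)) (fromℕ ∣ L ∣) (fromℕ d) p)
          (sym (cong (λ b → fromℕ ∣ L ∣ + b * p) (fromℕ-suc d))))

  -- Average density `q` leaves at least `(q - p) * d` levels of density at least `p`, and `d₀` is
  -- chosen so that this exceeds `C`.
  rich⇒average : ∀ {k} (F : Graph (Fin k)) {C q} → p < q → RichSuffices F p C → ∃ (AverageSuffices F q)
  rich⇒average F {C} {q} p<q rich =
    let d₀ , _ , C< = archimedean-* (fromℕ C) (<⇒0<- p<q) in
    d₀ , λ d d₀≤d H q≤ →
      let L , L-rich , le = atLeast d (λ ℓ → lev ℓ (ind (adj H))) (λ ℓ → lev-≤1 ℓ (λ x y → 𝟙≤1 (adj H x y))) in
      rich d H L
        (fromℕ-cancel-≤ (ℚ.≤-trans (ℚ.<⇒≤ C<) (ℚ.≤-trans (*-monoˡ (ℚ.<⇒≤ (<⇒0<- p<q)) (fromℕ-mono d₀≤d))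
          (≤-by (≤⇒0≤- (ℚ.≤-trans (*-monoʳ (0≤fromℕ d) q≤) (ℚ.≤-trans (ℚ.≤-reflexive (averageDensity-lev H)) le)))
                (lemma q p (fromℕ d) (fromℕ ∣ L ∣))))))
        L-rich
    where
    lemma : ∀ q p d l → (q - p) * d + ((l + d * p) - q * d) ≡ l
    lemma = solve-∀ ring

rich-from-density : ∀ {d} (α : ℝ) {p} (H : Graph (Cube d)) ℓ → α <ℚ p → p ≤ lev ℓ (ind (adj H)) → Rich α H ℓ
rich-from-density α {p} H ℓ α<p p≤ q e<q =
  p , α<p , ℚ.≤-<-trans (ℚ.≤-trans (*-monoʳ (0≤fromℕ (τ ℓ)) p≤) (ℚ.≤-reflexive (sym (e-level ℓ H)))) e<q

density-from-rich : ∀ {d} p (H : Graph (Cube d)) ℓ → Rich (fromℚ p) H ℓ → p ≤ lev ℓ (ind (adj H))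
density-from-rich p H ℓ rich = ℚ.≮⇒≥ λ lev<p →
  -- The test rational is `p * τ ℓ`: if it lay above the edge count, richness would yield `p′ > p`
  -- with `p′ * τ ℓ < p * τ ℓ`.
  let p′ , p<p′ , lt = rich (p * fromℕ (τ ℓ)) (subst (_< p * fromℕ (τ ℓ)) (sym (e-level ℓ H))
                         (ℚ.*-monoˡ-<-pos (fromℕ (τ ℓ)) {{positive (0<τ ℓ)}} lev<p))
  in <⇒≱ lt (*-monoʳ (0≤fromℕ (τ ℓ)) (ℚ.<⇒≤ p<p′))

-- Blow-up of the cube

-- A Boolean form of `_<lex_` that reduces on constructors, as needed inside indicators.
lt : ∀ {d} → Cube d → Cube d → Bool
lt []          []          = false
lt (false ∷ x) (true ∷ y)  = true
lt (true ∷ x)  (false ∷ y) = false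
lt (false ∷ x) (false ∷ y) = lt x y
lt (true ∷ x)  (true ∷ y)  = lt x y

<lex⇒lt : ∀ {d} (x y : Cube d) → x <lex y → T (lt x y)
<lex⇒lt []          []          (() , _)
<lex⇒lt (false ∷ x) (true ∷ y)  _ = _
<lex⇒lt (true ∷ x)  (false ∷ y) x<y = true≮lexfalse x<y
<lex⇒lt (false ∷ x) (false ∷ y) x<y = <lex⇒lt x y (<lex-tail x<y)
<lex⇒lt (true ∷ x)  (true ∷ y)  x<y = <lex⇒lt x y (<lex-tail x<y)

lt-++ : ∀ {d d′} (x y : Cube d) (u v : Cube d′) → x ≢ y → lt (x Vec.++ u) (y Vec.++ v) ≡ lt x y
lt-++ []          []          u v x≢y = ⊥-elim (x≢y refl)
lt-++ (false ∷ x) (true ∷ y)  u v x≢y = refl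
lt-++ (true ∷ x)  (false ∷ y) u v x≢y = refl
lt-++ (false ∷ x) (false ∷ y) u v x≢y = lt-++ x y u v (x≢y ∘ cong (false ∷_))
lt-++ (true ∷ x)  (true ∷ y)  u v x≢y = lt-++ x y u v (x≢y ∘ cong (true ∷_))

lt-irrefl : ∀ {d} (x : Cube d) → lt x x ≡ false
lt-irrefl []          = refl
lt-irrefl (false ∷ x) = lt-irrefl x
lt-irrefl (true ∷ x)  = lt-irrefl x

lt⇒≢ : ∀ {d} {x y : Cube d} → T (lt x y) → x ≢ y
lt⇒≢ {x = x} t refl = subst T (lt-irrefl x) t

lt-++ˡ : ∀ {d d′} (x y : Cube d) (u v : Cube d′) → T (lt x y) → T (lt (x Vec.++ u) (y Vec.++ v))
lt-++ˡ x y u v t = subst T (sym (lt-++ x y u v (lt⇒≢ t))) t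

lt-++ʳ : ∀ {d d′} (x : Cube d) (u v : Cube d′) → T (lt u v) → T (lt (x Vec.++ u) (x Vec.++ v))
lt-++ʳ []          u v t = t
lt-++ʳ (false ∷ x) u v t = lt-++ʳ x u v t
lt-++ʳ (true ∷ x)  u v t = lt-++ʳ x u v t

-- The power `2 ^ d`, written as a sum so that `Fin.splitAt` reads off the first bit.
size : ℕ → ℕ
size zero    = 1
size (suc d) = size d ℕ.+ size d

enc : ∀ {d} → Cube d → Fin (size d)
enc []                  = zero
enc {suc d} (false ∷ x) = enc x Fin.↑ˡ size d
enc {suc d} (true ∷ x)  = size d Fin.↑ʳ enc x

dec : ∀ {d} → Fin (size d) → Cube d
dec {zero}  _ = []
dec {suc d} u = [ (λ v → false ∷ dec v) , (λ v → true ∷ dec v) ]′ (Fin.splitAt (size d) u)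

dec-enc : ∀ {d} (x : Cube d) → dec (enc x) ≡ x
dec-enc []                  = refl
dec-enc {suc d} (false ∷ x) rewrite Fin.splitAt-↑ˡ (size d) (enc x) (size d) = cong (false ∷_) (dec-enc x)
dec-enc {suc d} (true ∷ x)  rewrite Fin.splitAt-↑ʳ (size d) (size d) (enc x) = cong (true ∷_) (dec-enc x)

rank : ∀ {d} → Cube d → ℕ
rank x = toℕ (enc x)

rank-mono : ∀ {d} (x y : Cube d) → T (lt x y) → rank x ℕ.< rank y
rank-mono []          []          ()
rank-mono {suc d} (false ∷ x) (true ∷ y) _ =
  subst₂ ℕ._<_ (sym (Fin.toℕ-↑ˡ (enc x) (size d))) (sym (Fin.toℕ-↑ʳ (size d) (enc y)))
    (ℕ.<-≤-trans (Fin.toℕ<n (enc x)) (ℕ.m≤m+n (size d) (rank y)))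
rank-mono {suc d} (false ∷ x) (false ∷ y) t =
  subst₂ ℕ._<_ (sym (Fin.toℕ-↑ˡ (enc x) (size d))) (sym (Fin.toℕ-↑ˡ (enc y) (size d))) (rank-mono x y t)
rank-mono {suc d} (true ∷ x) (true ∷ y) t =
  subst₂ ℕ._<_ (sym (Fin.toℕ-↑ʳ (size d) (enc x))) (sym (Fin.toℕ-↑ʳ (size d) (enc y)))
    (ℕ.+-monoʳ-< (size d) (rank-mono x y t))

lt-total : ∀ {d} (x y : Cube d) → T (lt x y) ⊎ x ≡ y ⊎ T (lt y x)
lt-total []          []          = inj₂ (inj₁ refl)
lt-total (false ∷ x) (true ∷ y)  = inj₁ _
lt-total (true ∷ x)  (false ∷ y) = inj₂ (inj₂ _)
lt-total (false ∷ x) (false ∷ y) = [ inj₁ , [ inj₂ ∘ inj₁ ∘ cong (false ∷_) , inj₂ ∘ inj₂ ]′ ]′ (lt-total x y)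
lt-total (true ∷ x)  (true ∷ y)  = [ inj₁ , [ inj₂ ∘ inj₁ ∘ cong (true ∷_) , inj₂ ∘ inj₂ ]′ ]′ (lt-total x y)

rank-cancel : ∀ {d} (x y : Cube d) → rank x ℕ.< rank y → T (lt x y)
rank-cancel x y r with lt-total x y
... | inj₁ t           = t
... | inj₂ (inj₁ refl) = ⊥-elim (ℕ.<-irrefl refl r)
... | inj₂ (inj₂ t)    = ⊥-elim (ℕ.<-asym r (rank-mono y x t))

enc-<? : ∀ {d} (x y : Cube d) → does (enc x Fin.<? enc y) ≡ lt x y
enc-<? x y = does-cong (enc x Fin.<? enc y) (Bool.T? (lt x y)) (rank-cancel x y) (rank-mono x y)

sum-↑ : ∀ m n (f : Fin (m ℕ.+ n) → ℚ) → sum f ≡ sum (λ i → f (i Fin.↑ˡ n)) + sum (λ j → f (m Fin.↑ʳ j))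
sum-↑ zero    n f = sym (ℚ.+-identityˡ (sum f))
sum-↑ (suc m) n f = trans (cong (f zero +_) (sum-↑ m n (f ∘ suc)))
  (sym (ℚ.+-assoc (f zero) (sum λ i → f (suc (i Fin.↑ˡ n))) (sum λ j → f (suc (m Fin.↑ʳ j)))))

sum-enc : ∀ d (f : Fin (size d) → ℚ) → sum f ≡ fromℕ (size d) * 𝔼 (λ (x : Cube d) → f (enc x))
sum-enc zero    f = trans (ℚ.+-identityʳ (f zero)) (sym (ℚ.*-identityˡ (f zero)))
sum-enc (suc d) f = trans (sum-↑ (size d) (size d) f)
  (trans (cong₂ _+_ (sum-enc d (λ u → f (u Fin.↑ˡ size d))) (sum-enc d (λ u → f (size d Fin.↑ʳ u))))
    (trans (lemma (fromℕ (size d)) (𝔼 (λ (x : Cube d) → f (enc x Fin.↑ˡ size d))) (𝔼 (λ (x : Cube d) → f (size d Fin.↑ʳ enc x))))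
      (cong (_* 𝔼 (λ (x : Cube (suc d)) → f (enc x))) (sym (fromℕ-+ (size d) (size d))))))
  where
  lemma : ∀ n a b → n * a + n * b ≡ (n + n) * (½ * (a + b))
  lemma = solve-∀ ring

e-enc : ∀ d (H : Graph (Fin (size d))) →
        fromℕ (e H) ≡ (fromℕ (size d) * fromℕ (size d)) * 𝔼 (λ (x : Cube d) → 𝔼 (λ (y : Cube d) → 𝟙 (lt x y ∧ adj H (enc x) (enc y))))
e-enc d H = begin
  fromℕ (e H)
    ≡⟨ trans (e-wt H) (sym (wt-≡ (size d) (adj H))) ⟩
  sum (λ u → sum (λ v → 𝟙 (does (u Fin.<? v) ∧ adj H u v)))
    ≡⟨ sum-enc d (λ u → sum (λ v → 𝟙 (does (u Fin.<? v) ∧ adj H u v))) ⟩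
  N * 𝔼 (λ (x : Cube d) → sum (λ v → 𝟙 (does (enc x Fin.<? v) ∧ adj H (enc x) v)))
    ≡⟨ cong (N *_) (𝔼-cong {d} λ x → trans (sum-enc d (λ v → 𝟙 (does (enc x Fin.<? v) ∧ adj H (enc x) v)))
         (cong (N *_) (𝔼-cong {d} λ y → cong (λ b → 𝟙 (b ∧ adj H (enc x) (enc y))) (enc-<? x y)))) ⟩
  N * 𝔼 (λ (x : Cube d) → N * E x)
    ≡⟨ trans (cong (N *_) (𝔼-* N E)) (sym (ℚ.*-assoc N N (𝔼 E))) ⟩
  (N * N) * 𝔼 E ∎
  where
  open ≡-Reasoning
  N = fromℕ (size d)
  E : Cube d → ℚ
  E x = 𝔼 (λ (y : Cube d) → 𝟙 (lt x y ∧ adj H (enc x) (enc y)))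

0<size : ∀ d → 0ℚ < fromℕ (size d)
0<size zero    = ℚ.positive⁻¹ 1ℚ
0<size (suc d) = subst (0ℚ <_) (sym (fromℕ-+ (size d) (size d)))
  (subst (_< fromℕ (size d) + fromℕ (size d)) (ℚ.+-identityˡ 0ℚ) (ℚ.+-mono-< (0<size d) (0<size d)))

-- Codes with hidden coordinates

infix 9 ½^_

½^_ : ℕ → ℚ
½^ zero  = 1ℚ
½^ suc n = ½ * ½^ n

0<½^ : ∀ n → 0ℚ < ½^ n
0<½^ zero    = ℚ.positive⁻¹ 1ℚ
0<½^ (suc n) = 0<-* (ℚ.positive⁻¹ ½) (0<½^ n)

-- Two points `ω` give the same masked code exactly when they differ only in hidden coordinates.
-- This is how copies come to share vertices, and edges where both ends hide.
mask : ∀ {n} → Vec Bool n → Cube n → Cube n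
mask []       []      = []
mask (h ∷ hs) (w ∷ ω) = (not h ∧ w) ∷ mask hs ω

-- Whether the bits a and b are the images of a common bit, hidden as h and h′ say.

agree : Bool → Bool → Bool → Bool → Bool
agree false false a b = not (a xor b)
agree false true  a b = not b
agree true  false a b = not a
agree true  true  a b = not a ∧ not b

compat : ∀ {n} → Vec Bool n → Vec Bool n → Cube n → Cube n → Bool
compat []      []        []      []      = true
compat (h ∷ μ) (h′ ∷ ν) (a ∷ as) (b ∷ bs) = agree h h′ a b ∧ compat μ ν as bs

agree-swap : ∀ h h′ a b → agree h h′ a b ≡ agree h′ h b a
agree-swap false false a b = cong not (Bool.xor-comm a b)
agree-swap false true  a b = refl
agree-swap true  false a b = refl
agree-swap true  true  a b = Bool.∧-comm (not a) (not b)

compat-swap : ∀ {n} (μ ν : Vec Bool n) a b → compat μ ν a b ≡ compat ν μ b a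
compat-swap []      []        []       []       = refl
compat-swap (h ∷ μ) (h′ ∷ ν) (a ∷ as) (b ∷ bs) = cong₂ _∧_ (agree-swap h h′ a b) (compat-swap μ ν as bs)

compat-mask : ∀ {n} (μ ν : Vec Bool n) ω → compat μ ν (mask μ ω) (mask ν ω) ≡ true
compat-mask []      []       []      = refl
compat-mask (h ∷ μ) (h′ ∷ ν) (w ∷ ω) = cong₂ _∧_ (bit h h′ w) (compat-mask μ ν ω)
  where
  bit : ∀ h h′ w → agree h h′ (not h ∧ w) (not h′ ∧ w) ≡ true
  bit false false w = cong not (Bool.xor-same w)
  bit false true  w = refl
  bit true  false w = refl
  bit true  true  w = refl

jointlyHidden : ∀ {n} → Vec Bool n → Vec Bool n → ℕ
jointlyHidden []          []           = 0
jointlyHidden (true ∷ μ)  (true ∷ ν)   = suc (jointlyHidden μ ν)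
jointlyHidden (true ∷ μ)  (false ∷ ν)  = jointlyHidden μ ν
jointlyHidden (false ∷ μ) (_ ∷ ν)      = jointlyHidden μ ν

-- Every compatible pair is the image of exactly 2 ^ jointlyHidden μ ν points ω.

𝔼-compat : ∀ {n} (μ ν : Vec Bool n) (f : Cube n → Cube n → ℚ) →
           𝔼 (λ a → 𝔼 (λ b → 𝟙 (compat μ ν a b) * f a b)) ≡
           (½^ n * ½^ jointlyHidden μ ν) * 𝔼 (λ ω → f (mask μ ω) (mask ν ω))
𝔼-compat [] [] f = lemma (f [] [])
  where
  lemma : ∀ x → 1ℚ * x ≡ (1ℚ * 1ℚ) * x
  lemma = solve-∀ ring
𝔼-compat {suc n} (h ∷ μ) (h′ ∷ ν) f = trans reduce (byCases h h′)
  where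
  R : Bool → Bool → ℚ
  R a b = 𝔼 (λ as → 𝔼 (λ bs → 𝟙 (compat μ ν as bs) * f (a ∷ as) (b ∷ bs)))
  w = ½^ n * ½^ jointlyHidden μ ν
  M : Bool → Bool → ℚ
  M a b = 𝔼 (λ ω → f (a ∷ mask μ ω) (b ∷ mask ν ω))
  R≡ : ∀ a b → R a b ≡ w * M a b
  R≡ a b = 𝔼-compat μ ν (λ as bs → f (a ∷ as) (b ∷ bs))
  pull : ∀ a b → 𝔼 (λ as → 𝔼 (λ bs → 𝟙 (agree h h′ a b ∧ compat μ ν as bs) * f (a ∷ as) (b ∷ bs))) ≡
                 𝟙 (agree h h′ a b) * R a b
  pull a b = trans (𝔼-cong λ as → trans (𝔼-cong λ bs →
      trans (cong (_* f (a ∷ as) (b ∷ bs)) (𝟙-∧ (agree h h′ a b) (compat μ ν as bs)))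
            (ℚ.*-assoc (𝟙 (agree h h′ a b)) (𝟙 (compat μ ν as bs)) (f (a ∷ as) (b ∷ bs))))
      (𝔼-* (𝟙 (agree h h′ a b)) (λ bs → 𝟙 (compat μ ν as bs) * f (a ∷ as) (b ∷ bs))))
    (𝔼-* (𝟙 (agree h h′ a b)) (λ as → 𝔼 (λ bs → 𝟙 (compat μ ν as bs) * f (a ∷ as) (b ∷ bs))))
  Q : Bool → Bool → ℚ
  Q a b = 𝟙 (agree h h′ a b) * (w * M a b)
  reduce : 𝔼 (λ a → 𝔼 (λ b → 𝟙 (compat (h ∷ μ) (h′ ∷ ν) a b) * f a b)) ≡
           ½ * (½ * (Q false false + Q false true) + ½ * (Q true false + Q true true))
  reduce = cong (½ *_) (cong₂ _+_ (row false) (row true))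
    where
    cell : ∀ a b → 𝔼 (λ as → 𝔼 (λ bs → 𝟙 (agree h h′ a b ∧ compat μ ν as bs) * f (a ∷ as) (b ∷ bs))) ≡ Q a b
    cell a b = trans (pull a b) (cong (𝟙 (agree h h′ a b) *_) (R≡ a b))
    row : ∀ a → 𝔼 (λ as → ½ * (𝔼 (λ bs → 𝟙 (agree h h′ a false ∧ compat μ ν as bs) * f (a ∷ as) (false ∷ bs))
                              + 𝔼 (λ bs → 𝟙 (agree h h′ a true ∧ compat μ ν as bs) * f (a ∷ as) (true ∷ bs)))) ≡
                ½ * (Q a false + Q a true)
    row a = trans (𝔼-* ½ (λ as → K false as + K true as))
      (cong (½ *_) (trans (𝔼-+ (K false) (K true)) (cong₂ _+_ (cell a false) (cell a true))))
      where
      K : Bool → Cube n → ℚ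
      K b as = 𝔼 (λ bs → 𝟙 (agree h h′ a b ∧ compat μ ν as bs) * f (a ∷ as) (b ∷ bs))
  -- Two of the four bit pairs are compatible, unless both sides hide the coordinate, when only one
  -- is; this is the extra factor `½` of `jointlyHidden`.
  byCases : ∀ h h′ → ½ * (½ * (𝟙 (agree h h′ false false) * (w * M false false) + 𝟙 (agree h h′ false true) * (w * M false true))
                       + ½ * (𝟙 (agree h h′ true false) * (w * M true false) + 𝟙 (agree h h′ true true) * (w * M true true))) ≡
            (½^ suc n * ½^ jointlyHidden (h ∷ μ) (h′ ∷ ν)) *
            (½ * (M (not h ∧ false) (not h′ ∧ false) + M (not h ∧ true) (not h′ ∧ true)))
  byCases false false = lemma (½^ n) (½^ jointlyHidden μ ν) (M false false) (M false true) (M true false) (M true true)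
    where
    lemma : ∀ n j a b c d → ½ * (½ * (1ℚ * ((n * j) * a) + 0ℚ * ((n * j) * b)) + ½ * (0ℚ * ((n * j) * c) + 1ℚ * ((n * j) * d))) ≡
            ((½ * n) * j) * (½ * (a + d))
    lemma = solve-∀ ring
  byCases false true = lemma (½^ n) (½^ jointlyHidden μ ν) (M false false) (M false true) (M true false) (M true true)
    where
    lemma : ∀ n j a b c d → ½ * (½ * (1ℚ * ((n * j) * a) + 0ℚ * ((n * j) * b)) + ½ * (1ℚ * ((n * j) * c) + 0ℚ * ((n * j) * d))) ≡
            ((½ * n) * j) * (½ * (a + c))
    lemma = solve-∀ ring
  byCases true false = lemma (½^ n) (½^ jointlyHidden μ ν) (M false false) (M false true) (M true false) (M true true)
    where
    lemma : ∀ n j a b c d → ½ * (½ * (1ℚ * ((n * j) * a) + 1ℚ * ((n * j) * b)) + ½ * (0ℚ * ((n * j) * c) + 0ℚ * ((n * j) * d))) ≡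
            ((½ * n) * j) * (½ * (a + b))
    lemma = solve-∀ ring
  byCases true true = lemma (½^ n) (½^ jointlyHidden μ ν) (M false false) (M false true) (M true false) (M true true)
    where
    lemma : ∀ n j a b c d → ½ * (½ * (1ℚ * ((n * j) * a) + 0ℚ * ((n * j) * b)) + ½ * (0ℚ * ((n * j) * c) + 0ℚ * ((n * j) * d))) ≡
            ((½ * n) * (½ * j)) * (½ * (a + a))
    lemma = solve-∀ ring

trues falses : ∀ {n} → Vec Bool n
trues  = Vec.replicate _ true
falses = Vec.replicate _ false

infixr 7 _⊗_

-- The product of sets given by indicator vectors. Intersections of products are products, so
-- `jointlyHidden`, the size of an intersection, is multiplicative.
_⊗_ : ∀ {m n} → Vec Bool m → Vec Bool n → Vec Bool (m ℕ.* n)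
[]      ⊗ v = []
(b ∷ u) ⊗ v = Vec.map (b ∧_) v Vec.++ u ⊗ v

J-++ : ∀ {m n} (u u′ : Vec Bool m) (v v′ : Vec Bool n) →
       jointlyHidden (u Vec.++ v) (u′ Vec.++ v′) ≡ jointlyHidden u u′ ℕ.+ jointlyHidden v v′
J-++ []          []           v v′ = refl
J-++ (true ∷ u)  (true ∷ u′)  v v′ = cong suc (J-++ u u′ v v′)
J-++ (true ∷ u)  (false ∷ u′) v v′ = J-++ u u′ v v′
J-++ (false ∷ u) (_ ∷ u′)     v v′ = J-++ u u′ v v′

J-falsesˡ : ∀ {n} (v : Vec Bool n) → jointlyHidden falses v ≡ 0
J-falsesˡ []      = refl
J-falsesˡ (_ ∷ v) = J-falsesˡ v

J-falsesʳ : ∀ {n} (v : Vec Bool n) → jointlyHidden v falses ≡ 0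
J-falsesʳ []          = refl
J-falsesʳ (true ∷ v)  = J-falsesʳ v
J-falsesʳ (false ∷ v) = J-falsesʳ v

J-trues : ∀ n → jointlyHidden (trues {n}) trues ≡ n
J-trues zero    = refl
J-trues (suc n) = cong suc (J-trues n)

J-map-true : ∀ {n} (v v′ : Vec Bool n) → jointlyHidden (Vec.map (true ∧_) v) (Vec.map (true ∧_) v′) ≡ jointlyHidden v v′
J-map-true v v′ = cong₂ jointlyHidden (Vec.map-id v) (Vec.map-id v′)

J-map-falseˡ : ∀ {n} (v v′ : Vec Bool n) → jointlyHidden (Vec.map (false ∧_) v) v′ ≡ 0
J-map-falseˡ []      []       = refl
J-map-falseˡ (_ ∷ v) (_ ∷ v′) = J-map-falseˡ v v′

J-map-falseʳ : ∀ {n} (v v′ : Vec Bool n) → jointlyHidden v (Vec.map (false ∧_) v′) ≡ 0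
J-map-falseʳ []          []       = refl
J-map-falseʳ (true ∷ v)  (_ ∷ v′) = J-map-falseʳ v v′
J-map-falseʳ (false ∷ v) (_ ∷ v′) = J-map-falseʳ v v′

J-⊗ : ∀ {m n} (u u′ : Vec Bool m) (v v′ : Vec Bool n) →
      jointlyHidden (u ⊗ v) (u′ ⊗ v′) ≡ jointlyHidden u u′ ℕ.* jointlyHidden v v′
J-⊗ []          []           v v′ = refl
J-⊗ (true ∷ u)  (true ∷ u′)  v v′ = trans (J-++ (Vec.map (true ∧_) v) (Vec.map (true ∧_) v′) (u ⊗ v) (u′ ⊗ v′))
  (cong₂ ℕ._+_ (J-map-true v v′) (J-⊗ u u′ v v′))
J-⊗ (true ∷ u)  (false ∷ u′) v v′ = trans (J-++ (Vec.map (true ∧_) v) (Vec.map (false ∧_) v′) (u ⊗ v) (u′ ⊗ v′))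
  (cong₂ ℕ._+_ (J-map-falseʳ (Vec.map (true ∧_) v) v′) (J-⊗ u u′ v v′))
J-⊗ (false ∷ u) (b ∷ u′)     v v′ = trans (J-++ (Vec.map (false ∧_) v) (Vec.map (b ∧_) v′) (u ⊗ v) (u′ ⊗ v′))
  (cong₂ ℕ._+_ (J-map-falseˡ v (Vec.map (b ∧_) v′)) (J-⊗ u u′ v v′))

onehot : ∀ {d} → Cube d → Vec Bool (size d)
onehot []          = true ∷ []
onehot (false ∷ x) = onehot x Vec.++ falses
onehot (true ∷ x)  = falses Vec.++ onehot x

trues-++ : ∀ m n → trues {m ℕ.+ n} ≡ trues {m} Vec.++ trues {n}
trues-++ zero    n = refl
trues-++ (suc m) n = cong (true ∷_) (trues-++ m n)

J-onehot-trues : ∀ {d} (x : Cube d) → jointlyHidden (onehot x) trues ≡ 1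
J-onehot-trues []                  = refl
J-onehot-trues {suc d} (false ∷ x) = trans (cong (jointlyHidden (onehot (false ∷ x))) (trues-++ (size d) (size d)))
  (trans (J-++ (onehot x) trues falses trues) (cong₂ ℕ._+_ (J-onehot-trues x) (J-falsesˡ {size d} trues)))
J-onehot-trues {suc d} (true ∷ x)  = trans (cong (jointlyHidden (onehot (true ∷ x))) (trues-++ (size d) (size d)))
  (trans (J-++ (falses {size d}) trues (onehot x) trues) (cong₂ ℕ._+_ (J-falsesˡ {size d} trues) (J-onehot-trues x)))

J-trues-onehot : ∀ {d} (x : Cube d) → jointlyHidden trues (onehot x) ≡ 1
J-trues-onehot []                  = refl
J-trues-onehot {suc d} (false ∷ x) = trans (cong (λ v → jointlyHidden v (onehot (false ∷ x))) (trues-++ (size d) (size d)))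
  (trans (J-++ trues (onehot x) trues falses) (cong₂ ℕ._+_ (J-trues-onehot x) (J-falsesʳ {size d} trues)))
J-trues-onehot {suc d} (true ∷ x)  = trans (cong (λ v → jointlyHidden v (onehot (true ∷ x))) (trues-++ (size d) (size d)))
  (trans (J-++ (trues {size d}) falses trues (onehot x)) (cong₂ ℕ._+_ (J-falsesʳ {size d} trues) (J-trues-onehot x)))

J-onehot : ∀ {d} (x y : Cube d) → x ≢ y → jointlyHidden (onehot x) (onehot y) ≡ 0
J-onehot []          []          x≢y = ⊥-elim (x≢y refl)
J-onehot {suc d} (false ∷ x) (false ∷ y) x≢y = trans (J-++ (onehot x) (onehot y) (falses {size d}) falses)
  (cong₂ ℕ._+_ (J-onehot x y (x≢y ∘ cong (false ∷_))) (J-falsesˡ (falses {size d})))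
J-onehot (false ∷ x) (true ∷ y)  x≢y = trans (J-++ (onehot x) falses falses (onehot y))
  (cong₂ ℕ._+_ (J-falsesʳ (onehot x)) (J-falsesˡ (onehot y)))
J-onehot (true ∷ x)  (false ∷ y) x≢y = trans (J-++ falses (onehot y) (onehot x) falses)
  (cong₂ ℕ._+_ (J-falsesˡ (onehot y)) (J-falsesʳ (onehot x)))
J-onehot {suc d} (true ∷ x)  (true ∷ y)  x≢y = trans (J-++ (falses {size d}) falses (onehot x) (onehot y))
  (cong₂ ℕ._+_ (J-falsesˡ (falses {size d})) (J-onehot x y (x≢y ∘ cong (true ∷_))))

-- The first summand holds `suc d` grids of side `size d` for the top level; the halves of the cube
-- then use disjoint stretches of coordinates, so that pairs across the halves meet only in the
-- grids.
codeLength : ℕ → ℕ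
codeLength zero    = 0
codeLength (suc d) = suc d ℕ.* (size d ℕ.* size d) ℕ.+ (codeLength d ℕ.+ codeLength d)

row column : ∀ {d} → Cube d → Vec Bool (suc d ℕ.* (size d ℕ.* size d))
row {d} x    = trues {suc d} ⊗ (onehot x ⊗ trues {size d})
column {d} x = trues {suc d} ⊗ (trues {size d} ⊗ onehot x)

J-row-column : ∀ {d} (x y : Cube d) → jointlyHidden (row x) (column y) ≡ suc d
J-row-column {d} x y = trans (J-⊗ (trues {suc d}) trues (onehot x ⊗ trues {size d}) (trues {size d} ⊗ onehot y))
  (trans (cong₂ ℕ._*_ (J-trues (suc d)) (trans (J-⊗ (onehot x) (trues {size d}) (trues {size d}) (onehot y))
    (cong₂ ℕ._*_ (J-onehot-trues x) (J-trues-onehot y)))) (ℕ.*-identityʳ (suc d)))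

J-row : ∀ {d} (x y : Cube d) → x ≢ y → jointlyHidden (row x) (row y) ≡ 0
J-row {d} x y x≢y = trans (J-⊗ (trues {suc d}) trues (onehot x ⊗ trues {size d}) (onehot y ⊗ trues {size d}))
  (trans (cong (J ℕ.*_) (trans (J-⊗ (onehot x) (onehot y) (trues {size d}) trues) (cong (ℕ._* J′) (J-onehot x y x≢y)))) (ℕ.*-zeroʳ J))
  where
  J = jointlyHidden (trues {suc d}) trues
  J′ = jointlyHidden (trues {size d}) trues

J-column : ∀ {d} (x y : Cube d) → x ≢ y → jointlyHidden (column x) (column y) ≡ 0
J-column {d} x y x≢y = trans (J-⊗ (trues {suc d}) trues (trues {size d} ⊗ onehot x) (trues {size d} ⊗ onehot y))
  (trans (cong (J ℕ.*_) (trans (J-⊗ (trues {size d}) trues (onehot x) (onehot y))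
    (trans (cong (J′ ℕ.*_) (J-onehot x y x≢y)) (ℕ.*-zeroʳ J′)))) (ℕ.*-zeroʳ J))
  where
  J = jointlyHidden (trues {suc d}) trues
  J′ = jointlyHidden (trues {size d}) trues

-- Distinct x and y jointly hide d - (δ(x , y) - 1) coordinates: the two halves of the cube hide
-- rows and columns of suc d copies of a grid, which meet once, while two rows or two columns do not.

hide : ∀ {d} → Cube d → Vec Bool (codeLength d)
hide []                  = []
hide {suc d} (false ∷ x) = row x Vec.++ (hide x Vec.++ falses {codeLength d})
hide {suc d} (true ∷ x)  = column x Vec.++ (falses {codeLength d} Vec.++ hide x)

J-hide-cross : ∀ {d} (x y : Cube d) → jointlyHidden (hide (false ∷ x)) (hide (true ∷ y)) ≡ suc d
J-hide-cross {d} x y = trans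
  (J-++ (row x) (column y) (hide x Vec.++ falses {codeLength d}) (falses {codeLength d} Vec.++ hide y))
  (trans (cong₂ ℕ._+_ (J-row-column x y) (trans (J-++ (hide x) (falses {codeLength d}) (falses {codeLength d}) (hide y))
    (cong₂ ℕ._+_ (J-falsesʳ (hide x)) (J-falsesˡ (hide y))))) (ℕ.+-identityʳ (suc d)))

J-hide-same : ∀ {d} b (x y : Cube d) → x ≢ y → jointlyHidden (hide (b ∷ x)) (hide (b ∷ y)) ≡ jointlyHidden (hide x) (hide y)
J-hide-same {d} false x y x≢y = trans
  (J-++ (row x) (row y) (hide x Vec.++ falses {codeLength d}) (hide y Vec.++ falses {codeLength d}))
  (trans (cong₂ ℕ._+_ (J-row x y x≢y) (trans (J-++ (hide x) (hide y) (falses {codeLength d}) (falses {codeLength d}))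
    (cong (jointlyHidden (hide x) (hide y) ℕ.+_) (J-falsesˡ (falses {codeLength d}))))) (ℕ.+-identityʳ _))
J-hide-same {d} true x y x≢y = trans
  (J-++ (column x) (column y) (falses {codeLength d} Vec.++ hide x) (falses {codeLength d} Vec.++ hide y))
  (cong₂ ℕ._+_ (J-column x y x≢y) (trans (J-++ (falses {codeLength d}) (falses {codeLength d}) (hide x) (hide y))
    (cong (ℕ._+ jointlyHidden (hide x) (hide y)) (J-falsesˡ (falses {codeLength d})))))

hideWeight : ∀ {d} → Cube d → Cube d → ℚ
hideWeight x y = ½^ jointlyHidden (hide x) (hide y)

-- Counting levels from 0, pairs at level `i` have frequency `2 ^ -(2 + i)` and weight
-- `2 ^ -(d - i)`. The product does not depend on `i`, which is the purpose of `hide`.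
𝔼-hideWeight : ∀ d (h : Cube d → Cube d → ℚ) →
               𝔼 (λ x → 𝔼 (λ y → 𝟙 (lt x y) * (hideWeight x y * h x y))) ≡ ½^ (2 ℕ.+ d) * sum (λ ℓ → lev ℓ h)
𝔼-hideWeight zero h = trans (ℚ.*-zeroˡ (1ℚ * h [] [])) (sym (ℚ.*-zeroʳ (½^ 2)))
𝔼-hideWeight (suc d) h = begin
  ½ * (𝔼 (λ x → ½ * (𝔼 (E false false x) + 𝔼 (E false true x))) + 𝔼 (λ x → ½ * (𝔼 (E true false x) + 𝔼 (E true true x))))
    ≡⟨ cong (½ *_) (cong₂ _+_
         (trans (𝔼-cong {d} λ x → cong (½ *_) (cong₂ _+_ (𝔼-cong {d} (same false refl x)) (𝔼-cong {d} (cross x))))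
           (trans (𝔼-* ½ (λ x → 𝔼 (B false x) + 𝔼 (C x))) (cong (½ *_) (trans (𝔼-+ (λ x → 𝔼 (B false x)) (λ x → 𝔼 (C x)))
             (cong₂ _+_ (𝔼-hideWeight d (h ↾ false)) 𝔼C)))))
         (trans (𝔼-cong {d} λ x → cong (½ *_) (cong₂ _+_ (trans (𝔼-cong {d} λ y → ℚ.*-zeroˡ (hideWeight (true ∷ x) (false ∷ y) * h (true ∷ x) (false ∷ y))) (𝔼-const {d} 0ℚ)) (𝔼-cong {d} (same true refl x))))
           (trans (𝔼-* ½ (λ x → 0ℚ + 𝔼 (B true x))) (cong (½ *_) (trans (𝔼-cong {d} λ x → ℚ.+-identityˡ (𝔼 (B true x)))
             (𝔼-hideWeight d (h ↾ true))))))) ⟩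
  ½ * (½ * (½^ (2 ℕ.+ d) * Σ₀ + ½^ suc d * lev zero h) + ½ * (½^ (2 ℕ.+ d) * Σ₁))
    ≡⟨ lemma (½^ d) Σ₀ Σ₁ (lev zero h) ⟩
  ½^ (3 ℕ.+ d) * (lev zero h + ½ * (Σ₀ + Σ₁))
    ≡⟨ cong (λ q → ½^ (3 ℕ.+ d) * (lev zero h + q)) (sym (trans (sum-* d ½ (λ ℓ → lev ℓ (h ↾ false) + lev ℓ (h ↾ true)))
         (cong (½ *_) (sum-+ d (λ ℓ → lev ℓ (h ↾ false)) (λ ℓ → lev ℓ (h ↾ true)))))) ⟩
  ½^ (3 ℕ.+ d) * sum (λ ℓ → lev ℓ h) ∎
  where
  open ≡-Reasoning
  E : Bool → Bool → Cube d → Cube d → ℚ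
  E b b′ x y = 𝟙 (lt (b ∷ x) (b′ ∷ y)) * (hideWeight (b ∷ x) (b′ ∷ y) * h (b ∷ x) (b′ ∷ y))
  B : Bool → Cube d → Cube d → ℚ
  B b x y = 𝟙 (lt x y) * (hideWeight x y * (h ↾ b) x y)
  C : Cube d → Cube d → ℚ
  C x y = ½^ suc d * h (false ∷ x) (true ∷ y)
  Σ₀ = sum (λ ℓ → lev ℓ (h ↾ false))
  Σ₁ = sum (λ ℓ → lev ℓ (h ↾ true))
  cross : ∀ x y → E false true x y ≡ C x y
  cross x y = trans (ℚ.*-identityˡ (hideWeight (false ∷ x) (true ∷ y) * h (false ∷ x) (true ∷ y))) (cong (λ j → ½^ j * h (false ∷ x) (true ∷ y)) (J-hide-cross x y))
  𝔼C : 𝔼 (λ x → 𝔼 (C x)) ≡ ½^ suc d * lev zero h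
  𝔼C = trans (𝔼-cong {d} λ x → 𝔼-* (½^ suc d) (λ y → h (false ∷ x) (true ∷ y)))
    (𝔼-* (½^ suc d) (λ x → 𝔼 (λ y → h (false ∷ x) (true ∷ y))))
  lt-∷ : ∀ b (x y : Cube d) → lt (b ∷ x) (b ∷ y) ≡ lt x y
  lt-∷ false x y = refl
  lt-∷ true  x y = refl
  weigh : ∀ c {w w′ : ℚ} z → (T c → w ≡ w′) → 𝟙 c * (w * z) ≡ 𝟙 c * (w′ * z)
  weigh false {w} {w′} z f = trans (ℚ.*-zeroˡ (w * z)) (sym (ℚ.*-zeroˡ (w′ * z)))
  weigh true  z f = cong (λ w → 1ℚ * (w * z)) (f _)
  same : ∀ b {b′} → b ≡ b′ → ∀ x y → E b b′ x y ≡ B b x y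
  same b refl x y = trans (cong (λ c → 𝟙 c * (hideWeight (b ∷ x) (b ∷ y) * h (b ∷ x) (b ∷ y))) (lt-∷ b x y))
    (weigh (lt x y) (h (b ∷ x) (b ∷ y)) λ t → cong ½^_ (J-hide-same b x y (lt⇒≢ t)))
  lemma : ∀ p s s′ l → ½ * (½ * ((½ * (½ * p)) * s + (½ * p) * l) + ½ * ((½ * (½ * p)) * s′)) ≡
          (½ * (½ * (½ * p))) * (l + ½ * (s + s′))
  lemma = solve-∀ ring

-- The blow-up and its edge count

same : ∀ {d} → Cube d → Cube d → Bool
same []      []       = true
same (b ∷ x) (b′ ∷ y) = not (b xor b′) ∧ same x y

same-refl : ∀ {d} (x : Cube d) → same x x ≡ true
same-refl []          = refl
same-refl (false ∷ x) = same-refl x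
same-refl (true ∷ x)  = same-refl x

same-sym : ∀ {d} (x y : Cube d) → same x y ≡ same y x
same-sym []      []       = refl
same-sym (b ∷ x) (b′ ∷ y) = cong₂ (λ p q → not p ∧ q) (Bool.xor-comm b b′) (same-sym x y)

same⇒≡ : ∀ {d} (x y : Cube d) → T (same x y) → x ≡ y
same⇒≡ []          []          _ = refl
same⇒≡ (false ∷ x) (false ∷ y) t = cong (false ∷_) (same⇒≡ x y t)
same⇒≡ (true ∷ x)  (true ∷ y)  t = cong (true ∷_) (same⇒≡ x y t)

¬same⇒≢ : ∀ {d} (x y : Cube d) → T (not (same x y)) → x ≢ y
¬same⇒≢ x .x t refl = subst (T ∘ not) (same-refl x) t

≢⇒¬same : ∀ {d} (x y : Cube d) → x ≢ y → T (not (same x y))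
≢⇒¬same x y x≢y = decide (same x y) refl
  where
  decide : ∀ b → same x y ≡ b → T (not (same x y))
  decide true  eq = ⊥-elim (x≢y (same⇒≡ x y (subst T (sym eq) _)))
  decide false eq = subst (T ∘ not) (sym eq) _

𝔼-same : ∀ {d} (x : Cube d) c → 𝔼 (λ y → 𝟙 (same x y) * c) ≡ ½^ d * c
𝔼-same []                  c = refl
𝔼-same {suc d} (false ∷ x) c = trans
  (cong₂ (λ p q → ½ * (p + q)) (𝔼-same x c) (trans (𝔼-cong {d} λ y → ℚ.*-zeroˡ c) (𝔼-const {d} 0ℚ)))
  (lemma (½^ d) c)
  where
  lemma : ∀ w c → ½ * (w * c + 0ℚ) ≡ (½ * w) * c
  lemma = solve-∀ ring
𝔼-same {suc d} (true ∷ x) c = trans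
  (cong₂ (λ p q → ½ * (p + q)) (trans (𝔼-cong {d} λ y → ℚ.*-zeroˡ c) (𝔼-const {d} 0ℚ)) (𝔼-same x c))
  (lemma (½^ d) c)
  where
  lemma : ∀ w c → ½ * (0ℚ + w * c) ≡ (½ * w) * c
  lemma = solve-∀ ring

prefix : ∀ m {n} → Cube (m ℕ.+ n) → Cube m
prefix zero    _       = []
prefix (suc m) (b ∷ x) = b ∷ prefix m x

suffix : ∀ m {n} → Cube (m ℕ.+ n) → Cube n
suffix zero    x       = x
suffix (suc m) (b ∷ x) = suffix m x

prefix-++ : ∀ {m n} (x : Cube m) (y : Cube n) → prefix m (x Vec.++ y) ≡ x
prefix-++ []      y = refl
prefix-++ (b ∷ x) y = cong (b ∷_) (prefix-++ x y)

suffix-++ : ∀ {m n} (x : Cube m) (y : Cube n) → suffix m (x Vec.++ y) ≡ y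
suffix-++ []      y = refl
suffix-++ (b ∷ x) y = suffix-++ x y

-- Vertices are triples of a cube point x, a code a and a label i.  For each label there is a copy
-- of the complete graph on the cube for each ω, with x placed at the code mask (hide x) ω; an edge
-- at level ℓ lies in exactly 2 ^ (d - ℓ + 1) copies, so it is weighted like 1 / τ ℓ.

module Blowup (d r : ℕ) where

  private
    N = codeLength d

  D : ℕ
  D = (d ℕ.+ N) ℕ.+ r

  Triple : Set
  Triple = Cube d × Cube N × Cube r

  triple : Cube D → Triple
  triple X = prefix d (prefix (d ℕ.+ N) X) , suffix d (prefix (d ℕ.+ N) X) , suffix (d ℕ.+ N) X

  -- The order of the parts matters. The cube point leads, so distinct cube points compare as in the
  -- cube whatever their codes and labels; the label comes last, so it orders vertices that agree
  -- otherwise.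
  point : Cube d → Cube N → Cube r → Cube D
  point x a i = (x Vec.++ a) Vec.++ i

  vertex : Cube d → Cube N → Cube r → Fin (size D)
  vertex x a i = enc (point x a i)

  triple-point : ∀ x a i → triple (point x a i) ≡ (x , a , i)
  triple-point x a i = cong₂ _,_
    (trans (cong (prefix d) (prefix-++ (x Vec.++ a) i)) (prefix-++ x a))
    (cong₂ _,_ (trans (cong (suffix d) (prefix-++ (x Vec.++ a) i)) (suffix-++ x a)) (suffix-++ (x Vec.++ a) i))

  joined : Triple → Triple → Bool
  joined (x , a , i) (y , b , j) = same i j ∧ (not (same x y) ∧ compat (hide x) (hide y) a b)

  joined-sym : ∀ u v → joined u v ≡ joined v u
  joined-sym (x , a , i) (y , b , j) =
    cong₂ _∧_ (same-sym i j) (cong₂ (λ p q → not p ∧ q) (same-sym x y) (compat-swap (hide x) (hide y) a b))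

  joined-irrefl : ∀ u → joined u u ≡ false
  joined-irrefl (x , a , i) = trans (cong (λ b → same i i ∧ (not b ∧ compat (hide x) (hide x) a a)) (same-refl x))
    (Bool.∧-zeroʳ (same i i))

  blowup : Graph (Fin (size D))
  blowup = record
    { adj        = λ u v → joined (triple (dec u)) (triple (dec v))
    ; adj-sym    = λ u v → joined-sym (triple (dec u)) (triple (dec v))
    ; adj-irrefl = λ v → joined-irrefl (triple (dec v))
    }

  adj-blowup : ∀ x a i y b j → adj blowup (vertex x a i) (vertex y b j) ≡ joined (x , a , i) (y , b , j)
  adj-blowup x a i y b j = cong₂ joined (trans (cong triple (dec-enc (point x a i))) (triple-point x a i))
                                        (trans (cong triple (dec-enc (point y b j))) (triple-point y b j))

  module _ (S : Graph (Fin (size D))) (S⊆ : ∀ u v → T (adj S u v) → T (adj blowup u v)) where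

    slice : Cube r → Cube N → Graph (Cube d)
    slice i ω = record
      { adj        = λ x y → adj S (at x) (at y)
      ; adj-sym    = λ x y → adj-sym S (at x) (at y)
      ; adj-irrefl = λ x → adj-irrefl S (at x)
      }
      where
      at : Cube d → Fin (size D)
      at x = vertex x (mask (hide x) ω) i

    private
      s : Cube r → Cube d → Cube d → Cube N → Cube N → ℚ
      s i x y a b = 𝟙 (adj S (vertex x a i) (vertex y b i))

      edge-joined : ∀ x a i y b j → T (adj S (vertex x a i) (vertex y b j)) → T (joined (x , a , i) (y , b , j))
      edge-joined x a i y b j t = subst T (adj-blowup x a i y b j) (S⊆ _ _ t)

      -- An edge of `S` is an edge of the blow-up, so its labels agree and its codes are compatible,
      -- and these indicators may be inserted freely. Its cube points differ, so they alone decide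
      -- the order.
      pointwise : ∀ x a i y b j →
        𝟙 (lt (point x a i) (point y b j) ∧ adj S (vertex x a i) (vertex y b j)) ≡
        𝟙 (same i j) * (𝟙 (compat (hide x) (hide y) a b) * (𝟙 (lt x y) * s i x y a b))
      pointwise x a i y b j = onLabels (same i j) refl
        where
        T≡ : ∀ {c} → T c → c ≡ true
        T≡ = Equivalence.to Bool.T-≡
        F≡ : ∀ c → ¬ T c → c ≡ false
        F≡ false _  = refl
        F≡ true  ¬t = ⊥-elim (¬t _)
        rest = 𝟙 (compat (hide x) (hide y) a b) * (𝟙 (lt x y) * s i x y a b)
        onLabels : ∀ c → same i j ≡ c →
          𝟙 (lt (point x a i) (point y b j) ∧ adj S (vertex x a i) (vertex y b j)) ≡ 𝟙 (same i j) * rest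
        onLabels false eq = trans
          (cong 𝟙 (trans (cong (lt (point x a i) (point y b j) ∧_)
            (F≡ _ λ t → subst T eq (proj₁ (Equivalence.to Bool.T-∧ (edge-joined x a i y b j t))))) (Bool.∧-zeroʳ _)))
          (sym (trans (cong (λ c → 𝟙 c * rest) eq) (ℚ.*-zeroˡ rest)))
        onLabels true eq = trans (onEdge (adj S (vertex x a i) (vertex y b j)) refl)
          (sym (trans (cong (λ c → 𝟙 c * rest) eq) (ℚ.*-identityˡ rest)))
          where
          i≡j : i ≡ j
          i≡j = same⇒≡ i j (subst T (sym eq) _)
          s≡ : s i x y a b ≡ 𝟙 (adj S (vertex x a i) (vertex y b j))
          s≡ = cong (λ j → 𝟙 (adj S (vertex x a i) (vertex y b j))) i≡j
          onEdge : ∀ c → adj S (vertex x a i) (vertex y b j) ≡ c →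
            𝟙 (lt (point x a i) (point y b j) ∧ adj S (vertex x a i) (vertex y b j)) ≡ rest
          onEdge false eq′ = trans (cong 𝟙 (trans (cong (lt (point x a i) (point y b j) ∧_) eq′) (Bool.∧-zeroʳ _)))
            (sym (trans (cong (λ q → 𝟙 (compat (hide x) (hide y) a b) * (𝟙 (lt x y) * q)) (trans s≡ (cong 𝟙 eq′)))
              (zeros (𝟙 (compat (hide x) (hide y) a b)) (𝟙 (lt x y)))))
            where
            zeros : ∀ p q → p * (q * 0ℚ) ≡ 0ℚ
            zeros = solve-∀ ring
          onEdge true eq′ = trans
            (cong 𝟙 (trans (cong₂ _∧_ (trans (lt-++ (x Vec.++ a) (y Vec.++ b) i j (x≢y ∘ x++a≡)) (lt-++ x y a b x≢y)) eq′) (Bool.∧-identityʳ (lt x y))))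
            (sym (trans (cong₂ (λ p q → 𝟙 p * (𝟙 (lt x y) * q)) (T≡ compatible) (trans s≡ (cong 𝟙 eq′))) (ones (𝟙 (lt x y)))))
            where
            join = Equivalence.to Bool.T-∧ (proj₂ (Equivalence.to (Bool.T-∧ {same i j}) (edge-joined x a i y b j (subst T (sym eq′) _))))
            x≢y : x ≢ y
            x≢y = ¬same⇒≢ x y (proj₁ join)
            compatible : T (compat (hide x) (hide y) a b)
            compatible = proj₂ join
            x++a≡ : x Vec.++ a ≡ y Vec.++ b → x ≡ y
            x++a≡ e = trans (sym (prefix-++ x a)) (trans (cong (prefix d) e) (prefix-++ y b))
            ones : ∀ p → 1ℚ * (p * 1ℚ) ≡ p
            ones = solve-∀ ring

      𝔼-triple : (f : Cube D → ℚ) → 𝔼 f ≡ 𝔼 {d} (λ x → 𝔼 {N} (λ a → 𝔼 {r} (λ i → f (point x a i))))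
      𝔼-triple f = trans (𝔼-++ (d ℕ.+ N) f) (𝔼-++ d (λ z → 𝔼 (λ i → f (z Vec.++ i))))

      -- The chance of equal labels, times the factor of `𝔼-compat` that is common to all pairs.
      κ = ½^ r * ½^ N

      Q : Cube d → Cube N → Cube r → Cube d → Cube N → ℚ
      Q x a i y b = 𝟙 (compat (hide x) (hide y) a b) * (½^ r * (𝟙 (lt x y) * s i x y a b))

      h : Cube r → Cube N → Cube d → Cube d → ℚ
      h i ω = ind (adj (slice i ω))

      sum-codes : ∀ i x y → 𝔼 (λ a → 𝔼 (λ b → Q x a i y b)) ≡
                  𝔼 (λ ω → κ * (𝟙 (lt x y) * (hideWeight x y * h i ω x y)))
      sum-codes i x y = trans (𝔼-compat (hide x) (hide y) (λ a b → ½^ r * (𝟙 (lt x y) * s i x y a b)))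
        (trans (sym (𝔼-* (½^ N * hideWeight x y) (λ ω → ½^ r * (𝟙 (lt x y) * h i ω x y))))
          (𝔼-cong {N} λ ω → lemma (½^ N) (hideWeight x y) (½^ r) (𝟙 (lt x y)) (h i ω x y)))
        where
        lemma : ∀ n w r l h → (n * w) * (r * (l * h)) ≡ (r * n) * (l * (w * h))
        lemma = solve-∀ ring

      sum-slice : ∀ i ω → 𝔼 (λ x → 𝔼 (λ y → κ * (𝟙 (lt x y) * (hideWeight x y * h i ω x y)))) ≡
                  (κ * ½^ (2 ℕ.+ d)) * sum (λ ℓ → lev ℓ (h i ω))
      sum-slice i ω = trans (𝔼-cong {d} λ x → 𝔼-* κ (λ y → 𝟙 (lt x y) * (hideWeight x y * h i ω x y)))
        (trans (𝔼-* κ (λ x → 𝔼 (λ y → 𝟙 (lt x y) * (hideWeight x y * h i ω x y))))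
          (trans (cong (κ *_) (𝔼-hideWeight d (h i ω))) (sym (ℚ.*-assoc κ (½^ (2 ℕ.+ d)) _))))

    -- By `𝔼-compat` the mean over pairs of codes becomes a mean over copies, at the price of
    -- `hideWeight`; inside a copy this weight turns the count of edges into the plain sum of level
    -- densities.
    e-slices : fromℕ (e S) ≡ ((fromℕ (size D) * fromℕ (size D)) * (κ * ½^ (2 ℕ.+ d))) *
                             𝔼 (λ i → 𝔼 (λ ω → sum (λ ℓ → lev ℓ (ind (adj (slice i ω))))))
    e-slices = trans (e-enc D S) (trans (cong ((fromℕ (size D) * fromℕ (size D)) *_) total) (sym (ℚ.*-assoc (fromℕ (size D) * fromℕ (size D)) (κ * ½^ (2 ℕ.+ d)) (𝔼 λ i → 𝔼 (λ ω → sum (λ ℓ → lev ℓ (h i ω)))))))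
      where
      open ≡-Reasoning
      inner : ∀ x a i → 𝔼 {D} (λ Y → 𝟙 (lt (point x a i) Y ∧ adj S (vertex x a i) (enc Y))) ≡ 𝔼 (λ y → 𝔼 (λ b → Q x a i y b))
      inner x a i = trans (𝔼-triple (λ Y → 𝟙 (lt (point x a i) Y ∧ adj S (vertex x a i) (enc Y))))
        (𝔼-cong {d} λ y → 𝔼-cong {N} λ b → trans (𝔼-cong {r} λ j → pointwise x a i y b j)
          (trans (𝔼-same i (𝟙 (compat (hide x) (hide y) a b) * (𝟙 (lt x y) * s i x y a b)))
            (lemma (½^ r) (𝟙 (compat (hide x) (hide y) a b)) (𝟙 (lt x y) * s i x y a b))))
        where
        lemma : ∀ r p q → r * (p * q) ≡ p * (r * q)
        lemma = solve-∀ ring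
      total : 𝔼 {D} (λ X → 𝔼 {D} (λ Y → 𝟙 (lt X Y ∧ adj S (enc X) (enc Y)))) ≡
              (κ * ½^ (2 ℕ.+ d)) * 𝔼 (λ i → 𝔼 (λ ω → sum (λ ℓ → lev ℓ (h i ω))))
      total = begin
        𝔼 {D} (λ X → 𝔼 {D} (λ Y → 𝟙 (lt X Y ∧ adj S (enc X) (enc Y))))
          ≡⟨ 𝔼-triple (λ X → 𝔼 {D} (λ Y → 𝟙 (lt X Y ∧ adj S (enc X) (enc Y)))) ⟩
        𝔼 (λ x → 𝔼 (λ a → 𝔼 (λ i → 𝔼 {D} (λ Y → 𝟙 (lt (point x a i) Y ∧ adj S (vertex x a i) (enc Y))))))
          ≡⟨ (𝔼-cong {d} λ x → 𝔼-cong {N} λ a → 𝔼-cong {r} λ i → inner x a i) ⟩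
        𝔼 (λ x → 𝔼 (λ a → 𝔼 (λ i → 𝔼 (λ y → 𝔼 (λ b → Q x a i y b)))))
          ≡⟨ (𝔼-cong {d} λ x → 𝔼-swap (λ a i → 𝔼 (λ y → 𝔼 (λ b → Q x a i y b)))) ⟩
        𝔼 (λ x → 𝔼 (λ i → 𝔼 (λ a → 𝔼 (λ y → 𝔼 (λ b → Q x a i y b)))))
          ≡⟨ 𝔼-swap (λ x i → 𝔼 (λ a → 𝔼 (λ y → 𝔼 (λ b → Q x a i y b)))) ⟩
        𝔼 (λ i → 𝔼 (λ x → 𝔼 (λ a → 𝔼 (λ y → 𝔼 (λ b → Q x a i y b)))))
          ≡⟨ (𝔼-cong {r} λ i → 𝔼-cong {d} λ x → trans (𝔼-swap (λ a y → 𝔼 (λ b → Q x a i y b)))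
               (𝔼-cong {d} λ y → sum-codes i x y)) ⟩
        𝔼 (λ i → 𝔼 (λ x → 𝔼 (λ y → 𝔼 (λ ω → κ * (𝟙 (lt x y) * (hideWeight x y * h i ω x y))))))
          ≡⟨ (𝔼-cong {r} λ i → trans (𝔼-cong {d} λ x → 𝔼-swap (λ y ω → κ * (𝟙 (lt x y) * (hideWeight x y * h i ω x y))))
               (trans (𝔼-swap (λ x ω → 𝔼 (λ y → κ * (𝟙 (lt x y) * (hideWeight x y * h i ω x y)))))
                 (trans (𝔼-cong {N} λ ω → sum-slice i ω) (𝔼-* (κ * ½^ (2 ℕ.+ d)) (λ ω → sum (λ ℓ → lev ℓ (h i ω))))))) ⟩
        𝔼 (λ i → (κ * ½^ (2 ℕ.+ d)) * 𝔼 (λ ω → sum (λ ℓ → lev ℓ (h i ω))))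
          ≡⟨ 𝔼-* (κ * ½^ (2 ℕ.+ d)) (λ i → 𝔼 (λ ω → sum (λ ℓ → lev ℓ (h i ω)))) ⟩
        (κ * ½^ (2 ℕ.+ d)) * 𝔼 (λ i → 𝔼 (λ ω → sum (λ ℓ → lev ℓ (h i ω)))) ∎

-- Dense copies that omit the same points

-- Markov's inequality in reverse, now over labels. Strictness of `p < f i` ensures that the copies
-- selected have edges even when `p = 0`.
manyAbove : ∀ {r} (f : Cube r → ℚ) p → 0ℚ ≤ p → (∀ i → f i ≤ 1ℚ) →
            ∃[ is ] AllPairs (λ i j → T (lt i j)) is × All (λ i → p < f i) is × 𝔼 f ≤ ½^ r * fromℕ (length is) + p
manyAbove {zero} f p 0≤p f≤1 = decide (p ℚ.<? f [])
  where
  decide : Dec (p < f []) → ∃[ is ] AllPairs (λ i j → T (lt i j)) is × All (λ i → p < f i) is × f [] ≤ 1ℚ * fromℕ (length is) + p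
  decide (yes p<f) = [] ∷ [] , [] ∷ [] , p<f ∷ [] , ≤-by (0≤-+ (≤⇒0≤- (f≤1 [])) 0≤p) (lemma (f []) p)
    where
    lemma : ∀ f p → f + ((1ℚ - f) + p) ≡ 1ℚ * 1ℚ + p
    lemma = solve-∀ ring
  decide (no p≮f) = [] , [] , [] , ℚ.≤-trans (ℚ.≮⇒≥ p≮f) (ℚ.≤-reflexive (lemma p))
    where
    lemma : ∀ p → p ≡ 1ℚ * 0ℚ + p
    lemma = solve-∀ ring
manyAbove {suc r} f p 0≤p f≤1 =
  map (false ∷_) is ++ map (true ∷_) js ,
  AllPairs.++⁺ (AllPairs.map⁺ is-sorted) (AllPairs.map⁺ js-sorted)
    (All.map⁺ (All.universal (λ i → All.map⁺ (All.universal (λ j → _) js)) is)) ,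
  All.++⁺ (All.map⁺ is-above) (All.map⁺ js-above) ,
  ℚ.≤-trans (*-monoˡ 0≤½ (ℚ.+-mono-≤ is-many js-many))
    (ℚ.≤-reflexive (trans (lemma (½^ r) (fromℕ (length is)) (fromℕ (length js)) p)
      (cong (λ q → ½^ suc r * q + p) (trans (sym (fromℕ-+ (length is) (length js))) (cong fromℕ (sym lengths))))))
  where
  ih₀ = manyAbove (λ i → f (false ∷ i)) p 0≤p (λ i → f≤1 (false ∷ i))
  ih₁ = manyAbove (λ i → f (true ∷ i)) p 0≤p (λ i → f≤1 (true ∷ i))
  is = proj₁ ih₀
  js = proj₁ ih₁
  is-sorted = proj₁ (proj₂ ih₀)
  js-sorted = proj₁ (proj₂ ih₁)
  is-above = proj₁ (proj₂ (proj₂ ih₀))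
  js-above = proj₁ (proj₂ (proj₂ ih₁))
  is-many = proj₂ (proj₂ (proj₂ ih₀))
  js-many = proj₂ (proj₂ (proj₂ ih₁))
  lengths : length (map (false ∷_) is ++ map (true ∷_) js) ≡ length is ℕ.+ length js
  lengths = trans (List.length-++ (map (false ∷_) is))
    (cong₂ ℕ._+_ (List.length-map (false ∷_) is) (List.length-map (true ∷_) js))
  lemma : ∀ w a b p → ½ * ((w * a + p) + (w * b + p)) ≡ (½ * w) * (a + b) + p
  lemma = solve-∀ ring

module _ {I Z : Set} {R : I → I → Set} {P : I → Set} (f : I → Z → Bool) where

  private
    halve : ∀ z (is : List I) →
            length (filter (λ i → f i z Bool.≟ true) is) ℕ.+ length (filter (λ i → f i z Bool.≟ false) is) ≡ length is
    halve z [] = refl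
    halve z (i ∷ is) with f i z
    ... | true  = cong suc (halve z is)
    ... | false = trans (ℕ.+-suc _ _) (cong suc (halve z is))

  -- Pigeonhole once per `z`: the larger of the two classes keeps at least half of the list.
  samePattern : ∀ (zs : List Z) s (is : List I) → AllPairs R is → All P is → 2 ℕ.^ length zs ℕ.* s ℕ.≤ length is →
    ∃[ js ] AllPairs R js × All P js × s ℕ.≤ length js × All (λ z → ∃[ c ] All (λ i → f i z ≡ c) js) zs
  samePattern [] s is sorted good le = is , sorted , good , ℕ.≤-trans (ℕ.≤-reflexive (sym (ℕ.*-identityˡ s))) le , []
  samePattern (z ∷ zs) s is sorted good le
    with js , sorted′ , good′ , le′ , const ← samePattern zs (2 ℕ.* s) is sorted good
           (ℕ.≤-trans (ℕ.≤-reflexive (trans (sym (ℕ.*-assoc (2 ℕ.^ length zs) 2 s)) (cong (ℕ._* s) (ℕ.*-comm (2 ℕ.^ length zs) 2)))) le) =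
    [ keep true , keep false ]′ larger
    where
    part : Bool → List I
    part c = filter (λ i → f i z Bool.≟ c) js
    larger : s ℕ.≤ length (part true) ⊎ s ℕ.≤ length (part false)
    larger with s ℕ.≤? length (part true) | s ℕ.≤? length (part false)
    ... | yes le₁ | _       = inj₁ le₁
    ... | no _    | yes le₂ = inj₂ le₂
    ... | no ¬le₁ | no ¬le₂ = ⊥-elim (ℕ.<⇒≱ (ℕ.+-mono-< (ℕ.≰⇒> ¬le₁) (ℕ.≰⇒> ¬le₂))
      (ℕ.≤-trans (ℕ.≤-reflexive (cong (s ℕ.+_) (sym (ℕ.+-identityʳ s)))) (ℕ.≤-trans le′ (ℕ.≤-reflexive (sym (halve z js))))))
    keep : ∀ c → s ℕ.≤ length (part c) →
      ∃[ js ] AllPairs R js × All P js × s ℕ.≤ length js × All (λ z → ∃[ c ] All (λ i → f i z ≡ c) js) (z ∷ zs)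
    keep c le″ = part c , AllPairs.filter⁺ (λ i → f i z Bool.≟ c) sorted′ , All.filter⁺ (λ i → f i z Bool.≟ c) good′ , le″ ,
      (c , All.all-filter (λ i → f i z Bool.≟ c) js) ∷ All.map (λ (c′ , eq) → c′ , All.filter⁺ (λ i → f i z Bool.≟ c) eq) const

lookup-AllPairs : ∀ {I : Set} {R : I → I → Set} {is : List I} → AllPairs R is →
                  ∀ {i j} → i Fin.< j → R (List.lookup is i) (List.lookup is j)
lookup-AllPairs (r ∷ rs) {zero}  {suc j} _           = All.lookup r (∈-lookup j)
lookup-AllPairs (r ∷ rs) {suc i} {suc j} (ℕ.s≤s i<j) = lookup-AllPairs rs i<j

-- Order retractions and positions of labels

-- Distinct points may be sent to the same kept point; labels separate them afterwards.
record Retraction {d} (alive : Cube d → Bool) : Set where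
  field
    ret       : Cube d → Cube d
    ret-alive : ∀ x → T (alive (ret x))
    ret-fix   : ∀ x → T (alive x) → ret x ≡ x
    ret-mono  : ∀ x y → T (lt x y) → T (lt (ret x) (ret y)) ⊎ ret x ≡ ret y

open Retraction public

lowest highest : ∀ {d} → Cube d
lowest  = Vec.replicate _ false
highest = Vec.replicate _ true

lowest-≤ : ∀ {d} (x : Cube d) → lowest ≡ x ⊎ T (lt lowest x)
lowest-≤ []          = inj₁ refl
lowest-≤ (true ∷ x)  = inj₂ _
lowest-≤ (false ∷ x) = [ inj₁ ∘ cong (false ∷_) , inj₂ ]′ (lowest-≤ x)

highest-≥ : ∀ {d} (x : Cube d) → x ≡ highest ⊎ T (lt x highest)
highest-≥ []          = inj₁ refl
highest-≥ (false ∷ x) = inj₂ _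
highest-≥ (true ∷ x)  = [ inj₁ ∘ cong (true ∷_) , inj₂ ]′ (highest-≥ x)

-- A half with nothing kept collapses to the nearest kept point of the other half, which is the
-- image there of `highest` or `lowest`.
retraction : ∀ d (alive : Cube d → Bool) → (∀ x → ¬ T (alive x)) ⊎ Retraction alive
retraction zero alive = decide (Bool.T? (alive []))
  where
  decide : Dec (T (alive [])) → (∀ x → ¬ T (alive x)) ⊎ Retraction alive
  decide (no dead) = inj₁ λ { [] → dead }
  decide (yes t)   = inj₂ record { ret = λ x → x ; ret-alive = λ { [] → t } ; ret-fix = λ _ _ → refl ; ret-mono = λ _ _ → inj₁ }
retraction (suc d) alive = combine (retraction d (λ x → alive (false ∷ x))) (retraction d (λ x → alive (true ∷ x)))
  where
  lift-mono : ∀ {a} (R : Retraction {d} a) b (x y : Cube d) → T (lt x y) →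
              T (lt (b ∷ ret R x) (b ∷ ret R y)) ⊎ _≡_ {A = Cube (suc d)} (b ∷ ret R x) (b ∷ ret R y)
  lift-mono R false x y t = [ inj₁ , inj₂ ∘ cong (false ∷_) ]′ (ret-mono R x y t)
  lift-mono R true  x y t = [ inj₁ , inj₂ ∘ cong (true ∷_) ]′ (ret-mono R x y t)
  combine : (∀ x → ¬ T (alive (false ∷ x))) ⊎ Retraction (λ x → alive (false ∷ x)) →
            (∀ x → ¬ T (alive (true ∷ x))) ⊎ Retraction (λ x → alive (true ∷ x)) →
            (∀ x → ¬ T (alive x)) ⊎ Retraction alive
  combine (inj₁ dead₀) (inj₁ dead₁) = inj₁ λ { (false ∷ x) → dead₀ x ; (true ∷ x) → dead₁ x }
  combine (inj₂ R₀) (inj₂ R₁) = inj₂ record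
    { ret       = λ { (false ∷ x) → false ∷ ret R₀ x ; (true ∷ x) → true ∷ ret R₁ x }
    ; ret-alive = λ { (false ∷ x) → ret-alive R₀ x ; (true ∷ x) → ret-alive R₁ x }
    ; ret-fix   = λ { (false ∷ x) t → cong (false ∷_) (ret-fix R₀ x t) ; (true ∷ x) t → cong (true ∷_) (ret-fix R₁ x t) }
    ; ret-mono  = λ { (false ∷ x) (false ∷ y) t → lift-mono R₀ false x y t
                    ; (false ∷ x) (true ∷ y)  t → inj₁ _
                    ; (true ∷ x)  (true ∷ y)  t → lift-mono R₁ true x y t }
    }
  combine (inj₂ R₀) (inj₁ dead₁) = inj₂ record
    { ret       = λ { (false ∷ x) → false ∷ ret R₀ x ; (true ∷ x) → false ∷ ret R₀ highest }
    ; ret-alive = λ { (false ∷ x) → ret-alive R₀ x ; (true ∷ x) → ret-alive R₀ highest }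
    ; ret-fix   = λ { (false ∷ x) t → cong (false ∷_) (ret-fix R₀ x t) ; (true ∷ x) t → ⊥-elim (dead₁ x t) }
    ; ret-mono  = λ { (false ∷ x) (false ∷ y) t → lift-mono R₀ false x y t
                    ; (false ∷ x) (true ∷ y)  t → [ inj₂ ∘ cong (λ x → false ∷ ret R₀ x) , lift-mono R₀ false x highest ]′ (highest-≥ x)
                    ; (true ∷ x)  (true ∷ y)  t → inj₂ refl }
    }
  combine (inj₁ dead₀) (inj₂ R₁) = inj₂ record
    { ret       = λ { (false ∷ x) → true ∷ ret R₁ lowest ; (true ∷ x) → true ∷ ret R₁ x }
    ; ret-alive = λ { (false ∷ x) → ret-alive R₁ lowest ; (true ∷ x) → ret-alive R₁ x }
    ; ret-fix   = λ { (false ∷ x) t → ⊥-elim (dead₀ x t) ; (true ∷ x) t → cong (true ∷_) (ret-fix R₁ x t) }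
    ; ret-mono  = λ { (false ∷ x) (false ∷ y) t → inj₂ refl
                    ; (false ∷ x) (true ∷ y)  t → [ inj₂ ∘ cong (λ x → true ∷ ret R₁ x) , lift-mono R₁ true lowest y ]′ (lowest-≤ y)
                    ; (true ∷ x)  (true ∷ y)  t → lift-mono R₁ true x y t }
    }

-- Among vertices moved to the same `u`, those from below get positions under `k`, one already there
-- gets `k`, and those from above get positions over `k`. So the labels repeat the order of the
-- origins, and unmoved vertices share the middle label.
place : ∀ {a u} (k i : ℕ) → Tri (a ℕ.< u) (a ≡ u) (u ℕ.< a) → ℕ
place k i (tri< _ _ _) = i
place k i (tri≈ _ _ _) = k
place k i (tri> _ _ _) = k ℕ.+ suc i

place-mono : ∀ {a b u} k {i j} (t : Tri (a ℕ.< u) (a ≡ u) (u ℕ.< a)) (t′ : Tri (b ℕ.< u) (b ≡ u) (u ℕ.< b)) →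
             i ℕ.< j → j ℕ.< k → a ℕ.< b → place k i t ℕ.< place k j t′
place-mono k (tri< _ _ _)    (tri< _ _ _)    i<j j<k a<b = i<j
place-mono k (tri< _ _ _)    (tri≈ _ _ _)    i<j j<k a<b = ℕ.<-trans i<j j<k
place-mono k {j = j} (tri< _ _ _) (tri> _ _ _) i<j j<k a<b = ℕ.<-≤-trans (ℕ.<-trans i<j j<k) (ℕ.m≤m+n k (suc j))
place-mono k (tri≈ _ refl _) (tri< b<u _ _)  i<j j<k a<b = ⊥-elim (ℕ.<-asym a<b b<u)
place-mono k (tri≈ _ refl _) (tri≈ _ b≡u _)  i<j j<k a<b = ⊥-elim (ℕ.<-irrefl (sym b≡u) a<b)
place-mono k {j = j} (tri≈ _ _ _) (tri> _ _ _) i<j j<k a<b = ℕ.m<m+n k (ℕ.s≤s ℕ.z≤n)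
place-mono k (tri> _ _ u<a)  (tri< b<u _ _)  i<j j<k a<b = ⊥-elim (ℕ.<-asym (ℕ.<-trans u<a a<b) b<u)
place-mono k (tri> _ _ u<a)  (tri≈ _ refl _) i<j j<k a<b = ⊥-elim (ℕ.<-asym u<a a<b)
place-mono k (tri> _ _ _)    (tri> _ _ _)    i<j j<k a<b = ℕ.+-monoʳ-< k (ℕ.s≤s i<j)

place-bound : ∀ {a u} k i (t : Tri (a ℕ.< u) (a ≡ u) (u ℕ.< a)) → i ℕ.< k → place k i t ℕ.< k ℕ.+ suc k
place-bound k i (tri< _ _ _) i<k = ℕ.<-≤-trans i<k (ℕ.m≤m+n k (suc k))
place-bound k i (tri≈ _ _ _) i<k = ℕ.m<m+n k (ℕ.s≤s ℕ.z≤n)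
place-bound k i (tri> _ _ _) i<k = ℕ.+-monoʳ-< k (ℕ.s≤s i<k)

place-eq : ∀ {a u} k i (t : Tri (a ℕ.< u) (a ≡ u) (u ℕ.< a)) → a ≡ u → place k i t ≡ k
place-eq k i (tri< _ a≢u _) a≡u = ⊥-elim (a≢u a≡u)
place-eq k i (tri≈ _ _ _)   a≡u = refl
place-eq k i (tri> _ a≢u _) a≡u = ⊥-elim (a≢u a≡u)

-- Extreme densities and powers of two

lev-offDiagonal : ∀ {d} (ℓ : Fin d) {h : Cube d → Cube d → ℚ} → (∀ x y → x ≢ y → h x y ≡ 1ℚ) → lev ℓ h ≡ 1ℚ
lev-offDiagonal {suc d} zero    eq = trans (𝔼-cong {d} λ x → 𝔼-cong {d} λ y → eq (false ∷ x) (true ∷ y) λ ()) (lev-const {suc d} zero 1ℚ)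
lev-offDiagonal {suc d} (suc ℓ) eq = cong₂ (λ p q → ½ * (p + q))
  (lev-offDiagonal ℓ λ x y x≢y → eq (false ∷ x) (false ∷ y) (x≢y ∘ Vec.∷-injectiveʳ))
  (lev-offDiagonal ℓ λ x y x≢y → eq (true ∷ x) (true ∷ y) (x≢y ∘ Vec.∷-injectiveʳ))

½^-inverse : ∀ n → ½^ n * fromℕ (2 ℕ.^ n) ≡ 1ℚ
½^-inverse zero    = refl
½^-inverse (suc n) = trans (cong (½^ suc n *_) (fromℕ-* 2 (2 ℕ.^ n)))
  (trans (lemma (½^ n) (fromℕ (2 ℕ.^ n))) (½^-inverse n))
  where
  lemma : ∀ a b → (½ * a) * ((1ℚ + 1ℚ) * b) ≡ a * b
  lemma = solve-∀ ring

n≤2^n : ∀ n → n ℕ.≤ 2 ℕ.^ n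
n≤2^n zero    = ℕ.z≤n
n≤2^n (suc n) = ℕ.≤-trans (ℕ.+-mono-≤ (ℕ.m^n>0 2 n) (n≤2^n n)) (ℕ.≤-reflexive (cong (2 ℕ.^ n ℕ.+_) (sym (ℕ.+-identityʳ (2 ℕ.^ n)))))

averageDensity-≤1 : ∀ d .{{_ : NonZero d}} (H : Graph (Cube d)) → averageDensity H ≤ 1ℚ
averageDensity-≤1 d H = *-cancelˡ-≤ (0<fromℕ d) (subst₂ _≤_
  (trans (sym (averageDensity-lev H)) (ℚ.*-comm (averageDensity H) (fromℕ d))) refl
  (sum-≤ d 1ℚ (λ ℓ → lev-≤1 ℓ (λ x y → 𝟙≤1 (adj H x y)))))

averageDensity-empty : ∀ d .{{_ : NonZero d}} (H : Graph (Cube d)) → (∀ x y → ¬ T (adj H x y)) → averageDensity H ≤ 0ℚ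
averageDensity-empty d H empty = *-cancelˡ-≤ (0<fromℕ d) (subst₂ _≤_
  (trans (sym (averageDensity-lev H)) (ℚ.*-comm (averageDensity H) (fromℕ d))) refl
  (sum-≤ d 0ℚ (λ ℓ → ℚ.≤-trans (lev-mono ℓ λ x y → 𝟙-mono (adj H x y) false (empty x y)) (ℚ.≤-reflexive (lev-const ℓ 0ℚ)))))

T⇒∈ : ∀ {n} (W : Subset n) u → T (lookup W u) → u ∈ W
T⇒∈ W u t = Vec.lookup⇒[]= u W (Equivalence.to Bool.T-≡ t)

∈⇒T : ∀ {n} {W : Subset n} {u} → u ∈ W → T (lookup W u)
∈⇒T u∈ = Equivalence.from Bool.T-≡ (Vec.[]=⇒lookup u∈)

-- Repairing omitted isolated vertices

module BlowupSubgraph (d r : ℕ) (S : Subgraph (Blowup.blowup d r)) where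

  open Blowup d r public

  alive : Cube r → Cube (d ℕ.+ codeLength d) → Bool
  alive i z = lookup (verts S) (enc (z Vec.++ i))

  copy : Cube r → Cube (codeLength d) → Graph (Cube d)
  copy = slice (edges S) (edges⊆ S)

  aliveAt : Cube r → Cube (codeLength d) → Cube d → Bool
  aliveAt i ω x = alive i (x Vec.++ mask (hide x) ω)

  -- An isolated vertex of F may be embedded in a copy at a vertex that S omits.  It is moved to the
  -- nearest vertex that S keeps, in another copy whose label restores strict monotonicity.

  module Repair {k} (F : Graph (Fin k)) (label : Fin (k ℕ.+ suc k) → Cube r)
    (label-mono : ∀ l l′ → l Fin.< l′ → T (lt (label l) (label l′)))
    (same-alive : ∀ z l l′ → alive (label l) z ≡ alive (label l′) z)
    (ω : Cube (codeLength d)) where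

    labelAt : ∀ n → n ℕ.< k ℕ.+ suc k → Cube r
    labelAt n n< = label (Fin.fromℕ< n<)

    k< : k ℕ.< k ℕ.+ suc k
    k< = ℕ.m<m+n k (ℕ.s≤s ℕ.z≤n)

    middle : Cube r
    middle = labelAt k k<

    labelAt-mono : ∀ {m n} (m< : m ℕ.< k ℕ.+ suc k) (n< : n ℕ.< k ℕ.+ suc k) → m ℕ.< n → T (lt (labelAt m m<) (labelAt n n<))
    labelAt-mono m< n< m<n = label-mono (Fin.fromℕ< m<) (Fin.fromℕ< n<)
      (subst₂ ℕ._<_ (sym (Fin.toℕ-fromℕ< m<)) (sym (Fin.toℕ-fromℕ< n<)) m<n)

    module _ (φ : Embedding F _<lex_ (copy middle ω)) (R : Retraction (aliveAt middle ω)) where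

      private
        code : Cube d → Cube (codeLength d)
        code x = mask (hide x) ω

        u : Fin k → Cube d
        u i = ret R (to φ i)

        side : ∀ i → Tri (rank (to φ i) ℕ.< rank (u i)) (rank (to φ i) ≡ rank (u i)) (rank (u i) ℕ.< rank (to φ i))
        side i = ℕ.<-cmp (rank (to φ i)) (rank (u i))

        pos : Fin k → ℕ
        pos i = place k (toℕ i) (side i)

        pos< : ∀ i → pos i ℕ.< k ℕ.+ suc k
        pos< i = place-bound k (toℕ i) (side i) (Fin.toℕ<n i)

        lab : Fin k → Cube r
        lab i = labelAt (pos i) (pos< i)

        image : Fin k → Fin (size D)
        image i = vertex (u i) (code (u i)) (lab i)

        -- The retraction ends at a point kept in the middle copy, and the chosen labels all keep
        -- the same points.
        image-alive : ∀ i → image i ∈ verts S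
        image-alive i = T⇒∈ (verts S) (image i) (subst T
          (same-alive (u i Vec.++ code (u i)) (Fin.fromℕ< k<) (Fin.fromℕ< (pos< i))) (ret-alive R (to φ i)))

        image-alive-fix : ∀ i → T (aliveAt middle ω (to φ i)) → image i ≡ vertex (to φ i) (code (to φ i)) middle
        image-alive-fix i t = cong₂ (λ x l → vertex x (code x) l) (ret-fix R (to φ i) t)
          (cong label (Fin.fromℕ<-cong (pos i) k (place-eq k (toℕ i) (side i) (cong rank (sym (ret-fix R (to φ i) t)))) (pos< i) k<))

        sameCluster : ∀ {v w} → v ≡ w → ∀ i j → i Fin.< j → rank (to φ i) ℕ.< rank (to φ j) →
          (t : Tri (rank (to φ i) ℕ.< rank v) (rank (to φ i) ≡ rank v) (rank v ℕ.< rank (to φ i))) →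
          (t′ : Tri (rank (to φ j) ℕ.< rank w) (rank (to φ j) ≡ rank w) (rank w ℕ.< rank (to φ j))) →
          ∀ p p′ → T (lt (point v (code v) (labelAt (place k (toℕ i) t) p)) (point w (code w) (labelAt (place k (toℕ j) t′) p′)))
        sameCluster {v} refl i j i<j a<b t t′ p p′ = lt-++ʳ (v Vec.++ code v) _ _
          (labelAt-mono p p′ (place-mono k t t′ i<j (Fin.toℕ<n j) a<b))

        -- Distinct targets are ordered by their cube points. Equal targets have equal codes too, so
        -- the labels decide, and `place-mono` orders them like the origins.
        image-mono : ∀ i j → i Fin.< j → image i Fin.< image j
        image-mono i j i<j = rank-mono (point (u i) (code (u i)) (lab i)) (point (u j) (code (u j)) (lab j))
          ([ (λ t → lt-++ˡ (u i Vec.++ code (u i)) (u j Vec.++ code (u j)) (lab i) (lab j) (lt-++ˡ (u i) (u j) (code (u i)) (code (u j)) t))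
           , (λ eq → sameCluster eq i j i<j (rank-mono (to φ i) (to φ j) φi<φj) (side i) (side j) (pos< i) (pos< j))
           ]′ (ret-mono R (to φ i) (to φ j) φi<φj))
          where
          φi<φj : T (lt (to φ i) (to φ j))
          φi<φj = <lex⇒lt (to φ i) (to φ j) (to-mono φ i j i<j)

        -- The ends of an edge of the middle copy are kept by `edges-ends`, so the repair neither
        -- moves nor relabels them.
        image-edges : ∀ i j → T (adj F i j) → T (adj (edges S) (image i) (image j))
        image-edges i j t = subst₂ (λ v w → T (adj (edges S) v w))
          (sym (image-alive-fix i (∈⇒T (edges-ends S _ _ edge))))
          (sym (image-alive-fix j (∈⇒T (edges-ends S _ _ (subst T (adj-sym (edges S) (vertex (to φ i) (code (to φ i)) middle) (vertex (to φ j) (code (to φ j)) middle)) edge)))))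
          edge
          where
          edge : T (adj (edges S) (vertex (to φ i) (code (to φ i)) middle) (vertex (to φ j) (code (to φ j)) middle))
          edge = to-edges φ i j t

      repaired : SubgraphContains S F
      repaired = record { to = image ; to-mono = image-mono ; to-edges = image-edges } , image-alive

-- Edge ratios as mean densities

module BlowupDensity (d r : ℕ) .{{_ : NonZero d}} where

  open Blowup d r

  K : ℚ
  K = (fromℕ (size D) * fromℕ (size D)) * ((½^ r * ½^ codeLength d) * ½^ (2 ℕ.+ d))

  0<K : 0ℚ < K
  0<K = 0<-* (0<-* (0<size D) (0<size D)) (0<-* (0<-* (0<½^ r) (0<½^ (codeLength d))) (0<½^ (2 ℕ.+ d)))

  module _ (S : Graph (Fin (size D))) (S⊆ : ∀ u v → T (adj S u v) → T (adj blowup u v)) where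

    meanDensity : Cube r → ℚ
    meanDensity i = 𝔼 (λ ω → averageDensity (slice S S⊆ i ω))

    e-meanDensity : fromℕ (e S) ≡ (K * fromℕ d) * 𝔼 meanDensity
    e-meanDensity = trans (e-slices S S⊆) (trans (cong (K *_) (trans
        (𝔼-cong {r} λ i → trans (𝔼-cong {codeLength d} λ ω →
            trans (sym (averageDensity-lev (slice S S⊆ i ω))) (ℚ.*-comm (averageDensity (slice S S⊆ i ω)) (fromℕ d)))
          (𝔼-* (fromℕ d) (λ ω → averageDensity (slice S S⊆ i ω))))
        (𝔼-* (fromℕ d) meanDensity)))
      (sym (ℚ.*-assoc K (fromℕ d) (𝔼 meanDensity))))

    meanDensity-≤1 : ∀ i → meanDensity i ≤ 1ℚ
    meanDensity-≤1 i = 𝔼-≤1 {codeLength d} λ ω → averageDensity-≤1 d (slice S S⊆ i ω)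

  blowup-complete : ∀ i ω x y → x ≢ y → adj (slice blowup (λ _ _ t → t) i ω) x y ≡ true
  blowup-complete i ω x y x≢y = trans (adj-blowup x _ i y _ i)
    (cong₂ _∧_ (same-refl i) (cong₂ _∧_ (Equivalence.to Bool.T-≡ (≢⇒¬same x y x≢y)) (compat-mask (hide x) (hide y) ω)))

  -- Every copy in the blow-up is complete, since codes of one `ω` are always compatible, so each of
  -- its `d` level densities is 1.
  e-blowup : fromℕ (e blowup) ≡ K * fromℕ d
  e-blowup = trans (e-slices blowup (λ _ _ t → t)) (cong (K *_) (trans
      (𝔼-cong {r} λ i → trans (𝔼-cong {codeLength d} λ ω → trans
          (sum-cong d λ ℓ → lev-offDiagonal ℓ λ x y x≢y → cong 𝟙 (blowup-complete i ω x y x≢y))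
          (trans (sum-const d 1ℚ) (ℚ.*-identityʳ (fromℕ d))))
        (𝔼-const {codeLength d} (fromℕ d)))
      (𝔼-const {r} (fromℕ d))))

  0<Kd : 0ℚ < K * fromℕ d
  0<Kd = 0<-* 0<K (0<fromℕ d)

  e-blowup≢0 : NonZero (e blowup)
  e-blowup≢0 = ℕ.≢-nonZero λ e≡0 → ℚ.<-irrefl (trans (sym (cong fromℕ e≡0)) e-blowup) 0<Kd

  ratio-meanDensity : .{{_ : NonZero (e blowup)}} (S : Subgraph blowup) →
                      ratio S ≡ 𝔼 (meanDensity (edges S) (edges⊆ S))
  ratio-meanDensity S = *-cancelˡ-≡ 0<Kd (trans (ℚ.*-comm (K * fromℕ d) (ratio S))
    (trans (cong (ratio S *_) (sym e-blowup)) (trans (ratio-fromℕ S) (e-meanDensity (edges S) (edges⊆ S)))))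

-- From average density to the ratio

module _ {k d₀ : ℕ} (F : Graph (Fin k)) {p q : ℚ} (0≤p : 0ℚ ≤ p) (p<q : p < q) (suffices : AverageSuffices F p d₀) where

  private
    -- The successor makes `d` positive as well as at least `d₀`.
    d = suc d₀
    zs = vectors bits (d ℕ.+ codeLength d)
    -- Enough labels for the pigeonhole over all points `zs` to leave `2 k + 1`: a middle one with
    -- `k` on either side.
    copies = 2 ℕ.^ length zs ℕ.* (k ℕ.+ suc k)

  module _ (r : ℕ) (r-large : fromℕ copies < (q - p) * fromℕ (2 ℕ.^ r)) where

    open BlowupDensity d r

    dense⇒contains : .{{_ : NonZero (e (Blowup.blowup d r))}} (S : Subgraph (Blowup.blowup d r)) → q ≤ ratio S → SubgraphContains S F
    dense⇒contains S q≤ = fromLabels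
        (manyAbove density p 0≤p (meanDensity-≤1 (edges S) (edges⊆ S)))
      where
      open BlowupSubgraph d r S
      density : Cube r → ℚ
      density = meanDensity (edges S) (edges⊆ S)

      module Labels (js : List (Cube r)) (sorted : AllPairs (λ i j → T (lt i j)) js) (above : All (λ i → p < density i) js)
        (long : k ℕ.+ suc k ℕ.≤ length js) (const : All (λ z → ∃[ c ] All (λ i → alive i z ≡ c) js) zs) where

        label : Fin (k ℕ.+ suc k) → Cube r
        label l = List.lookup js (Fin.inject≤ l long)

        label-mono : ∀ l l′ → l Fin.< l′ → T (lt (label l) (label l′))
        label-mono l l′ l<l′ = lookup-AllPairs sorted (subst₂ ℕ._<_ (sym (Fin.toℕ-inject≤ l long)) (sym (Fin.toℕ-inject≤ l′ long)) l<l′)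

        same-alive : ∀ z l l′ → alive (label l) z ≡ alive (label l′) z
        same-alive z l l′ =
          let c , all-c = All.lookup const (∈-vectors ∈-bits z)
          in trans (All.lookup all-c (∈-lookup (Fin.inject≤ l long))) (sym (All.lookup all-c (∈-lookup (Fin.inject≤ l′ long))))

        middle : Cube r
        middle = label (Fin.fromℕ< (ℕ.m<m+n k (ℕ.s≤s ℕ.z≤n)))

        best = 𝔼-≤-attained (λ ω → averageDensity (copy middle ω))
        ω = proj₁ best

        p<copy : p < averageDensity (copy middle ω)
        p<copy = ℚ.<-≤-trans (All.lookup above (∈-lookup (Fin.inject≤ (Fin.fromℕ< (ℕ.m<m+n k (ℕ.s≤s ℕ.z≤n))) long))) (proj₂ best)

        contains : SubgraphContains S F
        -- If `S` kept no point of this copy, the copy would have no edges, against `0 ≤ p` and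
        -- density above `p`.
        contains = [ (λ dead → ⊥-elim (<⇒≱ p<copy (ℚ.≤-trans (averageDensity-empty d (copy middle ω)
                       (λ x y t → dead x (∈⇒T (edges-ends S _ _ t)))) 0≤p)))
                   , (λ R → Repair.repaired F label label-mono same-alive ω
                       (suffices d (ℕ.n≤1+n d₀) (copy middle ω) (ℚ.<⇒≤ p<copy)) R)
                   ]′ (retraction d (aliveAt middle ω))

      fromLabels : ∃[ is ] AllPairs (λ i j → T (lt i j)) is × All (λ i → p < density i) is × 𝔼 density ≤ ½^ r * fromℕ (length is) + p →
                   SubgraphContains S F
      fromLabels (is , sorted , above , many) =
        let js , sorted′ , above′ , long , const = samePattern alive zs (k ℕ.+ suc k) is sorted above (fromℕ-cancel-≤ (ℚ.<⇒≤ copies<))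
        in Labels.contains js sorted′ above′ long const
        where
        w = fromℕ (2 ℕ.^ r)
        q-p≤ : q - p ≤ ½^ r * fromℕ (length is)
        q-p≤ = ≤-by (≤⇒0≤- (ℚ.≤-trans q≤ (ℚ.≤-trans (ℚ.≤-reflexive (ratio-meanDensity S)) many)))
          (lemma q p (½^ r * fromℕ (length is)))
          where
          lemma : ∀ q p l → (q - p) + ((l + p) - q) ≡ l
          lemma = solve-∀ ring
        copies< : fromℕ copies < fromℕ (length is)
        copies< = ℚ.<-≤-trans r-large (ℚ.≤-trans (*-monoʳ (0≤fromℕ (2 ℕ.^ r)) q-p≤)
          (ℚ.≤-reflexive (trans (lemma (½^ r) (fromℕ (length is)) w)
            (trans (cong (_* fromℕ (length is)) (½^-inverse r)) (ℚ.*-identityˡ (fromℕ (length is)))))))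
          where
          lemma : ∀ a l w → (a * l) * w ≡ (a * w) * l
          lemma = solve-∀ ring

  nonneg-average⇒ρ< : 0ℚ < q → ρ< F <ℚ q
  nonneg-average⇒ρ< 0<q =
    let r , _ , large = archimedean-* (fromℕ copies) (<⇒0<- p<q)
        r-large = ℚ.<-≤-trans large (*-monoˡ (ℚ.<⇒≤ (<⇒0<- p<q)) (fromℕ-mono (n≤2^n r)))
        G = Blowup.blowup d r
        e≢0 = BlowupDensity.e-blowup≢0 d r
    in (size (Blowup.D d r) , G , e≢0) ,
       -- The value 0 may be the default of the maximum, attained by no `F`-free subgraph; then
       -- positivity of `q` is what counts.
       [ (λ ρ≡0 → subst (_< q) (sym ρ≡0) 0<q)
       , (λ (S , free , ρ≡) → subst (_< q) (sym ρ≡) (ℚ.≰⇒> λ q≤ → free (dense⇒contains r r-large {{e≢0}} S q≤)))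
       ]′ (ρ-attained F G {{e≢0}})

-- The selection of labels requires `0 ≤ p`. A negative `p` can be raised to 0, which still lies
-- below `q`.
average⇒ρ< : ∀ {k d₀} (F : Graph (Fin k)) {p q} → AverageSuffices F p d₀ → p < q → 0ℚ < q → ρ< F <ℚ q
average⇒ρ< F {p} {q} suffices p<q 0<q =
  [ (λ 0≤p → nonneg-average⇒ρ< F 0≤p p<q suffices 0<q)
  , (λ p≤0 → nonneg-average⇒ρ< F ℚ.≤-refl 0<q (λ d d₀≤d H 0≤ → suffices d d₀≤d H (ℚ.≤-trans p≤0 0≤)) 0<q)
  ]′ (ℚ.≤-total 0ℚ p)

-- The two infima

module _ {k : ℕ} (F : Graph (Fin k)) where

  ρ<-full : ∀ {n} (G : Graph (Fin n)) .{{_ : NonZero (e G)}} {p} → ρ F G < p → ∃ (RichSuffices F p) × ∃ (AverageSuffices F p)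
  ρ<-full G {p} ρ<p =
    -- Passing from rich levels to averages costs a little, so the average statement at `p` comes
    -- from the rich one at a smaller `p₀`.
    let p₀ , ρ<p₀ , p₀<p = ℚ.<-dense ρ<p
        _ , rich = ρ<⇒rich F G ρ<p₀
    in ρ<⇒rich F G ρ<p , rich⇒average p₀ (ℚ.≤-trans (0≤ρ F G) (ℚ.<⇒≤ ρ<p₀)) F p₀<p rich

  -- For q > 1 a threshold below q in [0 , 1] is needed, hence the detour through complete graphs.

  threshold-below : ∀ q → ρ< F <ℚ q → ∃[ p ] 0ℚ ≤ p × p ≤ 1ℚ × p < q × ∃ (RichSuffices F p) × ∃ (AverageSuffices F p)
  threshold-below q ((n , G , e≢0) , ρ<q) = decide (1ℚ ℚ.<? q)
    where
    decide : Dec (1ℚ < q) → ∃[ p ] 0ℚ ≤ p × p ≤ 1ℚ × p < q × ∃ (RichSuffices F p) × ∃ (AverageSuffices F p)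
    decide (yes 1<q) = 1ℚ , 0≤1 , ℚ.≤-refl , 1<q ,
      ρ<-full (complete (2 ℕ.+ k)) {{K≢0}} (ρ-full<1 (complete (2 ℕ.+ k)) complete-adj F {{K≢0}})
      where K≢0 = e-full≢0 (complete (2 ℕ.+ k)) complete-adj
    decide (no 1≮q) =
      let p , ρ<p , p<q = ℚ.<-dense ρ<q
      in p , ℚ.≤-trans (0≤ρ F G {{e≢0}}) (ℚ.<⇒≤ ρ<p) , ℚ.≤-trans (ℚ.<⇒≤ p<q) (ℚ.≮⇒≥ 1≮q) , p<q , ρ<-full G {{e≢0}} ρ<p

  in-unit : ∀ {p} → 0ℚ ≤ p → p ≤ 1ℚ → fromℚ p ∈[0,1]
  in-unit 0≤p p≤1 = (λ q → ℚ.≤-<-trans 0≤p) , (λ q → ℚ.≤-<-trans p≤1)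

  average-infimum : IsInf (AverageThreshold F) (ρ< F)
  average-infimum = below , greatest
    where
    below : ∀ α → AverageThreshold F α → ρ< F ≤ᴿ α
    below α ((0≤α , _) , d₀ , contains) q α<q =
      let p , p<q , α<p = open′ α α<q
      in average⇒ρ< {d₀ = d₀} F
           (λ d d₀≤d H p≤ → contains d d₀≤d H (λ q′ avg<q′ → upward α (ℚ.≤-<-trans p≤ avg<q′) α<p)) p<q (0≤α q α<q)
    greatest : ∀ t → (∀ α → AverageThreshold F α → t ≤ᴿ α) → t ≤ᴿ ρ< F
    greatest t t≤ q ρ<q =
      let p , 0≤p , p≤1 , p<q , _ , d₀ , average = threshold-below q ρ<q
      in t≤ (fromℚ p) (in-unit 0≤p p≤1 , d₀ , λ d d₀≤d H p≤avg →
           average d d₀≤d H (ℚ.≮⇒≥ λ avg<p → ℚ.<-irrefl refl (p≤avg p avg<p))) q p<q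

  rich-infimum : IsInf (RichThreshold F) (ρ< F)
  rich-infimum = below , greatest
    where
    below : ∀ α → RichThreshold F α → ρ< F ≤ᴿ α
    below α ((0≤α , _) , C , contains) q α<q =
      let p , p<q , α<p = open′ α α<q
          -- Two gaps are needed: `p₀` replaces the real `α` by a rational density, and `p` pays for
          -- the passage to averages.
          p₀ , p₀<p , α<p₀ = open′ α α<p
          d₀ , average = rich⇒average p₀ (ℚ.<⇒≤ (0≤α p₀ α<p₀)) F {C} p₀<p
            (λ d H L C≤L rich → contains d H (L , C≤L , λ ℓ ℓ∈ → rich-from-density α H ℓ α<p₀ (rich ℓ ℓ∈)))
      in average⇒ρ< {d₀ = d₀} F average p<q (0≤α q α<q)
    greatest : ∀ t → (∀ α → RichThreshold F α → t ≤ᴿ α) → t ≤ᴿ ρ< F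
    greatest t t≤ q ρ<q =
      let p , 0≤p , p≤1 , p<q , (C , rich) , _ = threshold-below q ρ<q
      in t≤ (fromℚ p) (in-unit 0≤p p≤1 , C , λ d H (L , C≤L , rich-levels) →
           rich d H L C≤L (λ ℓ ℓ∈ → density-from-rich p H ℓ (rich-levels ℓ ℓ∈))) q p<q

theorem3p1 : ∀ {k : ℕ} (F : Graph (Fin k)) → IsInf (AverageThreshold F) (ρ< F) × IsInf (RichThreshold F) (ρ< F)
theorem3p1 F = average-infimum F , rich-infimum F
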